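{- For every graph $H$, there exists $\epsilon > 0$ such that for all $n > 1$, every $n$-vertex graph $G$ that contains, as an induced subgraph, neither a proper fuzzy odd subdivision of $H$ nor the complement of a proper fuzzy odd subdivision of $H$, contains two sets $A, B\subseteq V(G)$ of vertices such that $|A|, |B| \ge \epsilon n$ and $A$ is either complete or anticomplete to $B$.
   Context: Graphs are finite and simple. Two vertex sets $A,B\subseteq V(G)$ are complete if they are disjoint and every vertex of $A$ is adjacent to every vertex of $B$; they are anticomplete if they are disjoint and no vertex of $A$ is adjacent to a vertex of $B$. A fuzzy odd path is a graph obtained from a path of odd length by possibly adding one additional edge $uv$ between two internal vertices of the path, such that $uv$ is contained in a triangle (so $u,v$ are at distance two on the path). Its ends and its length are those of the underlying path. A graph $J$ is a proper fuzzy odd subdivision of a graph $H$ if $J$ can be obtained from $H$ by replacing each edge $xy$ of $H$ with a fuzzy odd path of length more than one with ends $x$ and $y$ (the replacing fuzzy paths being internally disjoint, with no further edges added). -}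

module Defs where

open import Data.Bool.Base using (Bool; T)
open import Data.Bool.Properties using (T?)
open import Data.Fin.Base using (Fin; zero; toℕ; fromℕ; _<_)
open import Data.Fin.Properties using (_≟_)
open import Data.Fin.Subset using (Subset; _∈_; _∩_; Empty)
open import Data.Integer.Base using (+_)
open import Data.Maybe.Base using (Maybe; just; nothing)
open import Data.Nat.Base as ℕ using (ℕ; suc)
open import Data.Nat.Divisibility using (_∤_)
open import Data.Product using (_×_; _,_; ∃-syntax; proj₁)
open import Data.Rational.Base using (ℚ; _/_)
open import Data.Sum.Base using (_⊎_)
open import Function.Base using (_∘_)
open import Function.Bundles using (_⇔_)
open import Function.Definitions using (Injective)
open import Relation.Binary.Core using (Rel)
open import Relation.Binary.Definitions using (Symmetric)
open import Relation.Binary.PropositionalEquality using (_≡_; _≢_; refl; sym)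
open import Relation.Nullary using (¬_)
open import Relation.Nullary.Decidable using (Dec; ¬?; _×-dec_; ⌊_⌋; toWitness; fromWitness)
open import Level using (0ℓ)

record Graph (n : ℕ) : Set where
  field
    adj : Fin n → Fin n → Bool

  Adj : Rel (Fin n) 0ℓ
  Adj u v = T (adj u v)

  field
    adj-sym    : Symmetric Adj
    adj-irrefl : ∀ u → ¬ Adj u u

open Graph public using (Adj)

complement : ∀ {n} → Graph n → Graph n
complement G = record
  { adj        = λ u v → ⌊ nonAdj? u v ⌋
  ; adj-sym    = λ {u} {v} p → let (u≢v , ¬uv) = toWitness {a? = nonAdj? u v} p in
                   fromWitness {a? = nonAdj? v u} (u≢v ∘ sym , ¬uv ∘ Graph.adj-sym G)
  ; adj-irrefl = λ u p → proj₁ (toWitness {a? = nonAdj? u u} p) refl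
  }
  where
  nonAdj? : ∀ u v → Dec (u ≢ v × ¬ Adj G u v)
  nonAdj? u v = ¬? (u ≟ v) ×-dec ¬? (T? (Graph.adj G u v))

InducedIn : ∀ {m n} → Graph m → Graph n → Set
InducedIn {m} {n} J G =
  ∃[ f ] Injective _≡_ _≡_ f × (∀ (u v : Fin m) → Adj J u v ⇔ Adj G (f u) (f v))

-- The path of length k has vertex set Fin (suc k), in order along the path.
PathAdj : ∀ {k} → Rel (Fin (suc k)) 0ℓ
PathAdj u v = suc (toℕ u) ≡ toℕ v ⊎ suc (toℕ v) ≡ toℕ u

Internal : ∀ {k} → Fin (suc k) → Set
Internal {k} i = i ≢ zero × i ≢ fromℕ k

AddEdge : ∀ {n} → Rel (Fin n) 0ℓ → Fin n → Fin n → Rel (Fin n) 0ℓ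
AddEdge R u v x y = R x y ⊎ (x ≡ u × y ≡ v) ⊎ (x ≡ v × y ≡ u)

record ExtraEdge (k : ℕ) : Set where
  field
    u v        : Fin (suc k)
    u-internal : Internal u
    v-internal : Internal v
    u≢v        : u ≢ v
    new        : ¬ PathAdj u v
    triangle   : ∃[ w ] AddEdge PathAdj u v u w × AddEdge PathAdj u v v w

record FuzzyOddPath : Set where
  field
    length : ℕ
    odd    : 2 ∤ length
    extra  : Maybe (ExtraEdge length)

  Vertex : Set
  Vertex = Fin (suc length)

FuzzyAdj : (P : FuzzyOddPath) → Rel (FuzzyOddPath.Vertex P) 0ℓ
FuzzyAdj record { extra = nothing } = PathAdj
FuzzyAdj record { extra = just e }  = AddEdge PathAdj (ExtraEdge.u e) (ExtraEdge.v e)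

-- Each edge is listed once, oriented from its smaller end.
record Edge {h} (H : Graph h) : Set where
  field
    lo hi    : Fin h
    lo<hi    : lo < hi
    adjacent : Adj H lo hi

record ProperFuzzyOddSubdivision {h m} (H : Graph h) (J : Graph m) : Set where
  field
    branch     : Fin h → Fin m
    branch-inj : Injective _≡_ _≡_ branch

    path   : Edge H → FuzzyOddPath
    proper : ∀ e → 1 ℕ.< FuzzyOddPath.length (path e)

    place     : ∀ e → FuzzyOddPath.Vertex (path e) → Fin m
    place-inj : ∀ e → Injective _≡_ _≡_ (place e)
    start     : ∀ e → place e zero ≡ branch (Edge.lo e)
    end       : ∀ e → place e (fromℕ _) ≡ branch (Edge.hi e)

    internal≢branch   : ∀ e i x → Internal i → place e i ≢ branch x
    internal-disjoint : ∀ e e′ i i′ → e ≢ e′ → Internal i → Internal i′ →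
                        place e i ≢ place e′ i′

    vertices : ∀ z → (∃[ x ] z ≡ branch x) ⊎ (∃[ e ] ∃[ i ] z ≡ place e i)
    edges    : ∀ z z′ → Adj J z z′ ⇔
               (∃[ e ] ∃[ i ] ∃[ i′ ] z ≡ place e i × z′ ≡ place e i′ × FuzzyAdj (path e) i i′)

ContainsSubdivision : ∀ {h n} → Graph h → Graph n → Set
ContainsSubdivision H G =
  ∃[ m ] ∃[ J ] ProperFuzzyOddSubdivision {m = m} H J × InducedIn J G

ContainsCoSubdivision : ∀ {h n} → Graph h → Graph n → Set
ContainsCoSubdivision H G =
  ∃[ m ] ∃[ J ] ProperFuzzyOddSubdivision {m = m} H J × InducedIn (complement J) G

Complete : ∀ {n} → Graph n → Subset n → Subset n → Set
Complete G A B = Empty (A ∩ B) × (∀ u v → u ∈ A → v ∈ B → Adj G u v)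

Anticomplete : ∀ {n} → Graph n → Subset n → Subset n → Set
Anticomplete G A B = Empty (A ∩ B) × (∀ u v → u ∈ A → v ∈ B → ¬ Adj G u v)

fromNat : ℕ → ℚ
fromNat n = + n / 1

{-# OPTIONS --safe #-}
module Submission where

-- Suppose there is no linear pure pair. By the greedy embedding argument of Rödl, either G contains a 3-subdivision of H,
-- or some linear set is sparse in G or in its complement Γ; there, any two sets of size at least u are joined by an edge, while
-- degrees are tiny compared with u.
--
-- A connected set K is grown until its neighbourhood has a few u vertices; that neighbourhood still reaches almost everything
-- else. Repeating this inside what is left yields many hubs: connected sets K, pairwise anticomplete, each
-- reached from a large set M by paths m — tl m — K whose interior vertices are rarely adjacent to those of other hubs. Call m and m′ in
-- contact if these tails touch. Contact is again sparse and coherent, and a merging game in which weights 2^degree never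
-- decrease produces induced stars in the contact graph, hence branch vertices whose legs end in different hubs.
--
-- To link two hubs, extend the second by a fresh connected set Kt, and look at the large set X of common neighbours of
-- the tails of the first hub and of the neighbourhood of Kt. If some x ∈ X gives a path of odd length we are done; otherwise
-- an edge u v inside X changes the parity, and choosing u and v on different sides of a minimal partial cover of X leaves at
-- most one chord, which closes a triangle. This is the fuzzy edge.

open import Defs
open import Data.Bool.Base using (Bool; true; false; T; not; _xor_)
open import Data.Bool.Properties using (T?; T-≡; T-irrelevant; not-involutive; not-¬; ¬-not; xor-same) renaming (_≟_ to _≟ᵇ_)
open import Data.Empty using (⊥; ⊥-elim)
open import Data.Fin.Base as Fin using (Fin; zero; suc; toℕ; fromℕ; punchIn; inject≤; splitAt; _↑ˡ_; _↑ʳ_; combine; remQuot)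
open import Data.Fin.Properties as Fin using (_≟_; any?; all?; ¬∀⟶∃¬; suc-injective; punchInᵢ≢i; punchIn-injective; inject≤-injective; combine-injective; remQuot-combine; splitAt-↑ˡ; splitAt-↑ʳ; <-cmp; <⇒≢; <-asym; <-irrelevant)
open import Data.List.Base using (List; []; _∷_; length; lookup; filter; allFin; _ʳ++_; map; tabulate; _++_)
open import Data.List.Properties using (length-++; length-ʳ++; length-tabulate)
open import Data.List.Membership.Propositional using (_∈_; _∉_; lose; find)
open import Data.List.Membership.Propositional.Properties using (∈-filter⁺; ∈-filter⁻; ∈-allFin; ∈-lookup; ∈-tabulate⁺; ∈-++⁺ˡ; ∈-++⁺ʳ)
open import Data.List.Relation.Unary.All as All using (All; []; _∷_)
import Data.List.Relation.Unary.All.Properties as All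
open import Data.List.Relation.Unary.AllPairs as AllPairs using (AllPairs; []; _∷_)
open import Data.List.Relation.Unary.Any as Any using (Any; here; there)
import Data.List.Relation.Unary.Any.Properties as Any
open import Data.List.Relation.Unary.Unique.Propositional using (Unique)
import Data.List.Relation.Unary.Unique.Propositional.Properties as Unique
open import Data.Maybe.Base using (just; nothing)
open import Data.Nat.Base as ℕ using (ℕ)
open import Data.Product using (Σ; _×_; _,_; ∃; ∃-syntax; proj₁; proj₂)
open import Data.Sum.Base using (_⊎_; inj₁; inj₂; [_,_]′; swap)
open import Data.Unit.Base using (⊤; tt)
open import Function.Base using (_∘_; id; case_of_)
open import Function.Bundles using (_⇔_; mk⇔; Equivalence)
open import Function.Definitions using (Injective)
open import Relation.Binary.Definitions using (tri<; tri≈; tri>)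
open import Relation.Binary.PropositionalEquality hiding (J)
open import Relation.Nullary using (¬_; Dec; yes; no; does; contradiction)
open import Relation.Nullary.Decidable using (_×-dec_; _⊎-dec_; _→-dec_; ¬?; map′; decidable-stable; does-⇔; dec-true; dec-false; toWitness; fromWitness)

-- All sizes are counted in units of `u`. A choice, be it a connected set or a bounded list of
-- vertices, spoils only a bounded number of units: connected sets are stopped once their
-- neighbourhood is large enough, and one vertex adds at most `d` to it. The number of choices
-- depends on `h` alone, so the constants are fixed backwards: what stars and links spend determines
-- `G`, which determines `L` and how thin the graph must be.
--
-- The obstacle is that nothing bounds the number of vertices of a connected set, hence neither the
-- length nor the parity of a path through it. Its neighbourhood therefore has to be deleted as a
-- whole, which cuts a finished hub off from the reservoir except through `M` and its tails. This is
-- why every hub keeps such a gate, and why a link needs a fresh connected set, whose neighbourhood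
-- is still present. Contacts between tails of the same hub are never controlled; they arise only
-- within one link, where an induced path is cut out afterwards.

module Combinatorics where

  open import Data.Nat.Base hiding (parity)
  open import Data.Nat.Divisibility using (_∤_; divides)
  open import Data.Nat.DivMod using (_/_; m*n/n≡m; /-monoˡ-≤; m/n*n≤m)
  open import Data.Nat.Properties hiding (_≟_; suc-injective; <-cmp; <⇒≢; <-asym; <-irrelevant)
  open import Algebra.Properties.CommutativeSemigroup +-commutativeSemigroup using () renaming (interchange to +-interchange)

  -- Counting in finite sets

  -- Membership is an arbitrary decidable predicate, so that each reason why a vertex lies in an
  -- iterated difference can be projected from its membership proof.
  record Sub (n : ℕ) : Set₁ where
    constructor sub
    field
      {Mem} : Fin n → Set
      mem?  : ∀ v → Dec (Mem v)

  open Sub public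

  infix 4 _∋_
  infixl 7 _∩_ _∖_

  _∋_ : ∀ {n} → Sub n → Fin n → Set
  A ∋ v = Mem A v

  _∩_ _∖_ : ∀ {n} → Sub n → Sub n → Sub n
  A ∩ B = sub λ v → mem? A v ×-dec mem? B v
  A ∖ B = sub λ v → mem? A v ×-dec ¬? (mem? B v)

  infix 4 _⊑_
  _⊑_ : ∀ {n} → Sub n → Sub n → Set
  A ⊑ B = ∀ v → A ∋ v → B ∋ v

  bit : ∀ {P : Set} → Dec P → ℕ
  bit (yes _) = 1
  bit (no _)  = 0

  bit≤1 : ∀ {P : Set} (p : Dec P) → bit p ≤ 1
  bit≤1 (yes _) = s≤s z≤n
  bit≤1 (no _)  = z≤n

  ∑ : ∀ {n} → (Fin n → ℕ) → ℕ
  ∑ {zero}  f = 0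
  ∑ {suc n} f = f zero + ∑ (f ∘ suc)

  ∑-mono : ∀ {n} {f g : Fin n → ℕ} → (∀ v → f v ≤ g v) → ∑ f ≤ ∑ g
  ∑-mono {zero}  f≤g = z≤n
  ∑-mono {suc n} f≤g = +-mono-≤ (f≤g zero) (∑-mono (f≤g ∘ suc))

  ∑-+ : ∀ {n} (f g : Fin n → ℕ) → ∑ (λ v → f v + g v) ≡ ∑ f + ∑ g
  ∑-+ {zero}  f g = refl
  ∑-+ {suc n} f g = trans (cong (f zero + g zero +_) (∑-+ (f ∘ suc) (g ∘ suc)))
                          (+-interchange (f zero) (g zero) (∑ (f ∘ suc)) (∑ (g ∘ suc)))

  ∑-0 : ∀ n → ∑ {n} (λ _ → 0) ≡ 0
  ∑-0 zero    = refl
  ∑-0 (suc n) = ∑-0 n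

  ∑-*ˡ : ∀ {n} k (f : Fin n → ℕ) → ∑ (λ v → k * f v) ≡ k * ∑ f
  ∑-*ˡ {zero}  k f = sym (*-zeroʳ k)
  ∑-*ˡ {suc n} k f = trans (cong (k * f zero +_) (∑-*ˡ k (f ∘ suc))) (sym (*-distribˡ-+ k (f zero) _))

  ∑-swap : ∀ {m n} (f : Fin m → Fin n → ℕ) → ∑ (λ a → ∑ (f a)) ≡ ∑ (λ b → ∑ (λ a → f a b))
  ∑-swap {zero}  {n} f = sym (∑-0 n)
  ∑-swap {suc m} f = trans (cong (∑ (f zero) +_) (∑-swap (f ∘ suc)))
                           (sym (∑-+ (f zero) (λ b → ∑ (λ a → f (suc a) b))))

  ∑-remove : ∀ {n} (f : Fin (suc n) → ℕ) i → ∑ f ≡ f i + ∑ (f ∘ punchIn i)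
  ∑-remove f zero = refl
  ∑-remove {suc n} f (suc i) = begin
    f zero + ∑ (f ∘ suc)                           ≡⟨ cong (f zero +_) (∑-remove (f ∘ suc) i) ⟩
    f zero + (f (suc i) + ∑ (f ∘ suc ∘ punchIn i)) ≡⟨ sym (+-assoc (f zero) _ _) ⟩
    f zero + f (suc i) + ∑ (f ∘ suc ∘ punchIn i)   ≡⟨ cong (_+ ∑ (f ∘ suc ∘ punchIn i)) (+-comm (f zero) (f (suc i))) ⟩
    f (suc i) + f zero + ∑ (f ∘ suc ∘ punchIn i)   ≡⟨ +-assoc (f (suc i)) _ _ ⟩
    f (suc i) + (f zero + ∑ (f ∘ suc ∘ punchIn i)) ∎
    where open ≡-Reasoning

  extend : ∀ {n} {P : Set} → Dec P → Sub n → Sub (suc n)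
  extend {n} {P} p? B = sub {Mem = M} λ where zero → p? ; (suc v) → mem? B v
    where
    M : Fin (suc n) → Set
    M zero    = P
    M (suc v) = B ∋ v

  fibre : ∀ {m n} (R : Fin m → Fin n → Set) (R? : ∀ a b → Dec (R a b)) → Sub m → Fin n → Sub m
  fibre R R? A b = sub λ a → mem? A a ×-dec R? a b

  cofibre : ∀ {m n} (R : Fin m → Fin n → Set) (R? : ∀ a b → Dec (R a b)) → Sub n → Fin m → Sub n
  cofibre R R? B a = sub λ b → mem? B b ×-dec R? a b

  abstract
    -- Kept abstract: later counting goes through the lemmas of this block, and only the comparison
    -- with `∣_∣` reopens the sum, by `size-∑`.
    size : ∀ {n} → Sub n → ℕ
    size A = ∑ (λ v → bit (mem? A v))

    size-∑ : ∀ {n} (A : Sub n) → size A ≡ ∑ (λ v → bit (mem? A v))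
    size-∑ A = refl

    size-all : ∀ {n} (A : Sub n) → (∀ v → A ∋ v) → n ≤ size A
    size-all {zero}  A f = z≤n
    size-all {suc n} A f with mem? A zero
    ... | yes _ = s≤s (size-all (sub (mem? A ∘ suc)) (f ∘ suc))
    ... | no ¬a = contradiction (f zero) ¬a

    size-cover : ∀ {n} (A B C : Sub n) → (∀ v → A ∋ v → B ∋ v ⊎ C ∋ v) → size A ≤ size B + size C
    size-cover A B C f = ≤-trans (∑-mono pt) (≤-reflexive (∑-+ (bit ∘ mem? B) (bit ∘ mem? C)))
      where
      pt : ∀ v → bit (mem? A v) ≤ bit (mem? B v) + bit (mem? C v)
      pt v with mem? A v | mem? B v | mem? C v
      ... | no _  | _     | _     = z≤n
      ... | yes _ | yes _ | _     = s≤s z≤n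
      ... | yes _ | no _  | yes _ = s≤s z≤n
      ... | yes a | no ¬b | no ¬c = [ (λ b → contradiction b ¬b) , (λ c → contradiction c ¬c) ]′ (f v a)

    size-mono : ∀ {n} (A B : Sub n) → A ⊑ B → size A ≤ size B
    size-mono A B f = ∑-mono pt
      where
      pt : ∀ v → bit (mem? A v) ≤ bit (mem? B v)
      pt v with mem? A v | mem? B v
      ... | no _  | _     = z≤n
      ... | yes _ | yes _ = s≤s z≤n
      ... | yes a | no ¬b = contradiction (f v a) ¬b

    size-disjoint : ∀ {n} (A B C : Sub n) → B ⊑ A → C ⊑ A → (∀ v → B ∋ v → C ∋ v → ⊥) → size B + size C ≤ size A
    size-disjoint A B C B⊑A C⊑A dis = ≤-trans (≤-reflexive (sym (∑-+ (bit ∘ mem? B) (bit ∘ mem? C)))) (∑-mono pt)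
      where
      pt : ∀ v → bit (mem? B v) + bit (mem? C v) ≤ bit (mem? A v)
      pt v with mem? B v | mem? C v | mem? A v
      ... | yes b | yes c | _     = ⊥-elim (dis v b c)
      ... | yes b | no _  | yes _ = s≤s z≤n
      ... | yes b | no _  | no ¬a = contradiction (B⊑A v b) ¬a
      ... | no _  | yes c | yes _ = s≤s z≤n
      ... | no _  | yes c | no ¬a = contradiction (C⊑A v c) ¬a
      ... | no _  | no _  | _     = z≤n

    size-split : ∀ {n} (A B : Sub n) → size A ≤ size (A ∩ B) + size (A ∖ B)
    size-split A B = size-cover A (A ∩ B) (A ∖ B) λ v a → case mem? B v of λ where
      (yes b) → inj₁ (a , b)
      (no ¬b) → inj₂ (a , ¬b)

    size-empty : ∀ {n} (A : Sub n) → (∀ v → ¬ (A ∋ v)) → size A ≡ 0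
    size-empty {n} A f = n≤0⇒n≡0 (≤-trans (∑-mono pt) (≤-reflexive (∑-0 n)))
      where
      pt : ∀ v → bit (mem? A v) ≤ 0
      pt v with mem? A v
      ... | yes a = contradiction a (f v)
      ... | no _  = z≤n

    size-∃ : ∀ {n} (A : Sub n) → 1 ≤ size A → ∃ (A ∋_)
    size-∃ A 1≤ with any? (mem? A)
    ... | yes p = p
    ... | no ¬p = contradiction (≤-trans 1≤ (≤-reflexive (size-empty A λ v a → ¬p (v , a)))) λ ()

    size-remove : ∀ {n} (A B : Sub n) a → A ∋ a → ¬ (B ∋ a) → B ⊑ A → suc (size B) ≤ size A
    size-remove {suc n} A B zero a ¬b B⊑A with mem? A zero | mem? B zero
    ... | no ¬a | _     = contradiction a ¬a
    ... | yes _ | yes b = contradiction b ¬b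
    ... | yes _ | no _  = s≤s (size-mono (sub (mem? B ∘ suc)) (sub (mem? A ∘ suc)) (B⊑A ∘ suc))
    size-remove {suc n} A B (suc v) a ¬b B⊑A = ≤-trans (≤-reflexive (sym (+-suc _ _)))
      (+-mono-≤ hd (size-remove (sub (mem? A ∘ suc)) (sub (mem? B ∘ suc)) v a ¬b (B⊑A ∘ suc)))
      where
      hd : bit (mem? B zero) ≤ bit (mem? A zero)
      hd with mem? B zero | mem? A zero
      ... | no _  | _     = z≤n
      ... | yes _ | yes _ = s≤s z≤n
      ... | yes b | no ¬a = contradiction (B⊑A zero b) ¬a

    size-single : ∀ {n} (A : Sub n) a → (∀ v → A ∋ v → v ≡ a) → size A ≤ 1
    size-single {suc n} A zero f = +-mono-≤ {bit (mem? A zero)} {1} (bit≤1 (mem? A zero)) (≤-reflexive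
      (size-empty (sub (mem? A ∘ suc)) λ v av → case f (suc v) av of λ ()))
    size-single {suc n} A (suc a) f = +-mono-≤ {bit (mem? A zero)} {0} hd
      (size-single (sub (mem? A ∘ suc)) a λ v av → Fin.suc-injective (f (suc v) av))
      where
      hd : bit (mem? A zero) ≤ 0
      hd with mem? A zero
      ... | yes a0 = case f zero a0 of λ ()
      ... | no _   = z≤n

    size-⋃ : ∀ {n N k} (P : Fin N → Sub n) → (∀ j → size (P j) ≤ k) → size (sub λ v → any? λ j → mem? (P j) v) ≤ N * k
    size-⋃ {N = zero}  P f = ≤-reflexive (size-empty (sub λ v → any? λ j → mem? (P j) v) λ v → λ ())
    size-⋃ {N = suc N} P f = ≤-trans
      (size-cover (sub λ v → any? λ j → mem? (P j) v) (P zero) (sub λ v → any? λ j → mem? (P (suc j)) v)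
        λ where v (zero , p) → inj₁ p ; v (suc j , p) → inj₂ (j , p))
      (+-mono-≤ (f zero) (size-⋃ (P ∘ suc) (f ∘ suc)))

    -- Double counting of the pairs of `R` between `A` and `B`: each counted `b` contributes at
    -- least `t` of them, each `a` at most `k`.
    markov : ∀ {m n} (A : Sub m) (B : Sub n) {R : Fin m → Fin n → Set} (R? : ∀ a b → Dec (R a b)) {k} t →
             (∀ a → A ∋ a → size (cofibre R R? B a) ≤ k) →
             size (sub λ b → mem? B b ×-dec (t ≤? size (fibre R R? A b))) * t ≤ size A * k
    markov {m} {n} A B {R} R? {k} t f = begin
      size Bad * t                                            ≡⟨ *-comm (size Bad) t ⟩
      t * size Bad                                            ≡⟨ sym (∑-*ˡ t (bit ∘ mem? Bad)) ⟩
      ∑ (λ b → t * bit (mem? Bad b))                          ≤⟨ ∑-mono low ⟩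
      ∑ (λ b → ∑ (λ a → F a b))                               ≡⟨ sym (∑-swap F) ⟩
      ∑ (λ a → ∑ (λ b → F a b))                               ≤⟨ ∑-mono high ⟩
      ∑ (λ a → k * bit (mem? A a))                            ≡⟨ ∑-*ˡ k (bit ∘ mem? A) ⟩
      k * size A                                              ≡⟨ *-comm k (size A) ⟩
      size A * k                                              ∎
      where
      open ≤-Reasoning
      Bad : Sub n
      Bad = sub λ b → mem? B b ×-dec (t ≤? size (fibre R R? A b))
      F : Fin m → Fin n → ℕ
      F a b = bit (mem? A a ×-dec (mem? B b ×-dec R? a b))
      low : ∀ b → t * bit (mem? Bad b) ≤ ∑ (λ a → F a b)
      low b with mem? Bad b
      ... | no _ = ≤-trans (≤-reflexive (*-zeroʳ t)) z≤n
      ... | yes (bb , t≤) = ≤-trans (≤-reflexive (*-identityʳ t)) (≤-trans t≤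
        (size-mono (fibre R R? A b) (sub λ a → mem? A a ×-dec (mem? B b ×-dec R? a b)) λ v (av , r) → av , bb , r))
      high : ∀ a → ∑ (λ b → F a b) ≤ k * bit (mem? A a)
      high a with mem? A a in eq
      ... | no ¬a = ≤-trans (≤-reflexive (size-empty {n} (sub {Mem = λ b → A ∋ a × B ∋ b × R a b} λ b → no ¬a ×-dec (mem? B b ×-dec R? a b)) λ v p → ¬a (proj₁ p))) z≤n
      ... | yes aa = ≤-trans (≤-trans
        (size-mono (sub {Mem = λ b → A ∋ a × B ∋ b × R a b} λ b → yes aa ×-dec (mem? B b ×-dec R? a b)) (cofibre R R? B a) λ v → proj₂) (f a aa)) (≤-reflexive (sym (*-identityʳ k)))

    subset-of-size : ∀ {n} (A : Sub n) k → k ≤ size A → ∃[ B ] B ⊑ A × size B ≡ k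
    subset-of-size {n} A zero    _   = sub {Mem = λ _ → ⊥} (λ _ → no λ ()) , (λ _ ()) ,
      size-empty (sub {Mem = λ (_ : Fin n) → ⊥} (λ _ → no λ ())) (λ _ ())
    subset-of-size {suc n} A (suc k) k≤ with mem? A zero
    ... | yes a with subset-of-size (sub (mem? A ∘ suc)) k (s≤s⁻¹ k≤)
    ...   | B , B⊑A , sz = extend (yes a) B , (λ { zero b → b ; (suc v) b → B⊑A v b }) , cong suc sz
    subset-of-size {suc n} A (suc k) k≤ | no ¬a with subset-of-size (sub (mem? A ∘ suc)) (suc k) k≤
    ...   | B , B⊑A , sz = extend {P = ⊥} (no λ ()) B , (λ { (suc v) b → B⊑A v b }) , sz

  toList : ∀ {n} → Sub n → List (Fin n)
  toList {n} A = filter (mem? A) (allFin n)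

  toList⁺ : ∀ {n} (A : Sub n) {v} → A ∋ v → v ∈ toList A
  toList⁺ A {v} a = ∈-filter⁺ (mem? A) (∈-allFin v) a

  toList⁻ : ∀ {n} (A : Sub n) {v} → v ∈ toList A → A ∋ v
  toList⁻ {n} A v∈ = proj₂ (∈-filter⁻ (mem? A) {xs = allFin n} v∈)

  -- A discrete intermediate value principle: a list is a history of insertions, and the answer is a
  -- moment at which `Stop` becomes true. As `ys` still fails, a threshold in `Stop` is exceeded by
  -- no more than the contribution of `y`.
  first-suffix : ∀ {ℓ} {X : Set ℓ} (Stop : List X → Set) (stop? : ∀ xs → Dec (Stop xs)) (Pr : List X → Set) →
                 (∀ x xs → Pr (x ∷ xs) → Pr xs) → ∀ xs → Pr xs → Stop xs → ¬ Stop [] →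
                 ∃[ y ] ∃[ ys ] ¬ Stop ys × Stop (y ∷ ys) × Pr (y ∷ ys)
  first-suffix Stop stop? Pr tl []       pr st ¬st = contradiction st ¬st
  first-suffix Stop stop? Pr tl (x ∷ xs) pr st ¬st with stop? xs
  ... | yes st′ = first-suffix Stop stop? Pr tl xs (tl x xs pr) st′ ¬st
  ... | no ¬st′ = x , xs , ¬st′ , st , pr

  -- Connected sets in sparse coherent graphs

  list∈? : ∀ {n} (v : Fin n) ys → Dec (v ∈ ys)
  list∈? v = Any.any? (v ≟_)

  LSub : ∀ {n} → List (Fin n) → Sub n
  LSub ys = sub λ v → list∈? v ys

  size-∷ : ∀ {n} (y : Fin n) ys → size (LSub (y ∷ ys)) ≤ suc (size (LSub ys))
  size-∷ y ys = ≤-trans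
    (size-cover (LSub (y ∷ ys)) (sub λ v → v ≟ y) (LSub ys) λ where v (here p) → inj₁ p ; v (there p) → inj₂ p)
    (+-monoˡ-≤ _ (size-single (sub λ v → v ≟ y) y λ v p → p))

  module _ {n : ℕ} (Γ : Graph n) where

    -- Near is adjacency or equality, so that vertices far from each other are in particular distinct.
    Near : Fin n → Fin n → Set
    Near x y = x ≡ y ⊎ Adj Γ x y

    near? : ∀ x y → Dec (Near x y)
    near? x y = (x ≟ y) ⊎-dec T? (Graph.adj Γ x y)

    Far : Fin n → Fin n → Set
    Far x y = ¬ Near x y

    near-sym : ∀ {x y} → Near x y → Near y x
    near-sym (inj₁ refl) = inj₁ refl
    near-sym (inj₂ a)    = inj₂ (Graph.adj-sym Γ a)

    far-sym : ∀ {x y} → Far x y → Far y x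
    far-sym f = f ∘ near-sym

    near⇒adj : ∀ {x y} → Near x y → x ≢ y → Adj Γ x y
    near⇒adj (inj₁ e) ne = contradiction e ne
    near⇒adj (inj₂ a) ne = a

    Cov : List (Fin n) → Sub n
    Cov ys = sub λ v → Any.any? (λ y → near? y v) ys

    ¬Cov⇒far : ∀ {ys v y} → ¬ (Cov ys ∋ v) → y ∈ ys → Far y v
    ¬Cov⇒far ¬c y∈ nr = ¬c (lose y∈ nr)

    Touches : List (Fin n) → Fin n → Set
    Touches K x = Any (λ y → Adj Γ y x) K

    touches? : ∀ K x → Dec (Touches K x)
    touches? K x = Any.any? (λ y → T? (Graph.adj Γ y x)) K

    -- Connected lists grow by consing, so every nonempty suffix is again connected with the same root.
    data Conn (v : Fin n) : List (Fin n) → Set where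
      root : Conn v (v ∷ [])
      step : ∀ {x K} → Conn v K → Touches K x → Conn v (x ∷ K)

    root∈ : ∀ {v K} → Conn v K → v ∈ K
    root∈ root       = here refl
    root∈ (step c _) = there (root∈ c)

    SConn : Fin n → List (Fin n) → Set
    SConn v K = K ≡ [] ⊎ Conn v K

    sconn-tail : ∀ {v} x K → SConn v (x ∷ K) → SConn v K
    sconn-tail x .[] (inj₂ root)       = inj₁ refl
    sconn-tail x K   (inj₂ (step c _)) = inj₂ c

    to-root : ∀ {P : Fin n → Set} {v K} → (∀ {x y} → x ∈ K → y ∈ K → Adj Γ x y → P x → P y) → Conn v K →
              ∀ {y} → y ∈ K → P y → P v
    to-root cl root (here refl) p = p
    to-root cl (step c t) (here refl) p with find t
    ... | y , y∈ , a = to-root (λ x∈ y∈ → cl (there x∈) (there y∈)) c y∈ (cl (here refl) (there y∈) (Graph.adj-sym Γ a) p)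
    to-root cl (step c t) (there y∈) p = to-root (λ x∈ y∈ → cl (there x∈) (there y∈)) c y∈ p

    from-root : ∀ {P : Fin n → Set} {v K} → (∀ {x y} → x ∈ K → y ∈ K → Adj Γ x y → P x → P y) → Conn v K →
                P v → ∀ {y} → y ∈ K → P y
    from-root cl root p (here refl) = p
    from-root cl (step c t) p (here refl) with find t
    ... | y , y∈ , a = cl (there y∈) (here refl) a (from-root (λ x∈ y∈ → cl (there x∈) (there y∈)) c p y∈)
    from-root cl (step c t) p (there y∈) = from-root (λ x∈ y∈ → cl (there x∈) (there y∈)) c p y∈

    -- The property travels through the root. It will be reachability of a far end by an induced
    -- path, so that one entrance to `K` serves all its vertices.
    conn-spread : ∀ {P : Fin n → Set} {v K} → (∀ {x y} → x ∈ K → y ∈ K → Adj Γ x y → P x → P y) → Conn v K →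
                  ∀ {y z} → y ∈ K → z ∈ K → P y → P z
    conn-spread {P} cl c y∈ z∈ p = from-root {P} cl c (to-root {P} cl c y∈ p) z∈

    record Component (R : Sub n) (v : Fin n) : Set where
      field
        verts  : List (Fin n)
        conn   : Conn v verts
        inside : All (R ∋_) verts
        closed : ∀ {x y} → x ∈ verts → R ∋ y → Adj Γ x y → y ∈ verts

    private
      saturate : ∀ (R : Sub n) v K fuel → size (R ∖ LSub K) ≤ fuel → Conn v K → All (R ∋_) K → Component R v
      saturate R v K fuel sz c al with any? (λ x → mem? R x ×-dec (¬? (list∈? x K) ×-dec touches? K x))
      ... | no none = record { verts = K ; conn = c ; inside = al
        ; closed = λ {x} {y} x∈ y∈R a → decidable-stable (list∈? y K) λ y∉ → none (y , y∈R , y∉ , lose x∈ a) }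
      ... | yes (x , x∈R , x∉K , t) with size-remove (R ∖ LSub K) (R ∖ LSub (x ∷ K)) x (x∈R , x∉K)
                                          (λ p → proj₂ p (here refl)) (λ w p → proj₁ p , proj₂ p ∘ there)
      ...   | lt with fuel
      ...     | zero  = contradiction (≤-trans lt sz) λ ()
      ...     | suc f = saturate R v (x ∷ K) f (s≤s⁻¹ (≤-trans lt sz)) (step c t) (x∈R ∷ al)

    component : ∀ R v → R ∋ v → Component R v
    component R v r = saturate R v (v ∷ []) (size (R ∖ LSub (v ∷ []))) ≤-refl root (r ∷ [])

    -- `coh` lets a set of size `u` reach all but fewer than `u` vertices of any other set, while
    -- `deg` will make a single vertex negligible on the scale of `u`. Degrees count the vertex
    -- itself, as `Near` includes equality.
    record Sparse (V₀ : Sub n) (d u : ℕ) : Set₁ where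
      field
        1≤d  : 1 ≤ d
        d≤u  : d ≤ u
        deg  : ∀ v → V₀ ∋ v → size (sub λ x → mem? V₀ x ×-dec near? v x) ≤ d
        coh  : ∀ (A B : Sub n) → A ⊑ V₀ → B ⊑ V₀ → u ≤ size A → u ≤ size B →
               ∃[ a ] ∃[ b ] A ∋ a × B ∋ b × Near a b

    module SparseProps {V₀ d u} (Sp : Sparse V₀ d u) where
      open Sparse Sp public

      1≤u : 1 ≤ u
      1≤u = ≤-trans 1≤d d≤u

      uncovered : ∀ ys (B : Sub n) → All (V₀ ∋_) ys → B ⊑ V₀ → u ≤ size (LSub ys) → size (B ∖ Cov ys) < u
      uncovered ys B al B⊑ u≤ with size (B ∖ Cov ys) <? u
      ... | yes p = p
      ... | no ¬p with coh (LSub ys) (B ∖ Cov ys) (λ v → All.lookup al) (λ v p → B⊑ v (proj₁ p)) u≤ (≮⇒≥ ¬p)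
      ...   | a , b , a∈ , (_ , b∉) , nr = contradiction (lose a∈ nr) b∉

      cov-∷ : ∀ y ys (B : Sub n) → V₀ ∋ y → B ⊑ V₀ → size (B ∩ Cov (y ∷ ys)) ≤ size (B ∩ Cov ys) + d
      cov-∷ y ys B y∈ B⊑ = ≤-trans
        (size-cover (B ∩ Cov (y ∷ ys)) (B ∩ Cov ys) (sub λ x → mem? V₀ x ×-dec near? y x)
           λ where v (b , here p) → inj₂ (B⊑ v b , p) ; v (b , there p) → inj₁ (b , p))
        (+-monoʳ-≤ _ (deg y y∈))

      BigComponent : Sub n → Fin n → Set
      BigComponent R v = Σ (Component R v) λ C → u ≤ size (LSub (Component.verts C))

      -- Small components are merged one at a time into a closed set Q; coherence keeps Q small, as R ∖ Q is large.
      abstract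
        big-components : ∀ (R : Sub n) → R ⊑ V₀ → 3 * u ≤ size R →
                         ∃[ Q ] size Q < u × (∀ v → R ∋ v → Q ∋ v ⊎ BigComponent R v)
        big-components R R⊑ 3u≤ = let (Q , _ , _ , sz , f) = go (allFin n) in Q , sz , λ v r → f v r (∈-allFin v)
          where
          go : ∀ vs → ∃[ Q ] Q ⊑ R × (∀ {x y} → Q ∋ x → R ∋ y → Adj Γ x y → Q ∋ y) × size Q < u ×
                             (∀ v → R ∋ v → v ∈ vs → Q ∋ v ⊎ BigComponent R v)
          go [] = LSub [] , (λ _ ()) , (λ ()) , ≤-trans (s≤s (≤-reflexive (size-empty (LSub {n} []) λ _ ()))) 1≤u , λ _ _ ()
          go (v ∷ vs) with go vs
          ... | Q , Q⊑ , cl , sz , f with mem? R v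
          ...   | no ¬r = Q , Q⊑ , cl , sz , λ where
                  w r (here refl) → contradiction r ¬r
                  w r (there w∈)  → f w r w∈
          ...   | yes r with component R v r
          ...     | C with u ≤? size (LSub (Component.verts C))
          ...       | yes big = Q , Q⊑ , cl , sz , λ where
                      w r (here refl) → inj₂ (C , big)
                      w r (there w∈)  → f w r w∈
          ...       | no ¬big = Q′ , Q′⊑ , cl′ , sz′ , λ where
                      w r (here refl) → inj₁ (inj₂ (root∈ (Component.conn C)))
                      w r (there w∈)  → [ inj₁ ∘ inj₁ , inj₂ ]′ (f w r w∈)
            where
            K : List (Fin n)
            K = Component.verts C
            Q′ : Sub n
            Q′ = sub λ x → mem? Q x ⊎-dec list∈? x K
            Q′⊑ : Q′ ⊑ R
            Q′⊑ x (inj₁ q) = Q⊑ x q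
            Q′⊑ x (inj₂ k) = All.lookup (Component.inside C) k
            cl′ : ∀ {x y} → Q′ ∋ x → R ∋ y → Adj Γ x y → Q′ ∋ y
            cl′ (inj₁ q) ry a = inj₁ (cl q ry a)
            cl′ (inj₂ k) ry a = inj₂ (Component.closed C k ry a)
            2u : size Q′ ≤ u + u
            2u = ≤-trans (size-cover Q′ Q (LSub K) λ _ → id) (+-mono-≤ (<⇒≤ sz) (≰⇒≥ ¬big))
            rest : u ≤ size (R ∖ Q′)
            rest = +-cancelˡ-≤ (u + u) u _ (begin
              u + u + u                   ≡⟨ +-assoc u u u ⟩
              u + (u + u)                 ≡⟨ cong (λ z → u + (u + z)) (sym (+-identityʳ u)) ⟩
              3 * u                       ≤⟨ 3u≤ ⟩
              size R                      ≤⟨ size-cover R Q′ (R ∖ Q′) (λ x rx → case mem? Q′ x of λ where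
                                               (yes q) → inj₁ q
                                               (no ¬q) → inj₂ (rx , ¬q)) ⟩
              size Q′ + size (R ∖ Q′)     ≤⟨ +-monoˡ-≤ _ 2u ⟩
              u + u + size (R ∖ Q′)       ∎)
              where open ≤-Reasoning
            sz′ : size Q′ < u
            sz′ with size Q′ <? u
            ... | yes p = p
            ... | no ¬p with coh Q′ (R ∖ Q′) (λ x q → R⊑ x (Q′⊑ x q)) (λ x p → R⊑ x (proj₁ p)) (≮⇒≥ ¬p) rest
            ...   | a , b , qa , (rb , ¬qb) , inj₁ refl = contradiction qa ¬qb
            ...   | a , b , qa , (rb , ¬qb) , inj₂ adj  = contradiction (cl′ qa rb adj) ¬qb

      record Grown (R V : Sub n) (v : Fin n) (g : ℕ) : Set where
        field
          verts  : List (Fin n)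
          conn   : Conn v verts
          inside : All (R ∋_) verts
          small  : size (LSub verts) ≤ u
          lower  : g * u ≤ size (V ∩ Cov verts)
          upper  : size (V ∩ Cov verts) ≤ g * u + d

      abstract
        -- A big component is rebuilt vertex by vertex until it covers `g * u` vertices of `V` or
        -- has `u` vertices itself. The second event implies the first, since `u` vertices leave
        -- fewer than `u` uncovered; the last vertex covers at most `d` more.
        grow : ∀ {R V v} g → R ⊑ V₀ → V ⊑ V₀ → 1 ≤ g → suc g * u ≤ size V → BigComponent R v → Grown R V v g
        grow {R} {V} {v} g R⊑ V⊑ 1≤g sz (C , big)
          with first-suffix Stop stop? Pr tl (Component.verts C) (inj₂ (Component.conn C) , Component.inside C) (inj₂ big) start
          where
          Stop : List (Fin n) → Set
          Stop K = g * u ≤ size (V ∩ Cov K) ⊎ u ≤ size (LSub K)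
          stop? : ∀ K → Dec (Stop K)
          stop? K = (g * u ≤? size (V ∩ Cov K)) ⊎-dec (u ≤? size (LSub K))
          Pr : List (Fin n) → Set
          Pr K = SConn v K × All (R ∋_) K
          tl : ∀ x K → Pr (x ∷ K) → Pr K
          tl x K (s , _ ∷ al) = sconn-tail x K s , al
          start : ¬ Stop []
          start (inj₁ p) = contradiction (≤-trans (*-mono-≤ 1≤g 1≤u) (≤-trans p (≤-reflexive (size-empty (V ∩ Cov []) λ _ → λ ())))) λ ()
          start (inj₂ p) = contradiction (≤-trans 1≤u (≤-trans p (≤-reflexive (size-empty (LSub {n} []) λ _ ())))) λ ()
        ... | y , ys , ¬st , st , inj₂ c , al@(ry ∷ als) = record
          { verts = y ∷ ys ; conn = c ; inside = al
          ; small = ≤-trans (size-∷ y ys) (≰⇒> (¬st ∘ inj₂))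
          ; lower = lw st
          ; upper = ≤-trans (cov-∷ y ys V (R⊑ y ry) V⊑) (+-monoˡ-≤ d (<⇒≤ (≰⇒> (¬st ∘ inj₁))))
          }
          where
          lw : g * u ≤ size (V ∩ Cov (y ∷ ys)) ⊎ u ≤ size (LSub (y ∷ ys)) → g * u ≤ size (V ∩ Cov (y ∷ ys))
          lw (inj₁ p) = p
          lw (inj₂ p) = +-cancelˡ-≤ u _ _ (begin
            u + g * u                                             ≤⟨ sz ⟩
            size V                                                ≤⟨ size-split V (Cov (y ∷ ys)) ⟩
            size (V ∩ Cov (y ∷ ys)) + size (V ∖ Cov (y ∷ ys))     ≤⟨ +-monoʳ-≤ _ (<⇒≤ (uncovered (y ∷ ys) V (All.map (R⊑ _) al) V⊑ p)) ⟩
            size (V ∩ Cov (y ∷ ys)) + u                           ≡⟨ +-comm _ u ⟩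
            u + size (V ∩ Cov (y ∷ ys))                           ∎)
            where open ≤-Reasoning

      record Pruned (C R : Sub n) (G : ℕ) : Set where
        field
          verts  : List (Fin n)
          inside : All (C ∋_) verts
          lower  : G * u ≤ size (R ∩ Cov verts)
          upper  : size (R ∩ Cov verts) ≤ G * u + d

      abstract
        -- The same stopping argument without connectivity, which tails do not need, each being
        -- attached to the connected set by itself. The lower bound makes `M` large, the upper one
        -- preserves the reservoir.
        prune : ∀ C R G → C ⊑ V₀ → R ⊑ V₀ → 1 ≤ G → u ≤ size C → suc G * u ≤ size R → Pruned C R G
        prune C R G C⊑ R⊑ 1≤G big sz
          with first-suffix Stop stop? (All (C ∋_)) (λ where _ _ (_ ∷ al) → al) (toList C) (All.tabulate (toList⁻ C)) full start
          where
          Stop : List (Fin n) → Set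
          Stop K = G * u ≤ size (R ∩ Cov K)
          stop? : ∀ K → Dec (Stop K)
          stop? K = G * u ≤? size (R ∩ Cov K)
          start : ¬ Stop []
          start p = contradiction (≤-trans (*-mono-≤ 1≤G 1≤u) (≤-trans p (≤-reflexive (size-empty (R ∩ Cov []) λ _ → λ ())))) λ ()
          K : List (Fin n)
          K = toList C
          full : Stop K
          full = +-cancelˡ-≤ u _ _ (begin
            u + G * u                         ≤⟨ sz ⟩
            size R                            ≤⟨ size-split R (Cov K) ⟩
            size (R ∩ Cov K) + size (R ∖ Cov K) ≤⟨ +-monoʳ-≤ _ (<⇒≤ (uncovered K R (All.tabulate (C⊑ _ ∘ toList⁻ C)) R⊑
                                                   (≤-trans big (size-mono C (LSub K) λ v → toList⁺ C)))) ⟩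
            size (R ∩ Cov K) + u              ≡⟨ +-comm _ u ⟩
            u + size (R ∩ Cov K)              ∎)
            where open ≤-Reasoning
        ... | y , ys , ¬st , st , al@(cy ∷ _) = record
          { verts = y ∷ ys ; inside = al ; lower = st
          ; upper = ≤-trans (cov-∷ y ys R (C⊑ y cy) R⊑) (+-monoˡ-≤ d (<⇒≤ (≰⇒> ¬st))) }

  -- Hubs

  module _ {n : ℕ} (Γ : Graph n) where

    abstract
      -- The value `m` at uncovered vertices is a default: both lemmas about `parent` assume
      -- `Cov Γ W ∋ m`.
      parent : List (Fin n) → Fin n → Fin n
      parent W m with mem? (Cov Γ W) m
      ... | yes p = proj₁ (find p)
      ... | no _  = m

      parent∈ : ∀ W {m} → Cov Γ W ∋ m → parent W m ∈ W
      parent∈ W {m} c with mem? (Cov Γ W) m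
      ... | yes p = proj₁ (proj₂ (find p))
      ... | no ¬c = contradiction c ¬c

      parent-near : ∀ W {m} → Cov Γ W ∋ m → Near Γ (parent W m) m
      parent-near W {m} c with mem? (Cov Γ W) m
      ... | yes p = proj₂ (proj₂ (find p))
      ... | no ¬c = contradiction c ¬c

    touch-outside : ∀ {K c} → Cov Γ K ∋ c → c ∉ K → Touches Γ K c
    touch-outside c∈ c∉ with find c∈
    ... | y , y∈ , nr = lose y∈ (near⇒adj Γ nr λ where refl → c∉ y∈)

    -- The neighbourhood of `K` is deleted, so later vertices cannot enter `K` directly: the way in
    -- leads from a member `m` of `M` to `tl m`, and only from there to `K`.
    record Hub (V₀ : Sub n) (s : ℕ) : Set₁ where
      field
        K    : List (Fin n)
        {kr} : Fin n
        conn : Conn Γ kr K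
        M    : Sub n
        M≤   : size M ≤ s
        tl   : Fin n → Fin n
        tl∈  : ∀ {m} → M ∋ m → V₀ ∋ tl m
        tl-m : ∀ {m} → M ∋ m → Adj Γ (tl m) m
        tl-K : ∀ {m} → M ∋ m → Touches Γ K (tl m)

    tails-at : ∀ {V₀ s} → Hub V₀ s → Fin n → Sub n
    tails-at H v = sub λ m → mem? (Hub.M H) m ×-dec near? Γ (Hub.tl H m) v

    -- Tails of different hubs may touch. Only `few` restrains this, and it is directed, so both
    -- orders of two hubs have to be treated.
    record Apart {V₀ s} (u : ℕ) (H H′ : Hub V₀ s) : Set where
      open Hub
      field
        K-K    : ∀ {x y} → x ∈ K H → y ∈ K H′ → Far Γ x y
        K-tl   : ∀ {x m} → x ∈ K H → M H′ ∋ m → Far Γ x (tl H′ m)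
        tl≢tl  : ∀ {m m′} → M H ∋ m → M H′ ∋ m′ → tl H m ≢ tl H′ m′
        M#M    : ∀ {m} → M H ∋ m → M H′ ∋ m → ⊥
        few    : size (sub λ m → mem? (M H) m ×-dec (u ≤? size (tails-at H′ (tl H m)))) ≤ u

    -- Two nested reservoirs. `V` is far from the old connected sets, which suffices for new tails;
    -- `R` is moreover far from the old tails and disjoint from the old `M`, as required of new
    -- connected sets and new members. Old members stay available as long as they lie in `V`.
    record State (V₀ : Sub n) (s u : ℕ) (k : ℕ) : Set₁ where
      field
        V R   : Sub n
        V⊑    : V ⊑ V₀
        R⊑    : R ⊑ V
        hub   : Fin k → Hub V₀ s
        apart : ∀ {i j} → i ≢ j → Apart u (hub i) (hub j)
        V-K   : ∀ {v i x} → V ∋ v → x ∈ Hub.K (hub i) → Far Γ x v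
        V-tl  : ∀ {v i m} → V ∋ v → Hub.M (hub i) ∋ m → v ≢ Hub.tl (hub i) m
        R-tl  : ∀ {r i m} → R ∋ r → Hub.M (hub i) ∋ m → Far Γ (Hub.tl (hub i) m) r
        R-M   : ∀ {r i} → R ∋ r → Hub.M (hub i) ∋ r → ⊥

    module _ {V₀ d u} (Sp : Sparse Γ V₀ d u) where
      open SparseProps Γ Sp

      module Construction (G N L : ℕ) (1≤G : 1 ≤ G) (thin : suc G * (suc G * d) ≤ u) where

        g cost s t : ℕ
        -- Of the `g * u` vertices covered by a new connected set, `u` may lie in the set itself and
        -- `N * u` may be crowded by older tails; `u` candidates for tails remain. A hub removes
        -- from `R` at most `suc g` units around `K` and `suc G` around its tails, in total `cost`.
        g    = 2 + N
        cost = suc g + suc G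
        s    = G * u + d
        t    = suc G * d

        -- By Markov's inequality at most u vertices are near t or more of the tails of a hub, and t is small enough that a
        -- second application bounds contacts in the other direction.
        s≤ : s ≤ suc G * u
        s≤ = ≤-trans (≤-reflexive (+-comm (G * u) d)) (+-monoˡ-≤ (G * u) d≤u)

        1≤t : 1 ≤ t
        1≤t = ≤-trans 1≤d (m≤m+n d (G * d))

        t≤u : t ≤ u
        t≤u = ≤-trans (m≤m+n t (G * t)) thin

        crowded-few : ∀ (H : Hub V₀ s) (B : Sub n) → B ⊑ V₀ → size (sub λ c → mem? B c ×-dec (t ≤? size (tails-at H c))) ≤ u
        crowded-few H B B⊑ = *-cancelʳ-≤ _ u t ⦃ >-nonZero 1≤t ⦄ (begin
          size Bad * t         ≤⟨ markov M B (λ m c → near? Γ (tl m) c) t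
                                    (λ m m∈ → ≤-trans (size-mono _ _ λ c p → B⊑ c (proj₁ p) , proj₂ p) (deg (tl m) (tl∈ m∈))) ⟩
          size M * d           ≤⟨ *-monoˡ-≤ d (≤-trans M≤ s≤) ⟩
          suc G * u * d        ≡⟨ cong (_* d) (*-comm (suc G) u) ⟩
          u * suc G * d        ≡⟨ *-assoc u (suc G) d ⟩
          u * t                ∎)
          where
          open Hub H
          open ≤-Reasoning
          Bad = sub λ c → mem? B c ×-dec (t ≤? size (tails-at H c))

        -- Members near new tails stay in `V`, so old members are lost only to the neighbourhoods of
        -- new connected sets; hence the smaller rate `suc g` in `M-size`.
        record Sized (k : ℕ) (S : State V₀ s u k) : Set where
          open State S
          field
            R-size : L * u ≤ size R + k * cost * u
            M-size : ∀ i → G * u ≤ size (Hub.M (hub i) ∩ V) + k * suc g * u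

        initial : L * u ≤ size V₀ → Σ (State V₀ s u 0) (Sized 0)
        initial L≤ = record
          { V = V₀ ; R = V₀ ; V⊑ = λ _ → id ; R⊑ = λ _ → id ; hub = λ () ; apart = λ { {()} }
          ; V-K = λ { {i = ()} } ; V-tl = λ { {i = ()} } ; R-tl = λ { {i = ()} } ; R-M = λ { {i = ()} } }
          , record { R-size = ≤-trans L≤ (m≤m+n _ _) ; M-size = λ () }

        module Extend {k} (k<N : k < N) (L-big : suc N * cost ≤ L) (S : State V₀ s u k) (Z : Sized k S) where
          open State S
          open Sized Z

          R⊑V₀ : R ⊑ V₀
          R⊑V₀ v = V⊑ v ∘ R⊑ v

          R-big : cost * u ≤ size R
          R-big = +-cancelʳ-≤ (k * cost * u) _ _ (begin
            cost * u + k * cost * u  ≡⟨ sym (*-distribʳ-+ u cost (k * cost)) ⟩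
            suc k * cost * u         ≤⟨ *-monoˡ-≤ u (≤-trans (*-monoˡ-≤ cost (s≤s (<⇒≤ k<N))) L-big) ⟩
            L * u                    ≤⟨ R-size ⟩
            size R + k * cost * u    ∎)
            where open ≤-Reasoning

          3≤cost : 3 ≤ cost
          3≤cost = s≤s (s≤s (s≤s z≤n))

          big = big-components R R⊑V₀ (≤-trans (*-monoˡ-≤ u 3≤cost) R-big)
          Q = proj₁ big

          start : ∃[ v ] BigComponent R v
          start with size-∃ (R ∖ Q) (+-cancelˡ-≤ u _ _ (begin
              u + 1                            ≤⟨ +-monoʳ-≤ u 1≤u ⟩
              u + u                            ≡⟨ cong (u +_) (sym (+-identityʳ u)) ⟩
              2 * u                            ≤⟨ *-monoˡ-≤ u (≤-trans (s≤s (s≤s z≤n)) 3≤cost) ⟩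
              cost * u                         ≤⟨ R-big ⟩
              size R                           ≤⟨ size-split R Q ⟩
              size (R ∩ Q) + size (R ∖ Q)      ≤⟨ +-monoˡ-≤ _ (≤-trans (size-mono (R ∩ Q) Q λ _ → proj₂) (<⇒≤ (proj₁ (proj₂ big)))) ⟩
              u + size (R ∖ Q)                 ∎))
            where open ≤-Reasoning
          ... | v , r , ¬q = v , [ (λ q → contradiction q ¬q) , id ]′ (proj₂ (proj₂ big) v r)

          v₀ = proj₁ start

          grown : Grown R V v₀ g
          grown = grow g R⊑V₀ V⊑ (s≤s z≤n)
            (≤-trans (*-monoˡ-≤ u (m≤m+n (suc g) (suc G))) (≤-trans R-big (size-mono R V R⊑))) (proj₂ start)

          module Gr = Grown grown
          K₀ : List (Fin n)
          K₀ = Gr.verts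

          Crowd : Sub n
          Crowd = sub λ v → any? λ j → mem? V v ×-dec (t ≤? size (tails-at (hub j) v))

          C V′ R′ : Sub n
          C = V ∩ Cov Γ K₀ ∖ LSub K₀ ∖ Crowd
          V′ = V ∖ Cov Γ K₀
          R′ = R ∖ Cov Γ K₀

          loss : ∀ (A : Sub n) → A ⊑ V → size A ≤ size (A ∖ Cov Γ K₀) + suc g * u
          loss A A⊑ = begin
            size A                                              ≤⟨ size-split A (Cov Γ K₀) ⟩
            size (A ∩ Cov Γ K₀) + size (A ∖ Cov Γ K₀)           ≡⟨ +-comm _ (size (A ∖ Cov Γ K₀)) ⟩
            size (A ∖ Cov Γ K₀) + size (A ∩ Cov Γ K₀)           ≤⟨ +-monoʳ-≤ _ (size-mono (A ∩ Cov Γ K₀) (V ∩ Cov Γ K₀) λ v p → A⊑ v (proj₁ p) , proj₂ p) ⟩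
            size (A ∖ Cov Γ K₀) + size (V ∩ Cov Γ K₀)           ≤⟨ +-monoʳ-≤ _ (≤-trans Gr.upper (≤-trans (+-monoʳ-≤ (g * u) d≤u) (≤-reflexive (+-comm (g * u) u)))) ⟩
            size (A ∖ Cov Γ K₀) + suc g * u                     ∎
            where open ≤-Reasoning

          C-big : u ≤ size C
          C-big = +-cancelʳ-≤ (suc N * u) _ _ (begin
            u + suc N * u                                 ≡⟨⟩
            g * u                                         ≤⟨ Gr.lower ⟩
            size (V ∩ Cov Γ K₀)                           ≤⟨ size-cover (V ∩ Cov Γ K₀) (V ∩ Cov Γ K₀ ∖ LSub K₀) (LSub K₀) (λ v p → case mem? (LSub K₀) v of λ where
                                                               (yes q) → inj₂ q
                                                               (no ¬q) → inj₁ (p , ¬q)) ⟩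
            size (V ∩ Cov Γ K₀ ∖ LSub K₀) + size (LSub K₀) ≤⟨ +-mono-≤ (size-cover (V ∩ Cov Γ K₀ ∖ LSub K₀) C Crowd (λ v p → case mem? Crowd v of λ where
                                                               (yes q) → inj₂ q
                                                               (no ¬q) → inj₁ (p , ¬q))) Gr.small ⟩
            size C + size Crowd + u                       ≤⟨ +-monoˡ-≤ u (+-monoʳ-≤ (size C) (≤-trans
                                                               (size-⋃ (λ j → sub λ v → mem? V v ×-dec (t ≤? size (tails-at (hub j) v))) (λ j → crowded-few (hub j) V V⊑))
                                                               (*-monoˡ-≤ u (<⇒≤ k<N)))) ⟩
            size C + N * u + u                            ≡⟨ trans (+-assoc (size C) (N * u) u) (cong (size C +_) (+-comm (N * u) u)) ⟩
            size C + suc N * u                            ∎)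
            where open ≤-Reasoning

          C⊑V : C ⊑ V
          C⊑V v (((p , _) , _) , _) = p

          pruned : Pruned C R′ G
          pruned = prune C R′ G (λ v → V⊑ v ∘ C⊑V v) (λ v → R⊑V₀ v ∘ proj₁) 1≤G C-big
            (+-cancelʳ-≤ (suc g * u) _ _ (begin
              suc G * u + suc g * u  ≡⟨ trans (+-comm (suc G * u) (suc g * u)) (sym (*-distribʳ-+ u (suc g) (suc G))) ⟩
              cost * u               ≤⟨ R-big ⟩
              size R                 ≤⟨ loss R R⊑ ⟩
              size R′ + suc g * u    ∎))
            where open ≤-Reasoning

          module Pn = Pruned pruned
          W : List (Fin n)
          W = Pn.verts

          M₀ R″ : Sub n
          M₀ = R′ ∩ Cov Γ W
          R″ = R′ ∖ Cov Γ W

          tl₀ : Fin n → Fin n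
          tl₀ = parent W

          tl₀∈C : ∀ {m} → M₀ ∋ m → C ∋ tl₀ m
          tl₀∈C (_ , c) = All.lookup Pn.inside (parent∈ W c)

          M₀⊑V : M₀ ⊑ V
          M₀⊑V m ((r , _) , _) = R⊑ m r

          new : Hub V₀ s
          new = record
            { K = K₀ ; conn = Gr.conn
            ; M = M₀ ; M≤ = Pn.upper ; tl = tl₀
            ; tl∈ = λ m∈ → V⊑ _ (C⊑V _ (tl₀∈C m∈))
            -- The tail lies in the neighbourhood of `K₀` and `m` outside it, so the two are
            -- distinct.
            ; tl-m = λ {m} m∈ → near⇒adj Γ (parent-near W (proj₂ m∈))
                λ e → proj₂ (proj₁ m∈) (subst (Cov Γ K₀ ∋_) e (proj₂ (proj₁ (proj₁ (tl₀∈C m∈)))))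
            ; tl-K = λ m∈ → touch-outside (proj₂ (proj₁ (proj₁ (tl₀∈C m∈)))) (proj₂ (proj₁ (tl₀∈C m∈)))
            }

          new-light : ∀ {m} → M₀ ∋ m → ∀ j → size (tails-at (hub j) (tl₀ m)) < t
          new-light m∈ j = ≰⇒> λ c → proj₂ (tl₀∈C m∈) (j , C⊑V _ (tl₀∈C m∈) , c)

          new-old : ∀ j → Apart u new (hub j)
          new-old j = record
            { K-K = λ x∈ y∈ → far-sym Γ (V-K (R⊑ _ (All.lookup Gr.inside x∈)) y∈)
            ; K-tl = λ x∈ m∈ → far-sym Γ (R-tl (All.lookup Gr.inside x∈) m∈)
            ; tl≢tl = λ m∈ m∈′ → V-tl (C⊑V _ (tl₀∈C m∈)) m∈′
            ; M#M = λ m∈ m∈′ → R-M (proj₁ (proj₁ m∈)) m∈′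
            ; few = ≤-trans (≤-reflexive (size-empty (sub λ m → mem? M₀ m ×-dec (u ≤? size (tails-at (hub j) (tl₀ m))))
                λ m p → <-irrefl refl (<-≤-trans (new-light (proj₁ p) j) (≤-trans t≤u (proj₂ p))))) z≤n
            }

          old-new : ∀ j → Apart u (hub j) new
          old-new j = record
            { K-K = λ x∈ y∈ → V-K (R⊑ _ (All.lookup Gr.inside y∈)) x∈
            ; K-tl = λ x∈ m∈ → V-K (C⊑V _ (tl₀∈C m∈)) x∈
            ; tl≢tl = λ m∈ m∈′ e → V-tl (C⊑V _ (tl₀∈C m∈′)) m∈ (sym e)
            ; M#M = λ m∈ m∈′ → R-M (proj₁ (proj₁ m∈′)) m∈
            ; few = *-cancelʳ-≤ _ u u ⦃ >-nonZero 1≤u ⦄ (begin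
                size (sub λ m → mem? Mⱼ m ×-dec (u ≤? size (tails-at new (tlⱼ m)))) * u
                  ≤⟨ markov M₀ Mⱼ (λ m′ m → near? Γ (tl₀ m′) (tlⱼ m)) u (λ m′ m′∈ → ≤-trans
                       (size-mono _ (tails-at (hub j) (tl₀ m′)) λ m q → proj₁ q , near-sym Γ (proj₂ q)) (<⇒≤ (new-light m′∈ j))) ⟩
                size M₀ * t           ≤⟨ *-monoˡ-≤ t (≤-trans Pn.upper s≤) ⟩
                suc G * u * t         ≡⟨ cong (_* t) (*-comm (suc G) u) ⟩
                u * suc G * t         ≡⟨ *-assoc u (suc G) t ⟩
                u * (suc G * t)       ≤⟨ *-monoʳ-≤ u thin ⟩
                u * u                 ∎)
            }
            where
            open ≤-Reasoning
            Mⱼ = Hub.M (hub j)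
            tlⱼ = Hub.tl (hub j)

          hub′ : Fin (suc k) → Hub V₀ s
          hub′ zero    = new
          hub′ (suc j) = hub j

          next : State V₀ s u (suc k)
          next = record
            { V = V′ ; R = R″ ; V⊑ = λ v → V⊑ v ∘ proj₁
            ; R⊑ = λ v → λ where ((r , ¬c) , _) → R⊑ v r , ¬c
            ; hub = hub′
            ; apart = apart′
            ; V-K = λ { {i = zero} (_ , ¬c) x∈ → ¬Cov⇒far Γ ¬c x∈ ; {i = suc i} (v∈ , _) x∈ → V-K v∈ x∈ }
            ; V-tl = λ { {i = zero} (_ , ¬c) m∈ refl → ¬c (proj₂ (proj₁ (proj₁ (tl₀∈C m∈)))) ; {i = suc i} (v∈ , _) m∈ → V-tl v∈ m∈ }
            ; R-tl = λ { {i = zero} (_ , ¬c) m∈ → ¬Cov⇒far Γ ¬c (parent∈ W (proj₂ m∈)) ; {i = suc i} ((r∈ , _) , _) m∈ → R-tl r∈ m∈ }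
            ; R-M = λ { {i = zero} (_ , ¬c) m∈ → ¬c (proj₂ m∈) ; {i = suc i} ((r∈ , _) , _) m∈ → R-M r∈ m∈ }
            }
            where
            apart′ : ∀ {i j} → i ≢ j → Apart u (hub′ i) (hub′ j)
            apart′ {zero}  {zero}  ne = contradiction refl ne
            apart′ {zero}  {suc j} ne = new-old j
            apart′ {suc i} {zero}  ne = old-new i
            apart′ {suc i} {suc j} ne = apart (ne ∘ cong suc)

          sized : Sized (suc k) next
          sized = record
            { R-size = begin
                L * u                                     ≤⟨ R-size ⟩
                size R + k * cost * u                     ≤⟨ +-monoˡ-≤ _ (loss R R⊑) ⟩
                size R′ + suc g * u + k * cost * u        ≤⟨ +-monoˡ-≤ _ (+-monoˡ-≤ _ (≤-trans (size-split R′ (Cov Γ W)) (+-monoˡ-≤ _ (≤-trans Pn.upper s≤)))) ⟩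
                suc G * u + size R″ + suc g * u + k * cost * u ≡⟨ cong (λ z → z + suc g * u + k * cost * u) (+-comm (suc G * u) (size R″)) ⟩
                size R″ + suc G * u + suc g * u + k * cost * u ≡⟨ cong (_+ k * cost * u) (trans (+-assoc (size R″) (suc G * u) (suc g * u))
                                                                   (cong (size R″ +_) (trans (+-comm (suc G * u) (suc g * u)) (sym (*-distribʳ-+ u (suc g) (suc G)))))) ⟩
                size R″ + cost * u + k * cost * u         ≡⟨ trans (+-assoc (size R″) _ _) (cong (size R″ +_) (sym (*-distribʳ-+ u cost (k * cost)))) ⟩
                size R″ + suc k * cost * u                ∎
            ; M-size = λ where
                zero → ≤-trans Pn.lower (≤-trans (size-mono M₀ (M₀ ∩ V′) λ m m∈ → m∈ , M₀⊑V m m∈ , proj₂ (proj₁ m∈)) (m≤m+n _ _))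
                (suc j) → begin
                  G * u                                                 ≤⟨ M-size j ⟩
                  size (Hub.M (hub j) ∩ V) + k * suc g * u              ≤⟨ +-monoˡ-≤ _ (loss (Hub.M (hub j) ∩ V) λ _ → proj₂) ⟩
                  size (Hub.M (hub j) ∩ V ∖ Cov Γ K₀) + suc g * u + k * suc g * u ≡⟨ trans (+-assoc (size (Hub.M (hub j) ∩ V ∖ Cov Γ K₀)) _ _) (cong (size (Hub.M (hub j) ∩ V ∖ Cov Γ K₀) +_) (sym (*-distribʳ-+ u (suc g) (k * suc g)))) ⟩
                  size (Hub.M (hub j) ∩ V ∖ Cov Γ K₀) + suc k * suc g * u ≤⟨ +-monoˡ-≤ _ (size-mono _ (Hub.M (hub j) ∩ V′) λ m → λ where ((m∈ , v∈) , ¬c) → m∈ , v∈ , ¬c) ⟩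
                  size (Hub.M (hub j) ∩ V′) + suc k * suc g * u         ∎
            }
            where open ≤-Reasoning

        build : suc N * cost ≤ L → L * u ≤ size V₀ → ∀ k → k ≤ N → Σ (State V₀ s u k) (Sized k)
        build Lb L≤ zero    _   = initial L≤
        build Lb L≤ (suc k) k<N = Extend.next k<N Lb S Z , Extend.sized k<N Lb S Z
          where
          rec = build Lb L≤ k (<⇒≤ k<N)
          S = proj₁ rec
          Z = proj₂ rec

  -- Induced stars

  -- `suc p` tokens of `σ p` units each can be played down to one. In a round a token of `σ (suc p)`
  -- units keeps either its hit part, at least `σ p` units, or its missed part, after a loss of at
  -- most `4 + σ p` units.
  σ : ℕ → ℕ
  σ zero    = 1
  σ (suc p) = 5 + (σ p + σ p)

  argmin : ∀ {p} (f : Fin (suc p) → ℕ) → ∃[ i ] ∀ j → f i ≤ f j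
  argmin {zero}  f = zero , λ { zero → ≤-refl }
  argmin {suc p} f with argmin (f ∘ suc)
  ... | i , min with ≤-total (f zero) (f (suc i))
  ...   | inj₁ le = zero , λ { zero → ≤-refl ; (suc j) → ≤-trans le (min j) }
  ...   | inj₂ le = suc i , λ { zero → le ; (suc j) → min j }

  module _ {n P : ℕ} (T : Fin P → Sub n) (C : Fin P → Fin n → Fin P → Fin n → Set) where

    Leaf : Set
    Leaf = Fin P × Fin n

    -- `C` is not assumed symmetric. New leaves are consed in front, and this order of arguments
    -- makes the condition on a new leaf literally what `Indep` provides for the token owning the
    -- older leaves.
    Sep : Leaf → Leaf → Set
    Sep (k , y) (l , z) = l ≢ k × ¬ C l z k y

    Star : ℕ → Set
    Star D = ∃[ i ] ∃[ z ] T i ∋ z × ∃[ ℓ ] D ≤ length ℓ × AllPairs Sep ℓ × All (λ (k , y) → T k ∋ y × k ≢ i × C k y i z) ℓ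

    module _ (C? : ∀ k y l m → Dec (C k y l m)) (u : ℕ) (1≤u : 1 ≤ u)
             (sparse : ∀ {k l y} → k ≢ l → T k ∋ y → size (sub λ m → mem? (T l) m ×-dec C? k y l m) ≤ 4 * u)
             (coherent : ∀ {k l} → k ≢ l → ∀ A B → A ⊑ T k → B ⊑ T l → u ≤ size A → u ≤ size B →
                         ∃[ a ] ∃[ b ] A ∋ a × B ∋ b × C k a l b)
             where

      Leaves : (Fin P → Fin n → Set) → Fin P → Fin n → ℕ → Set
      Leaves 𝓨 i z d = ∃[ ℓ ] length ℓ ≡ d × AllPairs Sep ℓ ×
        All (λ (k , y) → 𝓨 k y × T k ∋ y × k ≢ i × C k y i z) ℓ

      CC : Fin P → List (Fin n) → Fin P → Sub n
      CC i ys k = sub λ v → Any.any? (λ y → C? i y k v) ys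

      -- All vertices of `A` are still possible centres, each with its own leaves. `𝓨` collects the
      -- leaves of all of them, so that independence can be stated before a centre is chosen.
      record Token (s : ℕ) : Set₁ where
        field
          ix   : Fin P
          A    : Sub n
          A⊑   : A ⊑ T ix
          deg  : ℕ
          𝓨    : Fin P → Fin n → Set
          star : ∀ z → A ∋ z → Leaves 𝓨 ix z deg
          big  : s ≤ size A

      -- Leaves of a token stay out of contact with all other tokens, so a new leaf never touches an old one.
      Indep : ∀ {s} → Token s → Token s → Set
      Indep t t′ = ix t ≢ ix t′ × (∀ {k y a} → 𝓨 t k y → A t′ ∋ a → k ≢ ix t′ × ¬ C k y (ix t′) a)
        where open Token

      pow-≤ : ∀ D e → 2 ^ D ≤ 2 ^ e → D ≤ e
      pow-≤ D e le = ≮⇒≥ λ lt → <-irrefl refl (<-≤-trans (^-monoʳ-< 2 (s≤s (s≤s z≤n)) lt) le)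

      1≤σ : ∀ p → 1 ≤ σ p
      1≤σ zero    = s≤s z≤n
      1≤σ (suc p) = s≤s z≤n

      weight : ∀ {p s} → (Fin p → Token s) → ℕ
      weight t = ∑ λ j → 2 ^ Token.deg (t j)

      -- The vertices of the token of least degree are offered one by one as leaves, until some
      -- other token has `σ p * u` vertices in contact with one of them. No token can then be hit
      -- much more, since just before the last vertex none had reached that mark.
      module Round {p} (t : Fin (suc (suc p)) → Token (σ (suc p) * u)) (ind : ∀ {i j} → i ≢ j → Indep (t i) (t j)) where
        open Token

        i₀ : Fin (suc (suc p))
        i₀ = proj₁ (argmin (deg ∘ t))

        o : Fin (suc p) → Token (σ (suc p) * u)
        o j = t (punchIn i₀ j)

        ti = t i₀
        I = ix ti

        ind-i : ∀ j → Indep ti (o j)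
        ind-i j = ind λ e → punchInᵢ≢i i₀ j (sym e)

        ind-o : ∀ j → Indep (o j) ti
        ind-o j = ind (punchInᵢ≢i i₀ j)

        Hit : Fin (suc p) → List (Fin n) → Sub n
        Hit j ys = A (o j) ∩ CC I ys (ix (o j))

        Stop : List (Fin n) → Set
        Stop ys = ∃[ j ] σ p * u ≤ size (Hit j ys)

        stop? : ∀ ys → Dec (Stop ys)
        stop? ys = any? λ j → σ p * u ≤? size (Hit j ys)

        start : ¬ Stop []
        start (j , le) = contradiction (≤-trans (*-mono-≤ (1≤σ p) 1≤u) (≤-trans le (≤-reflexive (size-empty (Hit j []) λ _ → λ ())))) λ ()

        full : Stop (toList (A ti))
        -- By coherence, offering all vertices leaves at most `u` vertices of any other token out of
        -- contact; token `zero` is the witness.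
        full = zero , +-cancelʳ-≤ u _ _ (begin
            σ p * u + u                  ≡⟨ +-comm (σ p * u) u ⟩
            suc (σ p) * u                ≤⟨ *-monoˡ-≤ u (s≤s (≤-trans (m≤m+n (σ p) (σ p)) (m≤n+m _ 4))) ⟩
            σ (suc p) * u                ≤⟨ big (o zero) ⟩
            size (A (o zero))            ≤⟨ size-split (A (o zero)) Cv ⟩
            size (A (o zero) ∩ Cv) + size (A (o zero) ∖ Cv) ≤⟨ +-monoʳ-≤ _ miss ⟩
            size (A (o zero) ∩ Cv) + u   ∎)
          where
          open ≤-Reasoning
          Cv = CC I (toList (A ti)) (ix (o zero))
          1≤σ′ : u ≤ σ (suc p) * u
          1≤σ′ = ≤-trans (≤-reflexive (sym (*-identityˡ u))) (*-monoˡ-≤ u (1≤σ (suc p)))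
          miss : size (A (o zero) ∖ Cv) ≤ u
          miss with size (A (o zero) ∖ Cv) ≤? u
          ... | yes le = le
          ... | no ¬le with coherent (proj₁ (ind-i zero)) (A ti) (A (o zero) ∖ Cv) (A⊑ ti) (λ v → A⊑ (o zero) v ∘ proj₁)
                              (≤-trans 1≤σ′ (big ti)) (≰⇒≥ ¬le)
          ...   | a , b , a∈ , (_ , b∉) , c = contradiction (lose (toList⁺ (A ti) a∈) c) b∉

        round : ∃[ t′ ] (∀ {i j} → i ≢ j → Indep (t′ i) (t′ j)) × weight {suc p} {σ p * u} t′ ≥ weight t
        round with first-suffix Stop stop? (All (A ti ∋_)) (λ where _ _ (_ ∷ al) → al) (toList (A ti)) (All.tabulate (toList⁻ (A ti))) full start
        ... | y , ys , ¬st , (j₀ , hit) , al@(ay ∷ _) = t′ , ind′ , heavy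
          where
          Y : List (Fin n)
          Y = y ∷ ys

          light : ∀ j → size (Hit j Y) ≤ (4 + σ p) * u
          light j = begin
            size (Hit j Y)                      ≤⟨ size-cover (Hit j Y) (sub λ m → mem? (T (ix (o j))) m ×-dec C? I y (ix (o j)) m) (Hit j ys)
                                                    (λ where v (a , here c)  → inj₁ (A⊑ (o j) v a , c)
                                                             v (a , there c) → inj₂ (a , c)) ⟩
            size (sub λ m → mem? (T (ix (o j))) m ×-dec C? I y (ix (o j)) m) + size (Hit j ys)
                                                ≤⟨ +-mono-≤ (sparse (proj₁ (ind-i j)) (A⊑ ti y ay)) (<⇒≤ (≰⇒> λ le → ¬st (j , le))) ⟩
            4 * u + σ p * u                     ≡⟨ sym (*-distribʳ-+ u 4 (σ p)) ⟩
            (4 + σ p) * u                       ∎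
            where open ≤-Reasoning

          hitTok : Token (σ p * u)
          hitTok = record
            { ix = ix (o j₀) ; A = Hit j₀ Y ; A⊑ = λ v → A⊑ (o j₀) v ∘ proj₁ ; deg = suc (deg (o j₀))
            ; 𝓨 = 𝓨′ ; star = star′ ; big = hit }
            where
            𝓨′ : Fin P → Fin n → Set
            𝓨′ k v = 𝓨 (o j₀) k v ⊎ (k ≡ I × v ∈ Y)
            star′ : ∀ z → Hit j₀ Y ∋ z → Leaves 𝓨′ (ix (o j₀)) z (suc (deg (o j₀)))
            star′ z (az , c) with find c | star (o j₀) z az
            ... | x , x∈ , cx | ℓ , len , sep , all = (I , x) ∷ ℓ , cong suc len
                , All.map (λ (yv , _) → proj₂ (ind-o j₀) yv (All.lookup al x∈)) all ∷ sep
                , (inj₂ (refl , x∈) , A⊑ ti x (All.lookup al x∈) , proj₁ (ind-i j₀) , cx) ∷ All.map (λ (yv , r) → inj₁ yv , r) all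

          missTok : Fin (suc p) → Token (σ p * u)
          missTok j = record
            { ix = ix (o j) ; A = A (o j) ∖ CC I Y (ix (o j)) ; A⊑ = λ v → A⊑ (o j) v ∘ proj₁ ; deg = deg (o j) ; 𝓨 = 𝓨 (o j)
            ; star = λ z → star (o j) z ∘ proj₁
            ; big = +-cancelˡ-≤ ((4 + σ p) * u) _ _ (begin
                (4 + σ p) * u + σ p * u         ≡⟨ sym (*-distribʳ-+ u (4 + σ p) (σ p)) ⟩
                (4 + σ p + σ p) * u             ≤⟨ *-monoˡ-≤ u (≤-trans (≤-reflexive (+-assoc 4 (σ p) (σ p))) (n≤1+n _)) ⟩
                σ (suc p) * u                   ≤⟨ big (o j) ⟩
                size (A (o j))                  ≤⟨ size-split (A (o j)) (CC I Y (ix (o j))) ⟩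
                size (Hit j Y) + size (A (o j) ∖ CC I Y (ix (o j))) ≤⟨ +-monoˡ-≤ _ (light j) ⟩
                (4 + σ p) * u + size (A (o j) ∖ CC I Y (ix (o j))) ∎) }
            where open ≤-Reasoning

          pick : ∀ j → Dec (j ≡ j₀) → Token (σ p * u)
          pick j (yes _) = hitTok
          pick j (no  _) = missTok j

          t′ : Fin (suc p) → Token (σ p * u)
          t′ j = pick j (j ≟ j₀)

          o-ind : ∀ {i j} → i ≢ j → Indep (o i) (o j)
          o-ind i≢j = ind (i≢j ∘ punchIn-injective i₀ _ _)

          ind′ : ∀ {i j} → i ≢ j → Indep (t′ i) (t′ j)
          ind′ {i} {j} i≢j with i ≟ j₀ | j ≟ j₀
          ... | yes refl | yes refl = contradiction refl i≢j
          ... | yes refl | no _  = proj₁ (o-ind i≢j) , λ where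
                  (inj₁ yv) (az , _)          → proj₂ (o-ind i≢j) yv az
                  -- The other tokens have just been reduced to vertices out of contact with all of
                  -- `Y`, which contains every new leaf.
                  (inj₂ (refl , x∈)) (az , ¬c) → proj₁ (ind-i j) , λ c → ¬c (lose x∈ c)
          ... | no _  | yes refl = proj₁ (o-ind i≢j) , λ yv (az , _) → proj₂ (o-ind i≢j) yv az
          ... | no _  | no _     = proj₁ (o-ind i≢j) , λ yv (az , _) → proj₂ (o-ind i≢j) yv az

          deg-hit : ∀ j (d : Dec (j ≡ j₀)) → j ≡ j₀ → Token.deg (pick j d) ≡ suc (deg (o j))
          deg-hit j (yes refl) _ = refl
          deg-hit j (no ne)    e = contradiction e ne

          deg-other : ∀ j (d : Dec (j ≡ j₀)) → deg (o j) ≤ Token.deg (pick j d)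
          deg-other j (yes refl) = n≤1+n _
          deg-other j (no _)     = ≤-refl

          heavy : weight t′ ≥ weight t
          heavy = begin
            weight t                                    ≡⟨ ∑-remove (λ j → 2 ^ deg (t j)) i₀ ⟩
            -- Minimality pays here: doubling the weight of the hit token makes up for the token
            -- consumed.
            2 ^ deg ti + weight o                       ≤⟨ +-monoˡ-≤ _ (^-monoʳ-≤ 2 (proj₂ (argmin (deg ∘ t)) (punchIn i₀ j₀))) ⟩
            2 ^ deg (o j₀) + weight o                   ≡⟨ cong (2 ^ deg (o j₀) +_) (∑-remove (λ j → 2 ^ deg (o j)) j₀) ⟩
            2 ^ deg (o j₀) + (2 ^ deg (o j₀) + rest o)  ≡⟨ sym (+-assoc (2 ^ deg (o j₀)) _ _) ⟩
            2 ^ deg (o j₀) + 2 ^ deg (o j₀) + rest o    ≡⟨ cong (λ z → 2 ^ deg (o j₀) + z + rest o) (sym (+-identityʳ _)) ⟩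
            2 ^ suc (deg (o j₀)) + rest o               ≡⟨ cong (λ e → 2 ^ e + rest o) (sym (deg-hit j₀ (j₀ ≟ j₀) refl)) ⟩
            2 ^ Token.deg (t′ j₀) + rest o              ≤⟨ +-monoʳ-≤ (2 ^ Token.deg (t′ j₀)) (∑-mono λ j → ^-monoʳ-≤ 2 (deg-other (punchIn j₀ j) (punchIn j₀ j ≟ j₀))) ⟩
            2 ^ Token.deg (t′ j₀) + rest t′             ≡⟨ sym (∑-remove (λ j → 2 ^ Token.deg (t′ j)) j₀) ⟩
            weight t′                                   ∎
            where
            open ≤-Reasoning
            rest : ∀ {s} → (Fin (suc p) → Token s) → ℕ
            rest w = ∑ λ j → 2 ^ Token.deg (w (punchIn j₀ j))

      -- Every round consumes a token of minimum degree and raises the degree of another one, so weight never drops.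
      play : ∀ D p (t : Fin (suc p) → Token (σ p * u)) → (∀ {i j} → i ≢ j → Indep (t i) (t j)) → 2 ^ D ≤ weight t → Star D
      play D zero t ind w with size-∃ (Token.A (t zero)) (≤-trans (≤-trans 1≤u (≤-reflexive (sym (+-identityʳ u)))) (Token.big (t zero)))
      ... | z , az with Token.star (t zero) z az
      ...   | ℓ , len , sep , all = Token.ix (t zero) , z , Token.A⊑ (t zero) z az , ℓ
            , ≤-trans (pow-≤ D _ (≤-trans w (≤-reflexive (+-identityʳ _)))) (≤-reflexive (sym len)) , sep , All.map proj₂ all
      play D (suc p) t ind w = let (t′ , ind′ , heavy) = Round.round t ind in play D p t′ ind′ (≤-trans w heavy)

      raw : ∀ {s} → (∀ k → s ≤ size (T k)) → Fin P → Token s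
      raw f k = record { ix = k ; A = T k ; A⊑ = λ _ → id ; deg = 0 ; 𝓨 = λ _ _ → ⊥ ; star = λ _ _ → [] , refl , [] , [] ; big = f k }

      abstract
        -- `2 ^ D` tokens of weight one end as a single token of weight at least `2 ^ D`, hence of
        -- degree at least `D`.
        star-exists : ∀ D p → P ≡ suc p → P ≡ 2 ^ D → (∀ k → σ p * u ≤ size (T k)) → Star D
        star-exists D p refl e f = play D p (raw f) (λ i≢j → i≢j , λ ()) (≤-reflexive (trans (sym e) (ones P)))
          where
          ones : ∀ q → q ≡ ∑ {q} (λ _ → 1)
          ones zero    = refl
          ones (suc q) = cong suc (ones q)

  -- Induced and fuzzy paths

  par : ℕ → Bool
  par zero    = false
  par (suc k) = not (par k)

  par-+ : ∀ j k → par (j + k) ≡ par j xor par k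
  par-+ zero    k = refl
  par-+ (suc j) k = trans (cong not (par-+ j k)) (not-xor (par j) (par k))
    where
    not-xor : ∀ a b → not (a xor b) ≡ not a xor b
    not-xor false b = refl
    not-xor true  b = not-involutive b

  -- Paths are lists of vertices, so odd length means an even number of entries.
  odd-pred : ∀ k → par (suc k) ≡ false → 2 ∤ k
  odd-pred k e (divides q refl) = not-¬ (even q) e
    where
    even : ∀ q → par (suc (q * 2)) ≡ true
    even zero    = refl
    even (suc q) = trans (not-involutive _) (even q)

  data Last {X : Set} (s : X) : List X → Set where
    here  : Last s (s ∷ [])
    there : ∀ {x l} → Last s l → Last s (x ∷ l)

  Last-ʳ++ : ∀ {X : Set} {s : X} l {m} → Last s m → Last s (l ʳ++ m)
  Last-ʳ++ []      e = e
  Last-ʳ++ (x ∷ l) e = Last-ʳ++ l (there e)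

  head-ʳ++ : ∀ {X : Set} {s : X} {l} → Last s l → ∀ m → ∃[ k ] l ʳ++ m ≡ s ∷ k
  head-ʳ++ here      m = m , refl
  head-ʳ++ (there e) m = head-ʳ++ e _

  lookup-last : ∀ {X : Set} {s x : X} l → Last s (x ∷ l) → lookup (x ∷ l) (fromℕ (length l)) ≡ s
  lookup-last []      here      = refl
  lookup-last (y ∷ l) (there e) = lookup-last l e

  ∈-ʳ++⁺ʳ : ∀ {X : Set} {v : X} l {m} → v ∈ m → v ∈ l ʳ++ m
  ∈-ʳ++⁺ʳ []      v∈ = v∈
  ∈-ʳ++⁺ʳ (x ∷ l) v∈ = ∈-ʳ++⁺ʳ l (there v∈)

  All-ʳ++ : ∀ {X : Set} {P : X → Set} {l m} → All P l → All P m → All P (l ʳ++ m)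
  All-ʳ++ []       ms = ms
  All-ʳ++ (p ∷ ps) ms = All-ʳ++ ps (p ∷ ms)

  -- The relation is a parameter for the sake of two instances: adjacency, and adjacency without one
  -- chord, for which a fuzzy path is an ordinary induced path.
  module Induced {X : Set} (E : X → X → Set) (E-sym : ∀ {x y} → E x y → E y x) (E-irr : ∀ {x} → ¬ E x x) where

    Apart′ : X → X → Set
    Apart′ x y = ¬ E x y × x ≢ y

    apart-sym : ∀ {x y} → Apart′ x y → Apart′ y x
    apart-sym (¬e , ne) = ¬e ∘ E-sym , ne ∘ sym

    IP : List X → Set
    IP []          = ⊤
    IP (x ∷ [])    = ⊤
    IP (x ∷ y ∷ l) = E x y × All (Apart′ x) l × IP (y ∷ l)

    IP-tail : ∀ x l → IP (x ∷ l) → IP l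
    IP-tail x []      _           = tt
    IP-tail x (y ∷ l) (_ , _ , p) = p

    Consecutive : ∀ {k} → Fin k → Fin k → Set
    Consecutive i j = suc (toℕ i) ≡ toℕ j ⊎ suc (toℕ j) ≡ toℕ i

    private
      con-suc : ∀ {k} {i j : Fin k} → Consecutive i j → Consecutive (suc i) (suc j)
      con-suc (inj₁ e) = inj₁ (cong suc e)
      con-suc (inj₂ e) = inj₂ (cong suc e)

      con-pred : ∀ {k} {i j : Fin k} → Consecutive (suc i) (suc j) → Consecutive i j
      con-pred (inj₁ e) = inj₁ (cong pred e)
      con-pred (inj₂ e) = inj₂ (cong pred e)

    E⇒con : ∀ l → IP l → ∀ i j → E (lookup l i) (lookup l j) → Consecutive i j
    E⇒con (x ∷ [])    ip zero    zero          e = contradiction e E-irr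
    E⇒con (x ∷ y ∷ l) ip zero    zero          e = contradiction e E-irr
    E⇒con (x ∷ y ∷ l) ip zero    (suc zero)    e = inj₁ refl
    E⇒con (x ∷ y ∷ l) (_ , al , _) zero (suc (suc j)) e = contradiction e (proj₁ (All.lookup al (∈-lookup j)))
    E⇒con (x ∷ y ∷ l) ip (suc zero)    zero    e = inj₂ refl
    E⇒con (x ∷ y ∷ l) (_ , al , _) (suc (suc i)) zero e = contradiction (E-sym e) (proj₁ (All.lookup al (∈-lookup i)))
    E⇒con (x ∷ y ∷ l) (_ , _ , ip) (suc i) (suc j) e = con-suc (E⇒con (y ∷ l) ip i j e)

    con⇒E : ∀ l → IP l → ∀ i j → Consecutive i j → E (lookup l i) (lookup l j)
    con⇒E (x ∷ [])    ip zero    zero          (inj₁ ())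
    con⇒E (x ∷ [])    ip zero    zero          (inj₂ ())
    con⇒E (x ∷ y ∷ l) ip zero    zero          (inj₁ ())
    con⇒E (x ∷ y ∷ l) ip zero    zero          (inj₂ ())
    con⇒E (x ∷ y ∷ l) (e , _) zero    (suc zero)    c = e
    con⇒E (x ∷ y ∷ l) ip zero    (suc (suc j)) (inj₁ ())
    con⇒E (x ∷ y ∷ l) ip zero    (suc (suc j)) (inj₂ ())
    con⇒E (x ∷ y ∷ l) (e , _) (suc zero)    zero    c = E-sym e
    con⇒E (x ∷ y ∷ l) ip (suc (suc i)) zero    (inj₁ ())
    con⇒E (x ∷ y ∷ l) ip (suc (suc i)) zero    (inj₂ ())
    con⇒E (x ∷ y ∷ l) (_ , _ , ip) (suc i) (suc j) c = con⇒E (y ∷ l) ip i j (con-pred c)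

    private
      ≢-head : ∀ x l → IP (x ∷ l) → ∀ j → x ≢ lookup l j
      ≢-head x (y ∷ l) (e , _ , _)  zero    refl = E-irr e
      ≢-head x (y ∷ l) (_ , al , _) (suc j) eq   = proj₂ (All.lookup al (∈-lookup j)) eq

    lookup-inj : ∀ l → IP l → ∀ i j → lookup l i ≡ lookup l j → i ≡ j
    lookup-inj (x ∷ l) ip zero    zero    e = refl
    lookup-inj (x ∷ l) ip zero    (suc j) e = contradiction e (≢-head x l ip j)
    lookup-inj (x ∷ l) ip (suc i) zero    e = contradiction (sym e) (≢-head x l ip i)
    lookup-inj (x ∷ l) ip (suc i) (suc j) e = cong suc (lookup-inj l (IP-tail x l ip) i j e)

    -- Both paths are stored from the meeting point outwards, so the first is reversed onto the
    -- second. The recursion moves one vertex across at a time, keeping the rest of the first path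
    -- apart from everything already moved.
    glue : ∀ p la c B → IP (p ∷ la) → IP (c ∷ B) → E p c → All (Apart′ p) B → All (λ a → All (Apart′ a) (c ∷ B)) la →
           IP ((p ∷ la) ʳ++ (c ∷ B))
    glue p []        c B ipa ipb e pB cr = e , pB , ipb
    glue p (p′ ∷ la) c B (e′ , al , ipa) ipb e pB (p′B ∷ cr) =
      glue p′ la p (c ∷ B) ipa (e , pB , ipb) (E-sym e′) p′B (both al cr)
      where
      both : ∀ {l} → All (Apart′ p) l → All (λ a → All (Apart′ a) (c ∷ B)) l → All (λ a → All (Apart′ a) (p ∷ c ∷ B)) l
      both []       []       = []
      both (a ∷ as) (b ∷ bs) = (apart-sym a ∷ b) ∷ both as bs

  module _ {n : ℕ} (Γ : Graph n) where

    open Induced (Adj Γ) (Graph.adj-sym Γ) (λ {x} → Graph.adj-irrefl Γ x) public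

    far⇒apart : ∀ {x y} → Far Γ x y → Apart′ x y
    far⇒apart f = f ∘ inj₂ , f ∘ inj₁

    -- Only `l` has to lie in `U`, because the starting vertex `x` is often still outside the
    -- permitted set.
    Reach : Fin n → (Fin n → Set) → Fin n → Set
    Reach s U x = ∃[ l ] IP (x ∷ l) × Last s (x ∷ l) × All U l

    private
      -- A substitute for shortest paths: beyond the last vertex of `L` near `x` nothing is near
      -- `x`, so prefixing `x` there keeps the path induced. If that vertex is `x` itself, the
      -- suffix is already the path.
      cut : ∀ {s U x} L → IP L → Last s L → All U L → Any (Near Γ x) L → Reach s U x
      cut {x = x} (q ∷ l) ip la (uq ∷ ul) near with Any.any? (near? Γ x) l
      cut {x = x} (q ∷ []) ip la (uq ∷ ul) near | yes ()
      cut {x = x} (q ∷ y ∷ l) (_ , _ , ip) (there la) (uq ∷ ul) near | yes later = cut (y ∷ l) ip la ul later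
      cut {x = x} (q ∷ l) ip la (uq ∷ ul) (there later) | no ¬later = contradiction later ¬later
      cut {x = x} (q ∷ l) ip la (uq ∷ ul) (here (inj₁ refl)) | no ¬later = l , ip , la , ul
      cut {x = x} (q ∷ l) ip la (uq ∷ ul) (here (inj₂ a)) | no ¬later =
        q ∷ l , (a , All.tabulate (λ z∈ → far⇒apart λ nr → ¬later (lose z∈ nr)) , ip) , there la , uq ∷ ul

    reach-self : ∀ {s U} → Reach s U s
    reach-self = [] , tt , here , []

    reach-step : ∀ {s U x y} → Adj Γ x y → U y → Reach s U y → Reach s U x
    reach-step {y = y} a uy (l , ip , la , ul) = cut (y ∷ l) ip la (uy ∷ ul) (here (inj₂ a))

    reach-conn : ∀ {s U v K} → Conn Γ v K → All U K → ∀ {y z} → y ∈ K → z ∈ K → Reach s U y → Reach s U z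
    reach-conn c all y∈ z∈ = conn-spread Γ (λ x∈ y∈ a r → reach-step (Graph.adj-sym Γ a) (All.lookup all x∈) r) c y∈ z∈

    record OddFuzzy (s t : Fin n) (U : Fin n → Set) : Set where
      field
        path   : FuzzyOddPath
        proper : 1 < FuzzyOddPath.length path
        place  : FuzzyOddPath.Vertex path → Fin n
        inj    : Injective _≡_ _≡_ place
        start  : place zero ≡ s
        end    : place (fromℕ _) ≡ t
        adj    : ∀ i j → Adj Γ (place i) (place j) ⇔ FuzzyAdj path i j
        inside : ∀ i → Internal i → U (place i)

    OnPath : Fin n → Fin n → (Fin n → Set) → Fin n → Set
    OnPath s t U v = U v ⊎ v ≡ s ⊎ v ≡ t

    private
      internal-U : ∀ {s t U} l → All (OnPath s t U) (s ∷ l) → Last t (s ∷ l) →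
                   (∀ i j → lookup (s ∷ l) i ≡ lookup (s ∷ l) j → i ≡ j) → ∀ i → Internal i → U (lookup (s ∷ l) i)
      internal-U {s} {t} l all la inj i (i≢0 , i≢l) with All.lookup all (∈-lookup i)
      ... | inj₁ u            = u
      ... | inj₂ (inj₁ e)     = contradiction (inj i zero e) i≢0
      ... | inj₂ (inj₂ e)     = contradiction (inj i (fromℕ (length l)) (trans e (sym (lookup-last l la)))) i≢l

    plain : ∀ {s t U} l → IP (s ∷ l) → Last t (s ∷ l) → All (OnPath s t U) (s ∷ l) → par (length (s ∷ l)) ≡ false →
            1 < length l → OddFuzzy s t U
    plain {s} {t} {U} l ip la all ev big = record
      { path = record { length = length l ; odd = odd-pred _ ev ; extra = nothing }
      ; proper = big ; place = lookup (s ∷ l) ; inj = λ {i} {j} → lookup-inj (s ∷ l) ip i j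
      ; start = refl ; end = lookup-last l la
      ; adj = λ i j → mk⇔ (E⇒con (s ∷ l) ip i j) (con⇒E (s ∷ l) ip i j)
      ; inside = internal-U {s} {t} {U} l all la (lookup-inj (s ∷ l) ip)
      }

    module _ (p q : Fin n) (p~q : Adj Γ p q) where

      Chord : Fin n → Fin n → Set
      Chord x y = (x ≡ p × y ≡ q) ⊎ (x ≡ q × y ≡ p)

      chord-sym : ∀ {x y} → Chord x y → Chord y x
      chord-sym (inj₁ (a , b)) = inj₂ (b , a)
      chord-sym (inj₂ (a , b)) = inj₁ (b , a)

      chord? : ∀ x y → Dec (Chord x y)
      chord? x y = ((x ≟ p) ×-dec (y ≟ q)) ⊎-dec ((x ≟ q) ×-dec (y ≟ p))

      E⁻ : Fin n → Fin n → Set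
      E⁻ x y = Adj Γ x y × ¬ Chord x y

      E⁻-sym : ∀ {x y} → E⁻ x y → E⁻ y x
      E⁻-sym (a , ¬c) = Graph.adj-sym Γ a , ¬c ∘ chord-sym

      E⁻-irr : ∀ {x} → ¬ E⁻ x x
      E⁻-irr {x} (a , _) = Graph.adj-irrefl Γ x a

      module I⁻ = Induced E⁻ E⁻-sym E⁻-irr

      -- The pair `p`, `q`, ignored by the induced path, becomes the additional edge, and the common
      -- neighbour `c` supplies its triangle.
      fuzzy : ∀ {s t U} l → I⁻.IP (s ∷ l) → Last t (s ∷ l) → All (OnPath s t U) (s ∷ l) → par (length (s ∷ l)) ≡ false →
              1 < length l → p ≢ s → p ≢ t → q ≢ s → q ≢ t → p ∈ s ∷ l → q ∈ s ∷ l →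
              ∀ {c} → c ∈ s ∷ l → E⁻ p c → E⁻ q c → OddFuzzy s t U
      fuzzy {s} {t} {U} l ip la all ev big p≢s p≢t q≢s q≢t p∈ q∈ {c} c∈ pc qc = record
        { path = P
        ; proper = big ; place = lookup L ; inj = λ {i} {j} → inj′ i j
        ; start = refl ; end = lookup-last l la
        ; adj = λ i j → mk⇔ (to i j) (from i j)
        ; inside = internal-U {s} {t} {U} l all la inj′
        }
        where
        L = s ∷ l
        inj′ = I⁻.lookup-inj L ip
        ip-ix = Any.index p∈
        iq-ix = Any.index q∈
        ic-ix = Any.index c∈
        at : ∀ {v} (v∈ : v ∈ L) → lookup L (Any.index v∈) ≡ v
        at v∈ = sym (lookup-index v∈)
          where
          lookup-index : ∀ {v} {m : List (Fin n)} (v∈ : v ∈ m) → v ≡ lookup m (Any.index v∈)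
          lookup-index (here e)   = e
          lookup-index (there v∈) = lookup-index v∈
        intern : ∀ {v} (v∈ : v ∈ L) → v ≢ s → v ≢ t → Internal {length l} (Any.index v∈)
        intern v∈ v≢s v≢t = (λ e → v≢s (trans (sym (at v∈)) (cong (lookup L) e)))
                          , (λ e → v≢t (trans (sym (at v∈)) (trans (cong (lookup L) e) (lookup-last l la))))
        con : ∀ {v w} (v∈ : v ∈ L) (w∈ : w ∈ L) → E⁻ v w → PathAdj {length l} (Any.index v∈) (Any.index w∈)
        con v∈ w∈ e = I⁻.E⇒con L ip _ _ (subst₂ E⁻ (sym (at v∈)) (sym (at w∈)) e)
        ex : ExtraEdge (length l)
        ex = record
          { u = ip-ix ; v = iq-ix ; u-internal = intern p∈ p≢s p≢t ; v-internal = intern q∈ q≢s q≢t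
          ; u≢v = λ e → Graph.adj-irrefl Γ p (subst (Adj Γ p) (trans (sym (at q∈)) (trans (sym (cong (lookup L) e)) (at p∈))) p~q)
          ; new = λ a → proj₂ (subst₂ E⁻ (at p∈) (at q∈) (I⁻.con⇒E L ip _ _ a)) (inj₁ (refl , refl))
          ; triangle = ic-ix , inj₁ (con p∈ c∈ pc) , inj₁ (con q∈ c∈ qc) }
        P : FuzzyOddPath
        P = record { length = length l ; odd = odd-pred _ ev ; extra = just ex }
        to : ∀ i j → Adj Γ (lookup L i) (lookup L j) → FuzzyAdj P i j
        to i j a with chord? (lookup L i) (lookup L j)
        ... | no ¬c = inj₁ (I⁻.E⇒con L ip i j (a , ¬c))
        ... | yes (inj₁ (e , e′)) = inj₂ (inj₁ (inj′ _ _ (trans e (sym (at p∈))) , inj′ _ _ (trans e′ (sym (at q∈)))))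
        ... | yes (inj₂ (e , e′)) = inj₂ (inj₂ (inj′ _ _ (trans e (sym (at q∈))) , inj′ _ _ (trans e′ (sym (at p∈)))))
        from : ∀ i j → FuzzyAdj P i j → Adj Γ (lookup L i) (lookup L j)
        from i j (inj₁ c) = proj₁ (I⁻.con⇒E L ip i j c)
        from i j (inj₂ (inj₁ (refl , refl))) = subst₂ (Adj Γ) (sym (at p∈)) (sym (at q∈)) p~q
        from i j (inj₂ (inj₂ (refl , refl))) = subst₂ (Adj Γ) (sym (at q∈)) (sym (at p∈)) (Graph.adj-sym Γ p~q)

  -- Correcting the parity of a connection

  Last-∈ : ∀ {X : Set} {s : X} {l} → Last s l → s ∈ l
  Last-∈ here      = here refl
  Last-∈ (there e) = there (Last-∈ e)

  Last-tail : ∀ {X : Set} {s x : X} {l} → Last s (x ∷ l) → x ≢ s → Last s l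
  Last-tail here      ne = contradiction refl ne
  Last-tail (there e) ne = e

  Last-length : ∀ {X : Set} {s : X} {l} → Last s l → 1 ≤ length l
  Last-length here      = s≤s z≤n
  Last-length (there e) = s≤s z≤n

  module _ {n : ℕ} (Γ : Graph n) where

    module _ {s t : Fin n} {U : Fin n → Set} {p q : Fin n} {la lb : List (Fin n)}
             (ipa : IP Γ (p ∷ la)) (sa : Last s (p ∷ la)) (ipb : IP Γ (q ∷ lb)) (tb : Last t (q ∷ lb))
             (p≢s : p ≢ s) (q≢t : q ≢ t) (p≢q : p ≢ q)
             (p-lb : All (Far Γ p) lb) (q-la : All (Far Γ q) la) (la-lb : All (λ a → All (Far Γ a) lb) la)
             (Ua : All (OnPath Γ s t U) (p ∷ la)) (Ub : All (OnPath Γ s t U) (q ∷ lb)) where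

      private
        la≥1 : 1 ≤ length la
        la≥1 = Last-length (Last-tail sa p≢s)

        toApart : ∀ {x l} → All (Far Γ x) l → All (Apart′ Γ x) l
        toApart = All.map (far⇒apart Γ)

      direct : Adj Γ p q → par (length la + length lb) ≡ false → OddFuzzy Γ s t U
      direct pq ev = go (head-ʳ++ sa (q ∷ lb))
        where
        L : List (Fin n)
        L = (p ∷ la) ʳ++ (q ∷ lb)
        len : length L ≡ suc (length la) + suc (length lb)
        len = length-ʳ++ (p ∷ la)
        ip : IP Γ L
        ip = glue Γ p la q lb ipa ipb pq (toApart p-lb) (zip q-la la-lb)
          where
          zip : ∀ {l} → All (Far Γ q) l → All (λ a → All (Far Γ a) lb) l → All (λ a → All (Apart′ Γ a) (q ∷ lb)) l
          zip []       []       = []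
          zip (a ∷ as) (b ∷ bs) = (apart-sym Γ (far⇒apart Γ a) ∷ toApart b) ∷ zip as bs
        go : ∃[ k ] L ≡ s ∷ k → OddFuzzy Γ s t U
        go (k , e) = plain Γ k (subst (IP Γ) e ip) (subst (Last t) e (Last-ʳ++ (p ∷ la) tb)) (subst (All _) e (All-ʳ++ Ua Ub))
          (trans (cong par (trans (sym (cong length e)) (trans len (cong suc (+-suc (length la) (length lb)))))) (cong (not ∘ not) ev))
          (s≤s⁻¹ (subst (2 <_) (cong length e) (subst (2 <_) (sym len) (+-mono-≤ {2} {_} {1} (s≤s la≥1) (s≤s z≤n)))))

      -- Inserting `c` flips the parity that `direct` needs. The one adjacency left open is that of
      -- `p` and `q`; if present, it closes the triangle with `c` and serves as the additional edge,
      -- for neither `p` nor `q` is an end of the path.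
      bridge : ∀ {c} → Adj Γ p c → Adj Γ c q → All (Far Γ c) la → All (Far Γ c) lb → OnPath Γ s t U c →
               par (length la + length lb) ≡ true → OddFuzzy Γ s t U
      bridge {c} pc cq c-la c-lb Uc ev = go (head-ʳ++ sa (c ∷ q ∷ lb)) (near? Γ p q)
        where
        L : List (Fin n)
        L = (p ∷ la) ʳ++ (c ∷ q ∷ lb)
        len : length L ≡ suc (length la) + suc (suc (length lb))
        len = length-ʳ++ (p ∷ la)
        evL : par (length L) ≡ false
        evL = trans (cong par (trans len (cong suc (trans (+-suc (length la) _) (cong suc (+-suc (length la) (length lb)))))))
                    (cong (not ∘ not ∘ not) ev)
        big : ∀ {k} → L ≡ s ∷ k → 1 < length k
        big e = s≤s⁻¹ (subst (2 <_) (cong length e) (subst (2 <_) (sym len) (+-mono-≤ {2} {_} {1} (s≤s la≥1) (s≤s z≤n))))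
        laL : Last t L
        laL = Last-ʳ++ (p ∷ la) (there tb)
        UL : All (OnPath Γ s t U) L
        UL = All-ʳ++ Ua (Uc ∷ Ub)
        zip₃ : ∀ {R : Fin n → Fin n → Set} {l} → All (λ a → R a c) l → All (λ a → R a q) l → All (λ a → All (R a) lb) l →
               All (λ a → All (R a) (c ∷ q ∷ lb)) l
        zip₃ []       []       []       = []
        zip₃ (a ∷ as) (b ∷ bs) (d ∷ ds) = (a ∷ b ∷ d) ∷ zip₃ as bs ds
        cr : All (λ a → All (Apart′ Γ a) (c ∷ q ∷ lb)) la
        cr = zip₃ (All.map (apart-sym Γ ∘ far⇒apart Γ) c-la) (All.map (apart-sym Γ ∘ far⇒apart Γ) q-la) (All.map toApart la-lb)

        p≢t : p ≢ t
        p≢t refl with Last-∈ tb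
        ... | here e   = p≢q e
        ... | there t∈ = All.lookup p-lb t∈ (inj₁ refl)
        q≢s : q ≢ s
        q≢s refl with Last-∈ sa
        ... | here e   = p≢q (sym e)
        ... | there s∈ = All.lookup q-la s∈ (inj₁ refl)

        module _ (pq : Adj Γ p q) where
          private
            module I = I⁻ Γ p q pq
            -- Each of the two given paths avoids one end of the chord, so deleting the chord
            -- changes none of its adjacencies.
            weaken : ∀ {Good : Fin n → Set} → (∀ {x y} → Good x → Good y → ¬ Chord Γ p q pq x y) → ∀ l → All Good l → IP Γ l → I.IP l
            weaken nc []          _              _             = tt
            weaken nc (x ∷ [])    _              _             = tt
            weaken nc (x ∷ y ∷ l) (gx ∷ gs@(gy ∷ _)) (e , al , ip) =
              (e , nc gx gy) , All.map (λ (¬a , ne) → ¬a ∘ proj₁ , ne) al , weaken nc (y ∷ l) gs ip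
            lift : ∀ {x l} → All (Apart′ Γ x) l → All (I.Apart′ x) l
            lift = All.map λ (¬a , ne) → ¬a ∘ proj₁ , ne
            noq : ∀ {x y} → x ≢ q → y ≢ q → ¬ Chord Γ p q pq x y
            noq _  y≢ (inj₁ (_ , e)) = y≢ e
            noq x≢ _  (inj₂ (e , _)) = x≢ e
            nop : ∀ {x y} → x ≢ p → y ≢ p → ¬ Chord Γ p q pq x y
            nop x≢ _  (inj₁ (e , _)) = x≢ e
            nop _  y≢ (inj₂ (_ , e)) = y≢ e
            c≢p : c ≢ p
            c≢p refl = Graph.adj-irrefl Γ c pc
            c≢q : c ≢ q
            c≢q refl = Graph.adj-irrefl Γ c cq
          pc⁻ : E⁻ Γ p q pq p c
          pc⁻ = pc , λ where (inj₁ (_ , e)) → c≢q e ; (inj₂ (e , _)) → p≢q e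
          cq⁻ : E⁻ Γ p q pq c q
          cq⁻ = cq , λ where (inj₁ (e , _)) → c≢p e ; (inj₂ (e , _)) → c≢q e
          ip⁻ : I.IP L
          ip⁻ = I.glue p la c (q ∷ lb)
            (weaken noq (p ∷ la) (p≢q ∷ All.map (λ f e → f (inj₁ (sym e))) q-la) ipa)
            (cq⁻ , lift (toApart c-lb) , weaken nop (q ∷ lb) ((p≢q ∘ sym) ∷ All.map (λ f e → f (inj₁ (sym e))) p-lb) ipb)
            pc⁻ (((λ (_ , nc) → nc (inj₁ (refl , refl))) , p≢q) ∷ lift (toApart p-lb)) (All.map lift cr)

        go : ∃[ k ] L ≡ s ∷ k → Dec (Near Γ p q) → OddFuzzy Γ s t U
        go (k , e) (no ¬pq) = plain Γ k
          (subst (IP Γ) e (glue Γ p la c (q ∷ lb) ipa (cq , toApart c-lb , ipb) pc (far⇒apart Γ ¬pq ∷ toApart p-lb) cr))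
          (subst (Last t) e laL) (subst (All _) e UL) (subst (λ l → par (length l) ≡ false) e evL) (big e)
        go (k , e) (yes nr) = fuzzy Γ p q pq k (subst (I⁻.IP Γ p q pq) e (ip⁻ pq))
          (subst (Last t) e laL) (subst (All _) e UL) (subst (λ l → par (length l) ≡ false) e evL) (big e)
          p≢s p≢t q≢s q≢t
          (subst (p ∈_) e (p∈ʳ++ la)) (subst (q ∈_) e (∈-ʳ++⁺ʳ (p ∷ la) (there (here refl))))
          (subst (c ∈_) e (∈-ʳ++⁺ʳ (p ∷ la) (here refl))) (pc⁻ pq) (E⁻-sym Γ p q pq (cq⁻ pq))
          where
          pq = near⇒adj Γ nr p≢q
          p∈ʳ++ : ∀ l {m} → p ∈ (p ∷ l) ʳ++ m
          p∈ʳ++ l = ∈-ʳ++⁺ʳ l (here refl)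

    ReachPar : Fin n → (Fin n → Set) → Fin n → Bool → Set
    ReachPar s A x b = ∃[ l ] IP Γ (x ∷ l) × Last s (x ∷ l) × All A l × par (length l) ≡ b

    -- The result is uniform in `U`, because the vertex set allotted to a link can be named only
    -- once `x`, `y` and `m` are known.
    Outcome : (s t : Fin n) (A B : Fin n → Set) (X : Sub n) (w q : Fin n → Fin n) → Set₁
    Outcome s t A B X w q = ∃[ x ] ∃[ y ] ∃[ m ] X ∋ x × X ∋ y × X ∋ m ×
      (∀ U → (∀ {v} → A v → OnPath Γ s t U v) → (∀ {v} → B v → OnPath Γ s t U v) → U x → U y → U (w m) → U (q y) → OddFuzzy Γ s t U)

    module _ {V₀ d u} (Sp : Sparse Γ V₀ d u) where
      open SparseProps Γ Sp

      module ParityLink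
        {s t : Fin n} {A B : Fin n → Set} (X : Sub n) (w q : Fin n → Fin n)
        (X⊑ : X ⊑ V₀) (X-big : 6 * u ≤ size X)
        (As : A s) (Bt : B t)
        (w-m  : ∀ {m} → X ∋ m → Adj Γ (w m) m) (q-m : ∀ {m} → X ∋ m → Adj Γ m (q m))
        (w∈V₀ : ∀ {m} → X ∋ m → V₀ ∋ w m)
        (ra : ∀ {m} → X ∋ m → Reach Γ s A (w m)) (rb : ∀ {m} → X ∋ m → Reach Γ t B (q m))
        (m-A : ∀ {m a} → X ∋ m → A a → Far Γ m a) (m-B : ∀ {m b} → X ∋ m → B b → Far Γ m b)
        (w-B : ∀ {m b} → X ∋ m → B b → Far Γ (w m) b) (q-A : ∀ {m a} → X ∋ m → A a → Far Γ (q m) a)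
        (A-B : ∀ {a b} → A a → B b → Far Γ a b)
        (w≢s : ∀ {m} → X ∋ m → w m ≢ s) (q≢t : ∀ {m} → X ∋ m → q m ≢ t)
        (w≢q : ∀ {m m′} → X ∋ m → X ∋ m′ → w m ≢ q m′) (m≢q : ∀ {m m′} → X ∋ m → X ∋ m′ → m ≢ q m′)
        (w≢m : ∀ {m m′} → X ∋ m → X ∋ m′ → w m ≢ m′)
        where

        private
          -- Fixing one path for each `m` turns the parity of its length into a colouring of `X`;
          -- `false` outside `X` is a default.
          colour : ∀ {r : Fin n} {D : Fin n → Set} (f : Fin n → Fin n) → (∀ {m} → X ∋ m → Reach Γ r D (f m)) →
                   ∃[ c ] ∀ m → X ∋ m → ReachPar r D (f m) (c m)
          colour {r} {D} f rc = (λ m → c m (mem? X m)) , λ m x → ok m x (mem? X m)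
            where
            c : ∀ m → Dec (X ∋ m) → Bool
            c m (yes x) = par (length (proj₁ (rc x)))
            c m (no _)  = false
            ok : ∀ m → X ∋ m → (x? : Dec (X ∋ m)) → ReachPar r D (f m) (c m x?)
            ok m x (no ¬x) = contradiction x ¬x
            ok m _ (yes x) = let (l , ip , la , al) = rc x in l , ip , la , al , refl

          α = proj₁ (colour w ra)
          β = proj₁ (colour q rb)

        outcome : Outcome s t A B X w q
        outcome with any? (λ m → mem? X m ×-dec (α m xor β m ≟ᵇ true))
        ... | yes (m , xm , odd) with proj₂ (colour w ra) m xm | proj₂ (colour q rb) m xm
        ...   | la , ipa , sa , Aa , ea | lb , ipb , tb , Bb , eb = m , m , m , xm , xm , xm , λ U UA UB um _ uw uq →
          bridge ipa sa ipb tb (w≢s xm) (q≢t xm) (w≢q xm xm)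
            (All.map (w-B xm) Bb) (All.map (q-A xm) Aa) (All.map (λ a → All.map (A-B a) Bb) Aa)
            (inj₁ uw ∷ All.map UA Aa) (inj₁ uq ∷ All.map UB Bb)
            (w-m xm) (q-m xm) (All.map (m-A xm) Aa) (All.map (m-B xm) Bb) (inj₁ um)
            (trans (par-+ (length la) (length lb)) (trans (cong₂ _xor_ ea eb) odd))
        outcome | no none = half (split₂ X-big)
          where
          same : ∀ {m} → X ∋ m → α m ≡ β m
          same {m} xm with α m in ea | β m in eb
          ... | false | false = refl
          ... | true  | true  = refl
          ... | false | true  = contradiction (m , xm , cong₂ _xor_ ea eb) none
          ... | true  | false = contradiction (m , xm , cong₂ _xor_ ea eb) none

          Xc : Bool → Sub n
          Xc c = sub λ m → mem? X m ×-dec (α m ≟ᵇ c)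

          -- Here the two parities agree at every vertex of `X`. A colour class of three units
          -- suffices: the covered part below takes at most two of them, and one stays uncovered.
          split₂ : 6 * u ≤ size X → ∃[ c ] 3 * u ≤ size (Xc c)
          split₂ le with 3 * u ≤? size (Xc true)
          ... | yes p = true , p
          ... | no ¬p = false , +-cancelˡ-≤ (3 * u) _ _ (begin
              3 * u + 3 * u                    ≡⟨ sym (*-distribʳ-+ u 3 3) ⟩
              6 * u                            ≤⟨ le ⟩
              size X                           ≤⟨ size-cover X (Xc true) (Xc false) (λ m xm → byc m xm (α m) refl) ⟩
              size (Xc true) + size (Xc false) ≤⟨ +-monoˡ-≤ _ (≰⇒≥ ¬p) ⟩
              3 * u + size (Xc false)          ∎)
            where
            open ≤-Reasoning
            byc : ∀ m → X ∋ m → ∀ c → α m ≡ c → Xc true ∋ m ⊎ Xc false ∋ m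
            byc m xm true  e = inj₁ (xm , e)
            byc m xm false e = inj₂ (xm , e)

          half : ∃[ c ] 3 * u ≤ size (Xc c) → Outcome s t A B X w q
          half (c , le) with first-suffix Stop stop? Pr (λ where _ _ (_ ∷ al) → al) (map w (toList X′)) prW full start
            where
            X′ = Xc c
            Stop : List (Fin n) → Set
            Stop ys = u ≤ size (X′ ∩ Cov Γ ys)
            stop? : ∀ ys → Dec (Stop ys)
            stop? ys = u ≤? size (X′ ∩ Cov Γ ys)
            Pr : List (Fin n) → Set
            Pr = All (λ v → ∃[ m ] X′ ∋ m × v ≡ w m)
            prW : Pr (map w (toList X′))
            prW = All.map⁺ (All.tabulate λ {m} m∈ → m , toList⁻ X′ m∈ , refl)
            full : Stop (map w (toList X′))
            full = ≤-trans (≤-trans (m≤m+n u (u + (u + 0))) le) (size-mono X′ (X′ ∩ Cov Γ (map w (toList X′))) λ m m∈ → m∈ ,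
              Any.map⁺ (lose (toList⁺ X′ m∈) (inj₂ (w-m (proj₁ m∈)))))
            start : ¬ Stop []
            start p = contradiction (≤-trans 1≤u (≤-trans p (≤-reflexive (size-empty (X′ ∩ Cov Γ []) λ _ → λ ())))) λ ()
          ... | y , ys , ¬st , st , al@((my , xmy , refl) ∷ _) = finish (coh X₁ X₂ (λ v → X⊑ v ∘ proj₁ ∘ proj₁) (λ v → X⊑ v ∘ proj₁ ∘ proj₁) st big₂)
            where
            X₁ X₂ : Sub n
            X₁ = Xc c ∩ Cov Γ (y ∷ ys)
            X₂ = Xc c ∖ Cov Γ (y ∷ ys)
            big₂ : u ≤ size X₂
            big₂ = +-cancelˡ-≤ (u + u) _ _ (begin
              u + u + u                 ≡⟨ trans (+-assoc u u u) (cong (λ z → u + (u + z)) (sym (+-identityʳ u))) ⟩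
              3 * u                     ≤⟨ le ⟩
              size (Xc c)               ≤⟨ size-split (Xc c) (Cov Γ (y ∷ ys)) ⟩
              size X₁ + size X₂         ≤⟨ +-monoˡ-≤ _ (≤-trans (cov-∷ y ys (Xc c) (w∈V₀ (proj₁ xmy)) (λ v → X⊑ v ∘ proj₁)) (+-mono-≤ (<⇒≤ (≰⇒> ¬st)) d≤u)) ⟩
              u + u + size X₂           ∎)
              where open ≤-Reasoning
            finish : ∃[ a ] ∃[ b ] X₁ ∋ a × X₂ ∋ b × Near Γ a b → Outcome s t A B X w q
            finish (a , b , ((xa , _) , cov) , ((xb , αb) , ¬cov) , nr) with find cov
            ... | w′ , w∈ , nrw with All.lookup al w∈
            ...   | m , (xm , αm) , refl with proj₂ (colour w ra) m xm | proj₂ (colour q rb) b xb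
            ...     | la , ipa , sa , Aa , ea | lb , ipb , tb , Bb , eb = a , b , m , xa , xb , xm , build
              where
              a~b : Adj Γ a b
              a~b = near⇒adj Γ nr λ where refl → ¬cov cov
              w~a : Adj Γ (w m) a
              w~a = near⇒adj Γ nrw (w≢m xm xa)
              par-ab : par (length la + length lb) ≡ false
              par-ab = trans (par-+ (length la) (length lb)) (trans (cong₂ _xor_ (trans ea αm) (trans eb (trans (sym (same xb)) αb))) (xor-same c))
              build : ∀ U → (∀ {v} → A v → OnPath Γ s t U v) → (∀ {v} → B v → OnPath Γ s t U v) → U a → U b → U (w m) → U (q b) → OddFuzzy Γ s t U
              -- If `w m` and `q b` are adjacent, the path skips `a` and `b`; otherwise it runs
              -- through `w m`, `a`, `b`, `q b`. As `b` is uncovered, it is not adjacent to `w m`,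
              -- so `a` and `q b` form the only possible chord, which `bridge` admits.
              build U UA UB ua ub uw uq with near? Γ (w m) (q b)
              ... | yes wq = direct ipa sa ipb tb (w≢s xm) (q≢t xb) (w≢q xm xb)
                    (All.map (w-B xm) Bb) (All.map (q-A xb) Aa) (All.map (λ a → All.map (A-B a) Bb) Aa)
                    (inj₁ uw ∷ All.map UA Aa) (inj₁ uq ∷ All.map UB Bb) (near⇒adj Γ wq (w≢q xm xb)) par-ab
              ... | no ¬wq = bridge {p = a} {la = w m ∷ la}
                    (Graph.adj-sym Γ w~a , All.map (far⇒apart Γ ∘ m-A xa) Aa , ipa) (there sa) ipb tb
                    (λ where refl → m-A xa As (inj₁ refl)) (q≢t xb) (m≢q xa xb)
                    (All.map (m-B xa) Bb) ((¬wq ∘ near-sym Γ) ∷ All.map (q-A xb) Aa)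
                    (All.map (w-B xm) Bb ∷ All.map (λ a → All.map (A-B a) Bb) Aa)
                    (inj₁ ua ∷ inj₁ uw ∷ All.map UA Aa) (inj₁ uq ∷ All.map UB Bb)
                    a~b (q-m xb) (far-sym Γ (¬Cov⇒far Γ ¬cov w∈) ∷ All.map (m-A xb) Aa) (All.map (m-B xb) Bb) (inj₁ ub)
                    (cong not par-ab)

  -- Assembling a subdivision

  unique-lookup : ∀ {X : Set} {xs : List X} → Unique xs → ∀ i j → lookup xs i ≡ lookup xs j → i ≡ j
  unique-lookup (_ ∷ _)  zero    zero    _ = refl
  unique-lookup (a ∷ _)  zero    (suc j) e = contradiction e (All.lookup a (∈-lookup j))
  unique-lookup (a ∷ _)  (suc i) zero    e = contradiction (sym e) (All.lookup a (∈-lookup i))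
  unique-lookup (_ ∷ un) (suc i) (suc j) e = cong suc (unique-lookup un i j e)

  edge-≡ : ∀ {h} {H : Graph h} {e e′ : Edge H} → Edge.lo e ≡ Edge.lo e′ → Edge.hi e ≡ Edge.hi e′ → e ≡ e′
  edge-≡ {H = H} {record { lo = x ; hi = y ; lo<hi = p ; adjacent = a }} {record { lo<hi = p′ ; adjacent = a′ }} refl refl
    with <-irrelevant p p′ | T-irrelevant {Graph.adj H x y} a a′
  ... | refl | refl = refl

  anyEdge? : ∀ {h} {H : Graph h} {P : Edge H → Set} → (∀ e → Dec (P e)) → Dec (∃ P)
  anyEdge? {H = H} {P} P? = map′ (λ (x , y , p , a , q) → record { lo = x ; hi = y ; lo<hi = p ; adjacent = a } , q)
                                 (λ (e , q) → Edge.lo e , Edge.hi e , Edge.lo<hi e , Edge.adjacent e , q)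
                                 (any? λ x → any? λ y → here? x y)
    where
    here? : ∀ x y → Dec (∃[ p ] ∃[ a ] P (record { lo = x ; hi = y ; lo<hi = p ; adjacent = a }))
    here? x y with x Fin.<? y | T? (Graph.adj H x y)
    ... | no ¬p | _    = no λ (p , _) → ¬p p
    ... | yes _ | no ¬a = no λ (_ , a , _) → ¬a a
    ... | yes p | yes a with P? (record { lo = x ; hi = y ; lo<hi = p ; adjacent = a })
    ...   | yes q = yes (p , a , q)
    ...   | no ¬q = no λ (p′ , a′ , q) → ¬q (subst P (edge-≡ refl refl) q)

  -- The subdivision is the subgraph induced on all branch vertices and paths, so its embedding is
  -- immediate; the content is that it has no edges besides those of the paths.
  module _ {n h : ℕ} (Γ : Graph n) (H : Graph h) (b : Fin h → Fin n) (b-inj : Injective _≡_ _≡_ b)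
           (b-far : ∀ {x y} → x ≢ y → Far Γ (b x) (b y))
           (U : Edge H → Fin n → Set)
           (link : ∀ e → OddFuzzy Γ (b (Edge.lo e)) (b (Edge.hi e)) (U e))
           (U≢b : ∀ {e v} x → U e v → v ≢ b x)
           (U-b : ∀ {e v x} → U e v → x ≢ Edge.lo e → x ≢ Edge.hi e → Far Γ v (b x))
           (U-U : ∀ {e e′ v w} → e ≢ e′ → U e v → U e′ w → Far Γ v w)
           where

    private
      module O e = OddFuzzy (link e)

      Used : Sub n
      Used = sub λ v → (any? λ x → v ≟ b x) ⊎-dec (anyEdge? λ e → any? λ i → v ≟ O.place e i)

      used : List (Fin n)
      used = toList Used

      m : ℕ
      m = length used

      emb : Fin m → Fin n
      emb = lookup used

      emb-inj : ∀ {i j} → emb i ≡ emb j → i ≡ j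
      emb-inj {i} {j} = unique-lookup (Unique.filter⁺ (mem? Used) (Unique.allFin⁺ n)) i j

      ix : ∀ {v} → Used ∋ v → Fin m
      ix u = Any.index (toList⁺ Used u)

      emb-ix : ∀ {v} (u : Used ∋ v) → emb (ix u) ≡ v
      emb-ix u = sym (Any.lookup-index (toList⁺ Used u))

      J : Graph m
      J = record { adj = λ i j → Graph.adj Γ (emb i) (emb j) ; adj-sym = Graph.adj-sym Γ ; adj-irrefl = λ i → Graph.adj-irrefl Γ (emb i) }

      br : Fin h → Fin m
      br x = ix {b x} (inj₁ (x , refl))

      pl : ∀ e → FuzzyOddPath.Vertex (O.path e) → Fin m
      pl e i = ix {O.place e i} (inj₂ (e , i , refl))

      emb-br : ∀ x → emb (br x) ≡ b x
      emb-br x = emb-ix (inj₁ (x , refl))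

      emb-pl : ∀ e i → emb (pl e i) ≡ O.place e i
      emb-pl e i = emb-ix (inj₂ (e , i , refl))

      data Kind e : FuzzyOddPath.Vertex (O.path e) → Set where
        first : ∀ {i} → i ≡ zero → Kind e i
        final : ∀ {i} → i ≡ fromℕ _ → Kind e i
        inner : ∀ {i} → Internal i → Kind e i

      kind : ∀ e i → Kind e i
      kind e i with i ≟ zero | i ≟ fromℕ _
      ... | yes p | _     = first p
      ... | no _  | yes p = final p
      ... | no p  | no q  = inner (p , q)

      end-or-inner : ∀ e i → (∃[ x ] (x ≡ Edge.lo e ⊎ x ≡ Edge.hi e) × O.place e i ≡ b x) ⊎ U e (O.place e i)
      end-or-inner e i with kind e i
      ... | first refl = inj₁ (Edge.lo e , inj₁ refl , O.start e)
      ... | final refl = inj₁ (Edge.hi e , inj₂ refl , O.end e)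
      ... | inner p    = inj₂ (O.inside e i p)

      on-edge : ∀ e {x} → x ≡ Edge.lo e ⊎ x ≡ Edge.hi e → ∃[ j ] O.place e j ≡ b x
      on-edge e (inj₁ refl) = zero , O.start e
      on-edge e (inj₂ refl) = fromℕ _ , O.end e

      near-b : ∀ e i x → Near Γ (O.place e i) (b x) → (x ≡ Edge.lo e ⊎ x ≡ Edge.hi e)
      near-b e i x nr with x ≟ Edge.lo e | x ≟ Edge.hi e
      ... | yes p | _     = inj₁ p
      ... | no _  | yes q = inj₂ q
      ... | no p  | no q with end-or-inner e i
      ...   | inj₂ u = contradiction nr (U-b u p q)
      ...   | inj₁ (y , y∈ , ey) with y ≟ x
      ...     | yes refl = contradiction y∈ [ p , q ]′
      ...     | no ne    = contradiction (subst (λ v → Near Γ v (b x)) ey nr) (b-far ne)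

      Joined : Fin n → Fin n → Set
      Joined v w = ∃[ e ] ∃[ i ] ∃[ j ] v ≡ O.place e i × w ≡ O.place e j × FuzzyAdj (O.path e) i j

      joined-sym : ∀ {v w} → Joined v w → Joined w v
      joined-sym (e , i , j , p , q , f) = e , j , i , q , p ,
        Equivalence.to (O.adj e j i) (Graph.adj-sym Γ (Equivalence.from (O.adj e i j) f))

      join : ∀ e i j → Adj Γ (O.place e i) (O.place e j) → Joined (O.place e i) (O.place e j)
      join e i j a = e , i , j , refl , refl , Equivalence.to (O.adj e i j) a

      -- By `near-b` the branch vertex is an end of `e`. It therefore lies on the path of `e`, whose
      -- adjacencies are known.
      join-b : ∀ x e i → Adj Γ (O.place e i) (b x) → Joined (O.place e i) (b x)
      join-b x e i a with on-edge e (near-b e i x (inj₂ a))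
      ... | j , ej = subst (Joined (O.place e i)) ej (join e i j (subst (Adj Γ (O.place e i)) (sym ej) a))

      join-U : ∀ e i e′ j → Adj Γ (O.place e i) (O.place e′ j) → Joined (O.place e i) (O.place e′ j)
      join-U e i e′ j a with end-or-inner e i | end-or-inner e′ j
      ... | inj₁ (x , _ , ex) | _ = subst (λ v → Joined v (O.place e′ j)) (sym ex)
              (joined-sym (join-b x e′ j (Graph.adj-sym Γ (subst (λ v → Adj Γ v (O.place e′ j)) ex a))))
      ... | inj₂ _ | inj₁ (x , _ , ex) = subst (Joined (O.place e i)) (sym ex) (join-b x e i (subst (Adj Γ (O.place e i)) ex a))
      ... | inj₂ u | inj₂ u′ with Edge.lo e ≟ Edge.lo e′ | Edge.hi e ≟ Edge.hi e′
      ...   | no ne | _     = contradiction (inj₂ a) (U-U (ne ∘ cong Edge.lo) u u′)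
      ...   | yes _ | no ne = contradiction (inj₂ a) (U-U (ne ∘ cong Edge.hi) u u′)
      ...   | yes p | yes q with edge-≡ {e = e} {e′ = e′} p q
      ...     | refl = join e i j a

      adj⇒joined : ∀ {v w} → Used ∋ v → Used ∋ w → Adj Γ v w → Joined v w
      adj⇒joined (inj₁ (x , refl)) (inj₁ (y , refl)) a with x ≟ y
      ... | yes refl = contradiction a (Graph.adj-irrefl Γ _)
      ... | no ne    = contradiction (inj₂ a) (b-far ne)
      adj⇒joined (inj₁ (x , refl)) (inj₂ (e , i , refl)) a = joined-sym (join-b x e i (Graph.adj-sym Γ a))
      adj⇒joined (inj₂ (e , i , refl)) (inj₁ (x , refl)) a = join-b x e i a
      adj⇒joined (inj₂ (e , i , refl)) (inj₂ (e′ , j , refl)) a = join-U e i e′ j a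

      emb-used : ∀ z → Used ∋ emb z
      emb-used z = toList⁻ Used (∈-lookup z)

      subdivision : ProperFuzzyOddSubdivision H J
      subdivision = record
        { branch = br
        ; branch-inj = λ {x} {y} e → b-inj (trans (sym (emb-br x)) (trans (cong emb e) (emb-br y)))
        ; path = O.path
        ; proper = O.proper
        ; place = pl
        ; place-inj = λ e {i} {j} eq → O.inj e (trans (sym (emb-pl e i)) (trans (cong emb eq) (emb-pl e j)))
        ; start = λ e → emb-inj (trans (emb-pl e zero) (trans (O.start e) (sym (emb-br (Edge.lo e)))))
        ; end = λ e → emb-inj (trans (emb-pl e (fromℕ _)) (trans (O.end e) (sym (emb-br (Edge.hi e)))))
        ; internal≢branch = λ e i x p eq → U≢b x (O.inside e i p) (trans (sym (emb-pl e i)) (trans (cong emb eq) (emb-br x)))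
        ; internal-disjoint = λ e e′ i i′ ne p p′ eq → U-U ne (O.inside e i p) (O.inside e′ i′ p′)
            (inj₁ (trans (sym (emb-pl e i)) (trans (cong emb eq) (emb-pl e′ i′))))
        ; vertices = λ z → verts z (emb-used z)
        ; edges = λ z z′ → mk⇔ (to z z′) (from z z′)
        }
        where
        verts : ∀ z → Used ∋ emb z → (∃[ x ] z ≡ br x) ⊎ (∃[ e ] ∃[ i ] z ≡ pl e i)
        verts z (inj₁ (x , eq))     = inj₁ (x , emb-inj (trans eq (sym (emb-br x))))
        verts z (inj₂ (e , i , eq)) = inj₂ (e , i , emb-inj (trans eq (sym (emb-pl e i))))
        to : ∀ z z′ → Adj J z z′ → ∃[ e ] ∃[ i ] ∃[ i′ ] z ≡ pl e i × z′ ≡ pl e i′ × FuzzyAdj (O.path e) i i′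
        to z z′ a with adj⇒joined (emb-used z) (emb-used z′) a
        ... | e , i , j , p , q , f = e , i , j , emb-inj (trans p (sym (emb-pl e i))) , emb-inj (trans q (sym (emb-pl e j))) , f
        from : ∀ z z′ → ∃[ e ] ∃[ i ] ∃[ i′ ] z ≡ pl e i × z′ ≡ pl e i′ × FuzzyAdj (O.path e) i i′ → Adj J z z′
        from z z′ (e , i , j , refl , refl , f) = subst₂ (Adj Γ) (sym (emb-pl e i)) (sym (emb-pl e j)) (Equivalence.from (O.adj e i j) f)

    abstract
      contains-subdivision : ContainsSubdivision H Γ
      contains-subdivision = m , J , subdivision , emb , (λ {i} {j} → emb-inj {i} {j}) , λ i j → mk⇔ id id

  -- Sequential extraction from a shrinking reservoir

  module _ {n : ℕ} (Γ : Graph n) {V₀ : Sub n} {d u : ℕ} (Sp : Sparse Γ V₀ d u) {s N : ℕ} (S : State Γ V₀ s u N) where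

    open SparseProps Γ Sp
    private module S = State S

    tl : Fin N → Fin n → Fin n
    tl i = Hub.tl (S.hub i)

    K : Fin N → List (Fin n)
    K i = Hub.K (S.hub i)

    M : Fin N → Sub n
    M i = Hub.M (S.hub i)

    at : Fin N → Fin n → Sub n
    at i = tails-at Γ (S.hub i)

    IsTail : Fin N → Fin n → Fin n → Set
    IsTail i m p = p ≡ m ⊎ p ≡ tl i m

    -- `a` is a budget in units of `u`. `good` and `clean` limit what a used vertex can spoil: fewer
    -- than `u` members of any class other than its own have their tail near it.
    record World (a : ℕ) : Set₁ where
      field
        V R     : Sub n
        Mw      : Fin N → Sub n
        V⊑      : V ⊑ S.V
        R⊑      : R ⊑ V
        R⊑S     : R ⊑ S.R
        Mw⊑V    : ∀ i → Mw i ⊑ V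
        Mw⊑M    : ∀ i → Mw i ⊑ M i
        good    : ∀ {v} → V ∋ v → ∀ i → size (at i v) < u
        clean   : ∀ {i j m} → i ≢ j → Mw i ∋ m → size (at j (tl i m)) < u
        R-size  : a * u ≤ size R
        Mw-size : ∀ i → a * u ≤ size (Mw i)

      V⊑V₀ : V ⊑ V₀
      V⊑V₀ v = S.V⊑ v ∘ V⊑ v

    open World

    infix 4 _≼_
    record _≼_ {a a′} (w : World a) (w′ : World a′) : Set where
      field
        V≼ : V w ⊑ V w′
        M≼ : ∀ i → Mw w i ⊑ Mw w′ i

    open _≼_

    ≼-refl : ∀ {a} {w : World a} → w ≼ w
    ≼-refl = record { V≼ = λ _ → id ; M≼ = λ _ _ → id }

    ≼-trans : ∀ {a b c} {w : World a} {w′ : World b} {w″ : World c} → w ≼ w′ → w′ ≼ w″ → w ≼ w″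
    ≼-trans p q = record { V≼ = λ v → V≼ q v ∘ V≼ p v ; M≼ = λ i m → M≼ q i m ∘ M≼ p i m }

    resize : ∀ {a b} → a ≡ b → World a → World b
    resize refl w = w

    resize≼ : ∀ {a b} (e : a ≡ b) (w : World a) → resize e w ≼ w
    resize≼ refl w = ≼-refl

    -- A used vertex p carries as tag the class l whose tails are allowed to come near it.
    Inside : ∀ {a} → World a → Fin n → Fin N → Set
    Inside w p l = V w ∋ p ⊎ (∃[ m ] Mw w l ∋ m × p ≡ tl l m)

    record Avoids {a} (w : World a) (p : Fin n) (l : Fin N) : Set where
      field
        far-V  : ∀ {v} → V w ∋ v → Far Γ p v
        far-tl : ∀ {l′ m} → l ≢ l′ → Mw w l′ ∋ m → Far Γ p (tl l′ m)

    open Avoids public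

    inside-≼ : ∀ {a a′} {w : World a} {w′ : World a′} → w ≼ w′ → ∀ {p l} → Inside w p l → Inside w′ p l
    inside-≼ le (inj₁ v)           = inj₁ (V≼ le _ v)
    inside-≼ le (inj₂ (m , m∈ , e)) = inj₂ (m , M≼ le _ m m∈ , e)

    avoids-≼ : ∀ {a a′} {w : World a} {w′ : World a′} → w ≼ w′ → ∀ {p l} → Avoids w′ p l → Avoids w p l
    avoids-≼ le av = record { far-V = λ v → far-V av (V≼ le _ v) ; far-tl = λ ne m∈ → far-tl av ne (M≼ le _ _ m∈) }

    avoids⇒far : ∀ {a} {w : World a} {p q l l′} → Avoids w p l → Inside w q l′ → l ≢ l′ → Far Γ p q
    avoids⇒far av (inj₁ v)               ne = far-V av v
    avoids⇒far av (inj₂ (m , m∈ , refl)) ne = far-tl av ne m∈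

    Usable : Fin n × Fin N → Set
    Usable (p , l) = V₀ ∋ p × (∀ l′ → l ≢ l′ → size (at l′ p) < u)

    inside⇒usable : ∀ {a} (w : World a) {p l} → Inside w p l → Usable (p , l)
    inside⇒usable w (inj₁ v)               = V⊑V₀ w _ v , λ l′ _ → good w v l′
    inside⇒usable w (inj₂ (m , m∈ , refl)) = Hub.tl∈ (S.hub _) (Mw⊑M w _ m m∈) , λ l′ ne → clean w ne m∈

    HitV : List (Fin n × Fin N) → Sub n
    HitV F = sub λ v → Any.any? (λ (p , _) → near? Γ p v) F

    HitT : Fin N → List (Fin n × Fin N) → Sub n
    HitT l F = sub λ m → Any.any? (λ (p , l′) → ¬? (l′ ≟ l) ×-dec near? Γ (tl l m) p) F

    hitV-few : ∀ (A : Sub n) → A ⊑ V₀ → ∀ F → All Usable F → size (A ∩ HitV F) ≤ length F * u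
    hitV-few A A⊑ []            []         = ≤-reflexive (size-empty (A ∩ HitV []) λ _ → λ ())
    hitV-few A A⊑ ((p , l) ∷ F) (ok ∷ oks) = ≤-trans
      (size-cover (A ∩ HitV ((p , l) ∷ F)) (sub λ x → mem? V₀ x ×-dec near? Γ p x) (A ∩ HitV F)
        λ where v (a , here nr) → inj₁ (A⊑ v a , nr) ; v (a , there h) → inj₂ (a , h))
      (+-mono-≤ (≤-trans (deg p (proj₁ ok)) d≤u) (hitV-few A A⊑ F oks))

    hitT-few : ∀ l (A : Sub n) → A ⊑ M l → ∀ F → All Usable F → size (A ∩ HitT l F) ≤ length F * u
    hitT-few l A A⊑ []             []         = ≤-reflexive (size-empty (A ∩ HitT l []) λ _ → λ ())
    hitT-few l A A⊑ ((p , l′) ∷ F) (ok ∷ oks) = ≤-trans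
      (size-cover (A ∩ HitT l ((p , l′) ∷ F)) B (A ∩ HitT l F)
        λ where v (a , here nr) → inj₁ (a , nr) ; v (a , there h) → inj₂ (a , h))
      (+-mono-≤ one (hitT-few l A A⊑ F oks))
      where
      B = sub λ m → mem? A m ×-dec (¬? (l′ ≟ l) ×-dec near? Γ (tl l m) p)
      one : size B ≤ u
      one = case l′ ≟ l of λ where
        (yes refl) → ≤-trans (≤-reflexive (size-empty B λ _ (_ , ne , _) → ne refl)) z≤n
        (no ne)    → ≤-trans (size-mono B (at l p) λ m (a , _ , nr) → A⊑ m a , nr) (<⇒≤ (proj₂ ok l ne))

    -- Each entry of `F` costs one unit for the vertices near it and one for members with a tail
    -- near it, hence `length F + length F`. The list `Kt` may be long, so it is charged by what it
    -- covers; its distance from tails is free, because it was taken from `R`.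
    module Shrink {a} c (w : World (c + a)) (F : List (Fin n × Fin N)) (usable : All Usable F)
                  (Kt : List (Fin n)) (Kt⊑ : All (R w ∋_) Kt) (c₁ : ℕ) (cov≤ : size (V w ∩ Cov Γ Kt) ≤ c₁ * u)
                  (enough : c₁ + (length F + length F) ≤ c) where

      private
        trim : ∀ (A B : Sub n) → A ⊑ V w → size (A ∩ B) ≤ length F * u → (c + a) * u ≤ size A →
               a * u ≤ size (A ∖ Cov Γ Kt ∖ HitV F ∖ B)
        trim A B A⊑ AB le = +-cancelˡ-≤ (c * u) _ _ (begin
          c * u + a * u                 ≡⟨ sym (*-distribʳ-+ u c a) ⟩
          (c + a) * u                   ≤⟨ le ⟩
          size A                        ≤⟨ size-split A (Cov Γ Kt) ⟩
          size (A ∩ Cov Γ Kt) + size (A ∖ Cov Γ Kt)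
            ≤⟨ +-mono-≤ (≤-trans (size-mono (A ∩ Cov Γ Kt) (V w ∩ Cov Γ Kt) λ v (p , q) → A⊑ v p , q) cov≤)
                 (≤-trans (size-split (A ∖ Cov Γ Kt) (HitV F)) (+-mono-≤
                   (≤-trans (size-mono _ (A ∩ HitV F) λ v ((p , _) , q) → p , q) (hitV-few A (λ v → V⊑V₀ w v ∘ A⊑ v) F usable))
                   (≤-trans (size-split (A ∖ Cov Γ Kt ∖ HitV F) B) (+-monoˡ-≤ _
                     (≤-trans (size-mono _ (A ∩ B) λ v (((p , _) , _) , q) → p , q) AB))))) ⟩
          c₁ * u + (f + (f + rest))     ≡⟨ cong (c₁ * u +_) (sym (+-assoc f f rest)) ⟩
          c₁ * u + (f + f + rest)       ≡⟨ sym (+-assoc (c₁ * u) (f + f) rest) ⟩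
          c₁ * u + (f + f) + rest       ≡⟨ cong (λ z → c₁ * u + z + rest) (sym (*-distribʳ-+ u (length F) (length F))) ⟩
          c₁ * u + (length F + length F) * u + rest ≡⟨ cong (_+ rest) (sym (*-distribʳ-+ u c₁ (length F + length F))) ⟩
          (c₁ + (length F + length F)) * u + rest ≤⟨ +-monoˡ-≤ rest (*-monoˡ-≤ u enough) ⟩
          c * u + rest                  ∎)
          where
          open ≤-Reasoning
          f = length F * u
          rest = size (A ∖ Cov Γ Kt ∖ HitV F ∖ B)

        none : Sub n
        none = LSub []

        none-few : ∀ A → size (A ∩ none) ≤ length F * u
        none-few A = ≤-trans (≤-reflexive (size-empty (A ∩ none) λ _ → λ ())) z≤n

      w′ : World a
      w′ = record
        { V = V w ∖ Cov Γ Kt ∖ HitV F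
        ; R = R w ∖ Cov Γ Kt ∖ HitV F
        ; Mw = λ l → Mw w l ∖ Cov Γ Kt ∖ HitV F ∖ HitT l F
        ; V⊑ = λ v ((p , _) , _) → V⊑ w v p
        ; R⊑ = λ v ((p , q) , r) → (R⊑ w v p , q) , r
        ; R⊑S = λ v ((p , _) , _) → R⊑S w v p
        ; Mw⊑V = λ i v (((p , q) , r) , _) → (Mw⊑V w i v p , q) , r
        ; Mw⊑M = λ i v (((p , q) , r) , _) → Mw⊑M w i v p
        ; good = λ ((p , _) , _) → good w p
        ; clean = λ ne (((p , _) , _) , _) → clean w ne p
        ; R-size = ≤-trans (trim (R w) none (R⊑ w) (none-few (R w)) (R-size w)) (size-mono _ _ λ v → proj₁)
        ; Mw-size = λ i → trim (Mw w i) (HitT i F) (Mw⊑V w i) (hitT-few i (Mw w i) (Mw⊑M w i) F usable) (Mw-size w i)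
        }

      w′≼w : w′ ≼ w
      w′≼w = record { V≼ = λ v ((p , _) , _) → p ; M≼ = λ i v (((p , _) , _) , _) → p }

      avoids-F : ∀ {p l} → (p , l) ∈ F → Avoids w′ p l
      avoids-F p∈ = record
        { far-V = λ (_ , ¬h) nr → ¬h (lose p∈ nr)
        ; far-tl = λ ne (_ , ¬h) nr → ¬h (lose p∈ (ne , near-sym Γ nr)) }

      avoids-K : ∀ {p l} → p ∈ Kt → Avoids w′ p l
      avoids-K p∈ = record
        { far-V = λ ((_ , ¬c) , _) → ¬Cov⇒far Γ ¬c p∈
        ; far-tl = λ ne (((m∈ , _) , _) , _) → far-sym Γ (S.R-tl (R⊑S w _ (All.lookup Kt⊑ p∈)) (Mw⊑M w _ _ m∈)) }

    -- The induction shared by spiders and links. Of two items, the earlier avoids the world from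
    -- which the later is taken, so their footprints are far apart wherever the tags differ.
    module Sequence {E : Set} (Item : E → Set₁) (foot : ∀ {e} → Item e → Fin n → Fin N → Set)
                    {a₀} (w₀ : World a₀) (c : ℕ)
                    (op : ∀ e a (w : World (c + a)) → w ≼ w₀ → Σ (Item e) λ it → (∀ {p l} → foot it p l → Inside w p l) ×
                          Σ (World a) λ w′ → w′ ≼ w × (∀ {p l} → foot it p l → Avoids w′ p l)) where

      record Extracted {k} (es : Fin k → E) (a : ℕ) {a₁} (w : World a₁) : Set₁ where
        field
          item   : ∀ i → Item (es i)
          inside : ∀ {i p l} → foot (item i) p l → Inside w p l
          far    : ∀ {i j p q l l′} → i ≢ j → foot (item i) p l → foot (item j) q l′ → l ≢ l′ → Far Γ p q
          final  : World a
          final≼ : final ≼ w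
          avoids : ∀ {i p l} → foot (item i) p l → Avoids final p l

      extract : ∀ k (es : Fin k → E) a (w : World (k * c + a)) → w ≼ w₀ → Extracted es a w
      extract zero    es a w _  = record
        { item = λ () ; inside = λ { {()} } ; far = λ { {()} } ; final = w ; final≼ = ≼-refl ; avoids = λ { {()} } }
      extract (suc k) es a w le with op (es zero) (k * c + a) (resize (+-assoc c (k * c) a) w) (≼-trans (resize≼ (+-assoc c (k * c) a) w) le)
      ... | it , ins , w′ , w′≼ , av = record
        { item = item′ ; inside = λ {i} → inside′ i ; far = λ {i} {j} → far′ i j ; final = Ex.final
        ; final≼ = ≼-trans Ex.final≼ w′≼w ; avoids = λ {i} → avoids′ i }
        where
        w′≼w : w′ ≼ w
        w′≼w = ≼-trans w′≼ (resize≼ (+-assoc c (k * c) a) w)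
        ex : Extracted (es ∘ suc) a w′
        ex = extract k (es ∘ suc) a w′ (≼-trans w′≼w le)
        module Ex = Extracted ex
        item′ : ∀ i → Item (es i)
        item′ zero    = it
        item′ (suc i) = Ex.item i
        inside′ : ∀ i {p l} → foot (item′ i) p l → Inside w p l
        inside′ zero    f = inside-≼ (resize≼ (+-assoc c (k * c) a) w) (ins f)
        inside′ (suc i) f = inside-≼ w′≼w (Ex.inside f)
        far′ : ∀ i j {p q l l′} → i ≢ j → foot (item′ i) p l → foot (item′ j) q l′ → l ≢ l′ → Far Γ p q
        far′ zero    zero    ne f g l≢ = contradiction refl ne
        far′ zero    (suc j) ne f g l≢ = avoids⇒far (av f) (Ex.inside g) l≢
        far′ (suc i) zero    ne f g l≢ = far-sym Γ (avoids⇒far (av g) (Ex.inside f) (l≢ ∘ sym))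
        far′ (suc i) (suc j) ne f g l≢ = Ex.far (ne ∘ cong suc) f g l≢
        avoids′ : ∀ i {p l} → foot (item′ i) p l → Avoids Ex.final p l
        avoids′ zero    f = avoids-≼ Ex.final≼ (av f)
        avoids′ (suc i) f = Ex.avoids f

  -- Branch vertices

  -- Meant for the leaves of a star, which are in contact with its centre or with the tail of the
  -- centre: the kind containing half of them decides which of the two becomes the branch vertex.
  majority : ∀ {X : Set} {R : X → X → Set} {P Q G : X → Set} {h} ℓ → h + h ≤ length ℓ → AllPairs R ℓ → All G ℓ → All (λ x → P x ⊎ Q x) ℓ →
             (∃[ k ] h ≤ length k × AllPairs R k × All G k × All P k) ⊎ (∃[ k ] h ≤ length k × AllPairs R k × All G k × All Q k)
  majority {X} {R} {P} {Q} {G} {h} ℓ hh ap ag apq with split ℓ ap ag apq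
    where
    split : ∀ ℓ → AllPairs R ℓ → All G ℓ → All (λ x → P x ⊎ Q x) ℓ →
            ∃[ k ] ∃[ l ] length ℓ ≡ length k + length l × (∀ {S : X → Set} → All S ℓ → All S k × All S l) ×
            (AllPairs R k × All P k) × (AllPairs R l × All Q l)
    split [] [] [] [] = [] , [] , refl , (λ _ → [] , []) , ([] , []) , ([] , [])
    split (x ∷ ℓ) (a ∷ ap) (g ∷ gs) (pq ∷ pqs) with split ℓ ap gs pqs
    ... | k , l , len , res , (rk , pk) , (rl , ql) with pq
    ...   | inj₁ p = x ∷ k , l , cong suc len , (λ where (s ∷ ss) → s ∷ proj₁ (res ss) , proj₂ (res ss)) , (proj₁ (res a) ∷ rk , p ∷ pk) , (rl , ql)
    ...   | inj₂ q = k , x ∷ l , trans (cong suc len) (sym (+-suc (length k) (length l)))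
                   , (λ where (s ∷ ss) → proj₁ (res ss) , s ∷ proj₂ (res ss)) , (rk , pk) , (proj₂ (res a) ∷ rl , q ∷ ql)
  ... | k , l , len , res , (rk , pk) , (rl , ql) with h ≤? length k
  ...   | yes p = inj₁ (k , p , rk , proj₁ (res ag) , pk)
  ...   | no ¬p = inj₂ (l , +-cancelˡ-≤ h _ _ (≤-trans hh (≤-trans (≤-reflexive len) (+-monoˡ-≤ (length l) (≰⇒≥ ¬p)))) , rl , proj₂ (res ag) , ql)

  allpairs-lookup : ∀ {X : Set} {R : X → X → Set} {xs} → AllPairs R xs → ∀ i j → i ≢ j → R (lookup xs i) (lookup xs j) ⊎ R (lookup xs j) (lookup xs i)
  allpairs-lookup (a ∷ ap) zero    zero    ne = contradiction refl ne
  allpairs-lookup (a ∷ ap) zero    (suc j) ne = inj₁ (All.lookup a (∈-lookup j))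
  allpairs-lookup (a ∷ ap) (suc i) zero    ne = inj₂ (All.lookup a (∈-lookup i))
  allpairs-lookup (a ∷ ap) (suc i) (suc j) ne = allpairs-lookup ap i j (ne ∘ cong suc)

  family : ∀ {X : Set} {R : X → X → Set} {G : X → Set} {h} ℓ → h ≤ length ℓ → AllPairs R ℓ → All G ℓ →
           ∃[ f ] (∀ (j : Fin h) → G (f j)) × (∀ {i j} → i ≢ j → R (f i) (f j) ⊎ R (f j) (f i))
  family ℓ h≤ ap ag = (λ j → lookup ℓ (inject≤ j h≤)) , (λ j → All.lookup ag (∈-lookup (inject≤ j h≤)))
                    , λ ne → allpairs-lookup ap _ _ (ne ∘ inject≤-injective h≤ h≤ _ _)

  module _ {n : ℕ} (Γ : Graph n) {V₀ : Sub n} {d u : ℕ} (Sp : Sparse Γ V₀ d u) where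

    open SparseProps Γ Sp

    module _ (G N L : ℕ) (1≤G : 1 ≤ G) (thin : suc G * (suc G * d) ≤ u) where

      private
        g₀ = Construction.g Γ Sp G N L 1≤G thin
        c₀ = Construction.cost Γ Sp G N L 1≤G thin

      abstract
        -- Vertices near `u` tails of a hub are few by `crowded-few`, members whose tail is near `u`
        -- tails of another hub by `Apart.few`. Each of the two deletions costs at most one unit per
        -- hub.
        clean-world : ∀ (S : State Γ V₀ (Construction.s Γ Sp G N L 1≤G thin) u N) → Construction.Sized Γ Sp G N L 1≤G thin N S → ∀ a →
                      N * c₀ + N + a ≤ L → N * suc g₀ + (N + N) + a ≤ G → World Γ Sp S a
        clean-world S Z a aL aG = record
          { V = S.V ∖ Bad ; R = S.R ∖ Bad ; Mw = λ i → M′ i ∩ S.V ∖ Bad ∖ Ugly i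
          ; V⊑ = λ _ → proj₁ ; R⊑ = λ v (r , b) → S.R⊑ v r , b ; R⊑S = λ _ → proj₁
          ; Mw⊑V = λ i v (((_ , p) , b) , _) → p , b ; Mw⊑M = λ i v (((p , _) , _) , _) → p
          ; good = λ (v∈ , ¬b) i → ≰⇒> λ le → ¬b (i , v∈ , le)
          ; clean = λ {i} {j} i≢j (((m∈ , _) , _) , ¬ug) → ≰⇒> λ le → ¬ug (j , m∈ , i≢j , le)
          ; R-size = +-cancelʳ-≤ (N * c₀ * u + N * u) _ _ (begin
              a * u + (N * c₀ * u + N * u)      ≡⟨ regroup (N * c₀) N ⟩
              (N * c₀ + N + a) * u              ≤⟨ *-monoˡ-≤ u aL ⟩
              L * u                             ≤⟨ Z.R-size ⟩
              size S.R + N * c₀ * u             ≤⟨ +-monoˡ-≤ _ (drop S.R Bad bad-few) ⟩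
              size (S.R ∖ Bad) + N * u + N * c₀ * u ≡⟨ trans (+-assoc (size (S.R ∖ Bad)) _ _) (cong (size (S.R ∖ Bad) +_) (+-comm (N * u) _)) ⟩
              size (S.R ∖ Bad) + (N * c₀ * u + N * u) ∎)
          ; Mw-size = λ i → let A = M′ i ∩ S.V in +-cancelʳ-≤ (N * suc g₀ * u + (N + N) * u) _ _ (begin
              a * u + (N * suc g₀ * u + (N + N) * u) ≡⟨ regroup (N * suc g₀) (N + N) ⟩
              (N * suc g₀ + (N + N) + a) * u    ≤⟨ *-monoˡ-≤ u aG ⟩
              G * u                             ≤⟨ Z.M-size i ⟩
              size A + N * suc g₀ * u           ≤⟨ +-monoˡ-≤ _ (≤-trans (drop A Bad bad-few) (+-monoˡ-≤ _ (drop (A ∖ Bad) (Ugly i) (ugly-few i)))) ⟩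
              size (A ∖ Bad ∖ Ugly i) + N * u + N * u + N * suc g₀ * u ≡⟨ cong (_+ N * suc g₀ * u) (trans (+-assoc (size (A ∖ Bad ∖ Ugly i)) _ _) (cong (size (A ∖ Bad ∖ Ugly i) +_) (sym (*-distribʳ-+ u N N)))) ⟩
              size (A ∖ Bad ∖ Ugly i) + (N + N) * u + N * suc g₀ * u ≡⟨ trans (+-assoc (size (A ∖ Bad ∖ Ugly i)) _ _) (cong (size (A ∖ Bad ∖ Ugly i) +_) (+-comm ((N + N) * u) _)) ⟩
              size (A ∖ Bad ∖ Ugly i) + (N * suc g₀ * u + (N + N) * u) ∎)
          }
          where
          open ≤-Reasoning
          module S = State S
          module Z = Construction.Sized Z
          M′ : Fin N → Sub n
          M′ i = Hub.M (S.hub i)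
          tl′ : Fin N → Fin n → Fin n
          tl′ i = Hub.tl (S.hub i)
          Bad₁ : Fin N → Sub n
          Bad₁ j = sub λ v → mem? S.V v ×-dec (u ≤? size (tails-at Γ (S.hub j) v))
          Ugly₁ : Fin N → Fin N → Sub n
          Ugly₁ i j = sub λ m → mem? (M′ i) m ×-dec (¬? (i ≟ j) ×-dec (u ≤? size (tails-at Γ (S.hub j) (tl′ i m))))
          Bad : Sub n
          Bad = sub λ v → any? λ j → mem? (Bad₁ j) v
          Ugly : Fin N → Sub n
          Ugly i = sub λ v → any? λ j → mem? (Ugly₁ i j) v
          bad-few : size Bad ≤ N * u
          bad-few = size-⋃ Bad₁ λ j → ≤-trans
            (size-mono (Bad₁ j) (sub λ c → mem? S.V c ×-dec (Construction.t Γ Sp G N L 1≤G thin ≤? size (tails-at Γ (S.hub j) c)))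
              λ v (v∈ , le) → v∈ , ≤-trans (Construction.t≤u Γ Sp G N L 1≤G thin) le)
            (Construction.crowded-few Γ Sp G N L 1≤G thin (S.hub j) S.V S.V⊑)
          ugly-few : ∀ i → size (Ugly i) ≤ N * u
          ugly-few i = size-⋃ (Ugly₁ i) λ j → case i ≟ j of λ where
            (yes e) → ≤-trans (≤-reflexive (size-empty (Ugly₁ i j) λ _ (_ , ne , _) → ne e)) z≤n
            (no ne) → ≤-trans (size-mono (Ugly₁ i j) (sub λ m → mem? (M′ i) m ×-dec (u ≤? size (tails-at Γ (S.hub j) (tl′ i m))))
                         λ _ (p , _ , q) → p , q) (Apart.few (S.apart ne))
          drop : ∀ (A B : Sub n) → size B ≤ N * u → size A ≤ size (A ∖ B) + N * u
          drop A B f = ≤-trans (size-split A B) (≤-trans (≤-reflexive (+-comm (size (A ∩ B)) _))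
            (+-monoʳ-≤ (size (A ∖ B)) (≤-trans (size-mono (A ∩ B) B λ _ → proj₂) f)))
          regroup : ∀ x y → a * u + (x * u + y * u) ≡ (x + y + a) * u
          regroup x y = trans (+-comm (a * u) _) (trans (cong (_+ a * u) (sym (*-distribʳ-+ u x y))) (sym (*-distribʳ-+ u (x + y) a)))

    module _ {s N : ℕ} (S : State Γ V₀ s u N) where

      private
        module S = State S
        W = World Γ Sp S
        module Hb i = Hub (S.hub i)

      -- `cls x` reserves `P` hubs for the branch vertex `x`. Among `2 ^ (h + h)` of them there is a
      -- star with `h + h` leaves, of which `majority` keeps `h`, one for each possible partner.
      module StarOp {h P p : ℕ} (cls : Fin h → Fin P → Fin N) (cls-inj : ∀ {x x′ k k′} → cls x k ≡ cls x′ k′ → x ≡ x′ × k ≡ k′)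
                    (P≡ : P ≡ suc p) (P≡2^ : P ≡ 2 ^ (h + h)) where

        record Spider (x : Fin h) : Set₁ where
          field
            b      : Fin n
            rk     : Fin P
            lk     : Fin h → Fin P
            leaf   : Fin h → Fin n
            leaf∈  : ∀ j → Hb.M (cls x (lk j)) ∋ leaf j
            leaf∈V : ∀ j → S.V ∋ leaf j
            touch  : ∀ j → Adj Γ b (leaf j) ⊎ Adj Γ b (Hb.tl (cls x (lk j)) (leaf j))
            lk-inj : ∀ {j j′} → j ≢ j′ → lk j ≢ lk j′
            lk≢rk  : ∀ j → lk j ≢ rk
            sep    : ∀ {j j′ q q′} → j ≢ j′ → IsTail Γ Sp S (cls x (lk j)) (leaf j) q → IsTail Γ Sp S (cls x (lk j′)) (leaf j′) q′ → Far Γ q q′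
            tail≢b : ∀ {j q} → IsTail Γ Sp S (cls x (lk j)) (leaf j) q → q ≢ b
            -- If `b` is a tail it touches its own hub, whence the exception; `lk≢rk` prevents that
            -- hub from serving as an arm.
            b-K    : ∀ {l y} → l ≢ cls x rk → y ∈ Hb.K l → Far Γ y b

        foot : ∀ {x} → Spider x → Fin n → Fin N → Set
        foot {x} sp q l = (q ≡ Spider.b sp × l ≡ cls x (Spider.rk sp)) ⊎
          (∃[ j ] l ≡ cls x (Spider.lk sp j) × IsTail Γ Sp S l (Spider.leaf sp j) q)

        star-cost : ℕ
        -- `σ p` units are what the star game requires; the rest is two units each for the branch
        -- vertex, the `h` leaves and their `h` tails.
        star-cost = σ p + (suc (h + h) + suc (h + h))

        module _ (x : Fin h) {a} (w : W (star-cost + a)) where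
          private
            module w = World w

            Mx : Fin P → Sub n
            Mx k = w.Mw (cls x k)

            tlx : Fin P → Fin n → Fin n
            tlx k = Hb.tl (cls x k)

            -- A leg may use a leaf as well as its tail, so contact compares all four combinations;
            -- each contributes one unit to `sparse`.
            C : Fin P → Fin n → Fin P → Fin n → Set
            C k y l m = (Near Γ y m ⊎ Near Γ (tlx k y) m) ⊎ (Near Γ y (tlx l m) ⊎ Near Γ (tlx k y) (tlx l m))

            C? : ∀ k y l m → Dec (C k y l m)
            C? k y l m = (near? Γ y m ⊎-dec near? Γ (tlx k y) m) ⊎-dec (near? Γ y (tlx l m) ⊎-dec near? Γ (tlx k y) (tlx l m))

            Mx⊑V₀ : ∀ k → Mx k ⊑ V₀
            Mx⊑V₀ k v = w.V⊑V₀ v ∘ w.Mw⊑V (cls x k) v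

            tl∈V₀ : ∀ {k y} → Mx k ∋ y → V₀ ∋ tlx k y
            tl∈V₀ {k} y∈ = Hb.tl∈ (cls x k) (w.Mw⊑M (cls x k) _ y∈)

            cls≢ : ∀ {k l} → k ≢ l → cls x k ≢ cls x l
            cls≢ ne e = ne (proj₂ (cls-inj e))

            abstract
              sparse : ∀ {k l y} → k ≢ l → Mx k ∋ y → size (sub λ m → mem? (Mx l) m ×-dec C? k y l m) ≤ 4 * u
              sparse {k} {l} {y} ne y∈ = begin
                size (sub λ m → mem? (Mx l) m ×-dec C? k y l m)
                  ≤⟨ size-cover (sub λ m → mem? (Mx l) m ×-dec C? k y l m) AB CD
                       (λ where m (t , inj₁ c) → inj₁ (t , c) ; m (t , inj₂ c) → inj₂ (t , c)) ⟩
                size AB + size CD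
                  ≤⟨ +-mono-≤ (size-cover AB (D₁ y) (D₁ (tlx k y)) (λ where m (t , inj₁ c) → inj₁ (Mx⊑V₀ l m t , c) ; m (t , inj₂ c) → inj₂ (Mx⊑V₀ l m t , c)))
                              (size-cover CD (D₂ y) (D₂ (tlx k y)) (λ where m (t , inj₁ c) → inj₁ (w.Mw⊑M _ m t , near-sym Γ c)
                                                                            m (t , inj₂ c) → inj₂ (w.Mw⊑M _ m t , near-sym Γ c))) ⟩
                size (D₁ y) + size (D₁ (tlx k y)) + (size (D₂ y) + size (D₂ (tlx k y)))
                  ≤⟨ +-mono-≤ (+-mono-≤ (≤-trans (deg y (Mx⊑V₀ k y y∈)) d≤u) (≤-trans (deg (tlx k y) (tl∈V₀ y∈)) d≤u))
                              (+-mono-≤ (<⇒≤ (w.good (w.Mw⊑V (cls x k) y y∈) (cls x l))) (<⇒≤ (w.clean (cls≢ ne) y∈))) ⟩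
                u + u + (u + u)       ≡⟨ trans (+-assoc u u (u + u)) (cong (λ z → u + (u + (u + z))) (sym (+-identityʳ u))) ⟩
                4 * u                 ∎
                where
                open ≤-Reasoning
                AB CD : Sub n
                AB = sub λ m → mem? (Mx l) m ×-dec (near? Γ y m ⊎-dec near? Γ (tlx k y) m)
                CD = sub λ m → mem? (Mx l) m ×-dec (near? Γ y (tlx l m) ⊎-dec near? Γ (tlx k y) (tlx l m))
                D₁ D₂ : Fin n → Sub n
                D₁ v = sub λ m → mem? V₀ m ×-dec near? Γ v m
                D₂ v = tails-at Γ (S.hub (cls x l)) v

              coherent : ∀ {k l} → k ≢ l → ∀ A B → A ⊑ Mx k → B ⊑ Mx l → u ≤ size A → u ≤ size B → ∃[ a ] ∃[ b ] A ∋ a × B ∋ b × C k a l b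
              coherent {k} {l} ne A B A⊑ B⊑ uA uB with coh A B (λ v → Mx⊑V₀ k v ∘ A⊑ v) (λ v → Mx⊑V₀ l v ∘ B⊑ v) uA uB
              ... | a , b , a∈ , b∈ , nr = a , b , a∈ , b∈ , inj₁ (inj₁ nr)

            abstract
              found : Star Mx C (h + h)
              found = star-exists Mx C C? u 1≤u sparse coherent (h + h) p P≡ P≡2^ λ k →
                ≤-trans (*-monoˡ-≤ u (≤-trans (m≤m+n (σ p) _) (m≤m+n star-cost a))) (w.Mw-size (cls x k))

            Sp′ : Fin P × Fin n → Fin P × Fin n → Set
            Sp′ = Sep Mx C

            record Centre (b : Fin n) (rk : Fin P) : Set where
              field
                ent   : Fin h → Fin P × Fin n
                leafs : ∀ j → (Mx (proj₁ (ent j)) ∋ proj₂ (ent j) × proj₁ (ent j) ≢ rk) ×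
                              (Near Γ (proj₂ (ent j)) b ⊎ Near Γ (tlx (proj₁ (ent j)) (proj₂ (ent j))) b)
                pairs : ∀ {i j} → i ≢ j → Sp′ (ent i) (ent j) ⊎ Sp′ (ent j) (ent i)
                z     : Fin n
                z∈    : Mx rk ∋ z
                b≡    : b ≡ z ⊎ b ≡ tlx rk z

            abstract
              centre : ∃[ b ] ∃[ rk ] Centre b rk
              centre with found
              ... | i , z , z∈ , ℓ , len , pairs , good with majority ℓ len pairs (All.map (λ (t , ne , _) → t , ne) good) (All.map (λ (_ , _ , c) → c) good)
              ...   | inj₁ (k , h≤ , ap , ag , anear) = let (f , g , r) = family k h≤ ap (All.zip (ag , anear)) in
                        z , i , record { ent = f ; leafs = g ; pairs = r ; z∈ = z∈ ; b≡ = inj₁ refl }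
              ...   | inj₂ (k , h≤ , ap , ag , anear) = let (f , g , r) = family k h≤ ap (All.zip (ag , anear)) in
                        tlx i z , i , record { ent = f ; leafs = g ; pairs = r ; z∈ = z∈ ; b≡ = inj₂ refl }

            b₀ : Fin n
            b₀ = proj₁ centre

            r₀ : Fin P
            r₀ = proj₁ (proj₂ centre)

            module Ce = Centre (proj₂ (proj₂ centre))

            lk : Fin h → Fin P
            lk j = proj₁ (Ce.ent j)

            leaf : Fin h → Fin n
            leaf j = proj₂ (Ce.ent j)

            leafT : ∀ j → Mx (lk j) ∋ leaf j × lk j ≢ r₀
            leafT j = proj₁ (Ce.leafs j)

            leafM : ∀ j → Hb.M (cls x (lk j)) ∋ leaf j
            leafM j = w.Mw⊑M _ _ (proj₁ (leafT j))

            leafV : ∀ j → S.V ∋ leaf j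
            leafV j = w.V⊑ _ (w.Mw⊑V _ _ (proj₁ (leafT j)))

            zM = w.Mw⊑M _ _ Ce.z∈
            zV = w.V⊑ _ (w.Mw⊑V _ _ Ce.z∈)

            ap : ∀ j → Apart Γ u (S.hub (cls x (lk j))) (S.hub (cls x r₀))
            ap j = S.apart (cls≢ (proj₂ (leafT j)))

            abstract
              leaf≢b : ∀ j → leaf j ≢ b₀
              leaf≢b j e = [ (λ bz → Apart.M#M (ap j) (leafM j) (subst (Hb.M (cls x r₀) ∋_) (trans (sym bz) (sym e)) zM))
                           , (λ bt → S.V-tl (leafV j) zM (trans e bt)) ]′ Ce.b≡

              tl≢b : ∀ j → tlx (lk j) (leaf j) ≢ b₀
              tl≢b j e = [ (λ bz → S.V-tl zV (leafM j) (trans (sym bz) (sym e)))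
                         , (λ bt → Apart.tl≢tl (ap j) (leafM j) zM (trans e bt)) ]′ Ce.b≡

              touch₀ : ∀ j → Adj Γ b₀ (leaf j) ⊎ Adj Γ b₀ (tlx (lk j) (leaf j))
              touch₀ j = [ (λ nr → inj₁ (near⇒adj Γ (near-sym Γ nr) (leaf≢b j ∘ sym)))
                         , (λ nr → inj₂ (near⇒adj Γ (near-sym Γ nr) (tl≢b j ∘ sym))) ]′ (proj₂ (Ce.leafs j))

            sep₁ : ∀ {k y l z q q′} → Sp′ (k , y) (l , z) → IsTail Γ Sp S (cls x k) y q → IsTail Γ Sp S (cls x l) z q′ → Far Γ q′ q
            sep₁ (_ , ¬c) (inj₁ refl) (inj₁ refl) nr = ¬c (inj₁ (inj₁ nr))
            sep₁ (_ , ¬c) (inj₁ refl) (inj₂ refl) nr = ¬c (inj₁ (inj₂ nr))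
            sep₁ (_ , ¬c) (inj₂ refl) (inj₁ refl) nr = ¬c (inj₂ (inj₁ nr))
            sep₁ (_ , ¬c) (inj₂ refl) (inj₂ refl) nr = ¬c (inj₂ (inj₂ nr))

            b-inside : Inside Γ Sp S w b₀ (cls x r₀)
            b-inside = [ (λ e → inj₁ (subst (w.V ∋_) (sym e) (w.Mw⊑V _ _ Ce.z∈))) , (λ e → inj₂ (Ce.z , Ce.z∈ , e)) ]′ Ce.b≡

          spider : Spider x
          spider = record
            { b = b₀ ; rk = r₀ ; lk = lk ; leaf = leaf ; leaf∈ = leafM ; leaf∈V = leafV ; touch = touch₀
            ; lk-inj = λ ne e → [ (λ sp → proj₁ sp (sym e)) , (λ sp → proj₁ sp e) ]′ (Ce.pairs ne)
            ; lk≢rk = λ j → proj₂ (leafT j)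
            ; sep = λ ne tq tq′ → [ (λ sp → far-sym Γ (sep₁ sp tq tq′)) , (λ sp → sep₁ sp tq′ tq) ]′ (Ce.pairs ne)
            ; tail≢b = λ where (inj₁ refl) → leaf≢b _ ; (inj₂ refl) → tl≢b _
            ; b-K = bK Ce.b≡
            }
            where
            bK : b₀ ≡ Ce.z ⊎ b₀ ≡ tlx r₀ Ce.z → ∀ {l y} → l ≢ cls x r₀ → y ∈ Hb.K l → Far Γ y b₀
            bK (inj₁ e) {y = y} ne y∈ = subst (Far Γ y) (sym e) (S.V-K zV y∈)
            bK (inj₂ e) {y = y} ne y∈ = subst (Far Γ y) (sym e) (Apart.K-tl (S.apart ne) y∈ zM)

          spider-inside : ∀ {q l} → foot spider q l → Inside Γ Sp S w q l
          spider-inside (inj₁ (refl , refl))           = b-inside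
          spider-inside (inj₂ (j , refl , inj₁ refl)) = inj₁ (w.Mw⊑V _ _ (proj₁ (leafT j)))
          spider-inside (inj₂ (j , refl , inj₂ e))    = inj₂ (leaf j , proj₁ (leafT j) , e)

          private
            F : List (Fin n × Fin N)
            F = (b₀ , cls x r₀) ∷ tabulate (λ j → leaf j , cls x (lk j)) ++ tabulate (λ j → tlx (lk j) (leaf j) , cls x (lk j))

            F-length : length F ≡ suc (h + h)
            F-length = cong suc (trans (length-++ (tabulate (λ j → leaf j , cls x (lk j))))
              (cong₂ _+_ (length-tabulate (λ j → leaf j , cls x (lk j))) (length-tabulate (λ j → tlx (lk j) (leaf j) , cls x (lk j)))))

            F-usable : All (Usable Γ Sp S) F
            F-usable = use (inj₁ (refl , refl)) ∷ All.++⁺ (All.tabulate⁺ λ j → use (inj₂ (j , refl , inj₁ refl))) (All.tabulate⁺ λ j → use (inj₂ (j , refl , inj₂ refl)))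
              where
              use : ∀ {q l} → foot spider q l → Usable Γ Sp S (q , l)
              use f = inside⇒usable Γ Sp S w (spider-inside f)

            F⊇ : ∀ {q l} → foot spider q l → (q , l) ∈ F
            F⊇ (inj₁ (refl , refl))           = here refl
            F⊇ (inj₂ (j , refl , inj₁ refl)) = there (∈-++⁺ˡ (∈-tabulate⁺ {f = λ j → leaf j , cls x (lk j)} j))
            F⊇ (inj₂ (j , refl , inj₂ refl)) = there (∈-++⁺ʳ (tabulate (λ j → leaf j , cls x (lk j))) (∈-tabulate⁺ {f = λ j → tlx (lk j) (leaf j) , cls x (lk j)} j))

            module Sh = Shrink Γ Sp S star-cost w F F-usable [] [] 0
              (≤-reflexive (size-empty (w.V ∩ Cov Γ []) λ _ → λ ()))
              (≤-trans (≤-reflexive (cong₂ _+_ F-length F-length)) (m≤n+m _ (σ p)))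

          after-spider : Σ (W a) λ w′ → _≼_ Γ Sp S w′ w × (∀ {q l} → foot spider q l → Avoids Γ Sp S w′ q l)
          after-spider = Sh.w′ , Sh.w′≼w , λ f → Sh.avoids-F (F⊇ f)

        abstract
          star-op : ∀ x a (w : W (star-cost + a)) → Σ (Spider x) λ sp → (∀ {q l} → foot sp q l → Inside Γ Sp S w q l) ×
                    Σ (W a) λ w′ → _≼_ Γ Sp S w′ w × (∀ {q l} → foot sp q l → Avoids Γ Sp S w′ q l)
          star-op x a w = spider x w , spider-inside x w , after-spider x w

  -- Links between branch vertices

  module _ {n : ℕ} (Γ : Graph n) {V₀ : Sub n} {d u : ℕ} (Sp : Sparse Γ V₀ d u) {s N : ℕ} (S : State Γ V₀ s u N) where

    open SparseProps Γ Sp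

    private
      module S = State S
      W : ℕ → Set₁
      W = World Γ Sp S
      module Hb i = Hub (S.hub i)
      _≤ʷ_ : ∀ {a b} → W a → W b → Set
      _≤ʷ_ = _≼_ Γ Sp S

    module Linking {h P p : ℕ} (cls : Fin h → Fin P → Fin N) (cls-inj : ∀ {x x′ k k′} → cls x k ≡ cls x′ k′ → x ≡ x′ × k ≡ k′)
                   (P≡ : P ≡ suc p) (P≡2^ : P ≡ 2 ^ (h + h))
                   (sp : ∀ x → StarOp.Spider Γ Sp S cls cls-inj P≡ P≡2^ x)
                   (cross : ∀ {x x′ q q′ l l′} → x ≢ x′ → StarOp.foot Γ Sp S cls cls-inj P≡ P≡2^ (sp x) q l →
                            StarOp.foot Γ Sp S cls cls-inj P≡ P≡2^ (sp x′) q′ l′ → l ≢ l′ → Far Γ q q′)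
                   {a₀} (w₀ : World Γ Sp S a₀)
                   (avoid : ∀ {x q l} → StarOp.foot Γ Sp S cls cls-inj P≡ P≡2^ (sp x) q l → Avoids Γ Sp S w₀ q l) where

      module Spi x = StarOp.Spider (sp x)

      centre-class : Fin h → Fin N
      centre-class x = cls x (Spi.rk x)

      arm : Fin h → Fin h → Fin N
      arm x y = cls x (Spi.lk x y)

      arm≢arm : ∀ {x y x′ y′} → x ≢ x′ ⊎ y ≢ y′ → arm x y ≢ arm x′ y′
      arm≢arm (inj₁ ne) e = ne (proj₁ (cls-inj e))
      arm≢arm {x} {y} {x′} {y′} (inj₂ ne) e with cls-inj e
      ... | refl , ek = Spi.lk-inj x ne ek

      arm≢root : ∀ {x y x′} → arm x y ≢ centre-class x′
      arm≢root {x} {y} e with cls-inj e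
      ... | refl , ek = Spi.lk≢rk x y ek

      Side : Fin h → Fin h → Fin n → Set
      Side x y v = v ≡ Spi.b x ⊎ IsTail Γ Sp S (arm x y) (Spi.leaf x y) v ⊎ v ∈ Hb.K (arm x y)

      abstract
        side-V : ∀ {a} {w : W a} → w ≤ʷ w₀ → ∀ {x y q v} → Side x y q → World.V w ∋ v → Far Γ q v
        side-V le (inj₁ e) v∈ = Avoids.far-V (avoid (inj₁ (e , refl))) (_≼_.V≼ le _ v∈)
        side-V le {y = y} (inj₂ (inj₁ t)) v∈ = Avoids.far-V (avoid (inj₂ (y , refl , t))) (_≼_.V≼ le _ v∈)
        side-V {w = w} le (inj₂ (inj₂ k)) v∈ = S.V-K (World.V⊑ w _ v∈) k

        side-tl : ∀ {a} {w : W a} → w ≤ʷ w₀ → ∀ {x y q l m} → l ≢ centre-class x → l ≢ arm x y → Side x y q → World.Mw w l ∋ m → Far Γ q (Hb.tl l m)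
        side-tl le ne₁ ne₂ (inj₁ e) m∈ = Avoids.far-tl (avoid (inj₁ (e , refl))) (ne₁ ∘ sym) (_≼_.M≼ le _ _ m∈)
        side-tl le {y = y} ne₁ ne₂ (inj₂ (inj₁ t)) m∈ = Avoids.far-tl (avoid (inj₂ (y , refl , t))) (ne₂ ∘ sym) (_≼_.M≼ le _ _ m∈)
        side-tl {w = w} le ne₁ ne₂ (inj₂ (inj₂ k)) m∈ = Apart.K-tl (S.apart (ne₂ ∘ sym)) k (World.Mw⊑M w _ _ m∈)

        K-tail : ∀ {l y j q v} → l ≢ arm y j → v ∈ Hb.K l → IsTail Γ Sp S (arm y j) (Spi.leaf y j) q → Far Γ v q
        K-tail {y = y} {j} ne v∈ (inj₁ refl) = S.V-K (Spi.leaf∈V y j) v∈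
        K-tail {y = y} {j} ne v∈ (inj₂ refl) = Apart.K-tl (S.apart ne) v∈ (Spi.leaf∈ y j)

        tail-tail : ∀ {x y x′ y′ q q′} → x ≢ x′ ⊎ y ≢ y′ → IsTail Γ Sp S (arm x y) (Spi.leaf x y) q →
                    IsTail Γ Sp S (arm x′ y′) (Spi.leaf x′ y′) q′ → Far Γ q q′
        tail-tail {x} {y} {x′} {y′} ne t t′ with x ≟ x′
        ... | no x≢ = cross x≢ (inj₂ (y , refl , t)) (inj₂ (y′ , refl , t′)) (arm≢arm (inj₁ x≢))
        ... | yes refl = Spi.sep x ([ (λ f → contradiction refl f) , id ]′ ne) t t′

        b-tail : ∀ {x x′ y′ q} → x ≢ x′ → IsTail Γ Sp S (arm x′ y′) (Spi.leaf x′ y′) q → Far Γ (Spi.b x) q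
        b-tail {y′ = y′} ne t = cross ne (inj₁ (refl , refl)) (inj₂ (y′ , refl , t)) (arm≢root ∘ sym)

        b-b : ∀ {x x′} → x ≢ x′ → Far Γ (Spi.b x) (Spi.b x′)
        b-b ne = cross ne (inj₁ (refl , refl)) (inj₁ (refl , refl)) λ e → ne (proj₁ (cls-inj e))

        K-b : ∀ {x y x′ v} → v ∈ Hb.K (arm x y) → Far Γ v (Spi.b x′)
        K-b {x′ = x′} = Spi.b-K x′ arm≢root

        side-side : ∀ {x y x′ y′ q q′} → x ≢ x′ → Side x y q → Side x′ y′ q′ → Far Γ q q′
        side-side ne (inj₁ refl)     (inj₁ refl)      = b-b ne
        side-side {x} {y} {x′} {y′} ne (inj₁ refl)     (inj₂ (inj₁ t))  = b-tail {y′ = y′} ne t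
        side-side {x} {y} {x′} {y′} ne (inj₁ refl)     (inj₂ (inj₂ k))  = far-sym Γ (K-b {x′} {y′} k)
        side-side {x} {y} {x′} {y′} ne (inj₂ (inj₁ t)) (inj₁ refl)      = far-sym Γ (b-tail {y′ = y} (ne ∘ sym) t)
        side-side {x} {y} {x′} {y′} ne (inj₂ (inj₁ t)) (inj₂ (inj₁ t′)) = tail-tail {x} {y} {x′} {y′} (inj₁ ne) t t′
        side-side {x} {y} {x′} {y′} ne (inj₂ (inj₁ t)) (inj₂ (inj₂ k))  = far-sym Γ (K-tail {y = x} {y} (arm≢arm (inj₁ (ne ∘ sym))) k t)
        side-side {x} {y} ne (inj₂ (inj₂ k)) (inj₁ refl)      = K-b {x} {y} k
        side-side {x} {y} {x′} {y′} ne (inj₂ (inj₂ k)) (inj₂ (inj₁ t))  = K-tail {y = x′} {y′} (arm≢arm (inj₁ ne)) k t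
        side-side ne (inj₂ (inj₂ k)) (inj₂ (inj₂ k′)) = Apart.K-K (S.apart (arm≢arm (inj₁ ne))) k k′

        -- By `touch`, `b` is adjacent to the leaf or to its tail; either way it is reached from the
        -- tail, hence from all of the connected set.
        side-reach : ∀ {x y U} → (∀ {v} → Side x y v → U v) → ∀ {k} → k ∈ Hb.K (arm x y) → Reach Γ (Spi.b x) U k
        side-reach {x} {y} {U} ⊆U {k} k∈ = climb (find (Hb.tl-K i ℓ∈))
          where
          i : Fin N
          i = arm x y
          ℓ : Fin n
          ℓ = Spi.leaf x y
          ℓ∈ : Hb.M i ∋ ℓ
          ℓ∈ = Spi.leaf∈ x y
          tail-reach : Reach Γ (Spi.b x) U (Hb.tl i ℓ)
          tail-reach = [ (λ a → reach-step Γ (Hb.tl-m i ℓ∈) (⊆U (inj₂ (inj₁ (inj₁ refl)))) (reach-step Γ (Graph.adj-sym Γ a) (⊆U (inj₁ refl)) (reach-self Γ)))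
                       , (λ a → reach-step Γ (Graph.adj-sym Γ a) (⊆U (inj₁ refl)) (reach-self Γ)) ]′ (Spi.touch x y)
          climb : ∃[ z ] z ∈ Hb.K i × Adj Γ z (Hb.tl i ℓ) → Reach Γ (Spi.b x) U k
          climb (z , z∈ , a) = reach-conn Γ (Hb.conn i) (All.tabulate (⊆U ∘ inj₂ ∘ inj₂)) z∈ k∈
            (reach-step Γ a (⊆U (inj₂ (inj₁ (inj₂ refl)))) tail-reach)

      Body : Fin h → Fin h → (Fin n → Fin N → Set) → Fin n → Set
      Body x y foot q = (IsTail Γ Sp S (arm x y) (Spi.leaf x y) q ⊎ q ∈ Hb.K (arm x y)) ⊎
                        (IsTail Γ Sp S (arm y x) (Spi.leaf y x) q ⊎ q ∈ Hb.K (arm y x)) ⊎ (∃[ l ] foot q l)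

      -- All ordered pairs receive a link, which keeps the indexing uniform; as a path is demanded
      -- only for `x < y`, the diagonal can have an empty one.
      record Link (xy : Fin h × Fin h) : Set₁ where
        private
          x = proj₁ xy
          y = proj₂ xy
        field
          foot : Fin n → Fin N → Set
          tags : ∀ {q l} → foot q l → l ≡ arm x y ⊎ l ≡ arm y x
          path : x Fin.< y → OddFuzzy Γ (Spi.b x) (Spi.b y) (Body x y foot)

      link-cost : ℕ
      -- Three units for the neighbourhood of `Kt` and two for each of the six entries of `F`; this
      -- also covers the fourteen units from which `X` is made.
      link-cost = 15

      module Make (x y : Fin h) (x≢y : x ≢ y) {a} (w : W (link-cost + a)) (le : w ≤ʷ w₀) where
        private
          module w = World w

          i j : Fin N
          i = arm x y
          j = arm y x

          i≢j : i ≢ j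
          i≢j = arm≢arm (inj₁ x≢y)

          units : ∀ {k} → k ≤ 15 → k * u ≤ (link-cost + a) * u
          units le′ = *-monoˡ-≤ u (≤-trans le′ (m≤m+n 15 a))

          R⊑V₀ : w.R ⊑ V₀
          R⊑V₀ v = w.V⊑V₀ v ∘ w.R⊑ v

          -- The neighbourhoods of the hubs are gone from `V`, so hub `j` is prolonged through a
          -- member `t₀` into a component of `R`, where a connected set with a live neighbourhood
          -- can be grown.
          record Exit : Set where
            field
              t₀   : Fin n
              t₀∈  : w.Mw j ∋ t₀
              z    : Fin n
              z~t₀ : Adj Γ z t₀
              comp : BigComponent w.R z

          abstract
            exit : Exit
            exit = pick (size-∃ (w.Mw j ∩ Cv) (+-cancelʳ-≤ u _ _ (begin
                  1 + u                             ≤⟨ +-monoˡ-≤ u 1≤u ⟩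
                  u + u                             ≡⟨ cong (u +_) (sym (+-identityʳ u)) ⟩
                  2 * u                             ≤⟨ ≤-trans (units (s≤s (s≤s z≤n))) (w.Mw-size j) ⟩
                  size (w.Mw j)                     ≤⟨ size-split (w.Mw j) Cv ⟩
                  size (w.Mw j ∩ Cv) + size (w.Mw j ∖ Cv) ≤⟨ +-monoʳ-≤ _ (<⇒≤ (uncovered Rl (w.Mw j) (All.tabulate (R⊑V₀ _ ∘ proj₁ ∘ toList⁻ Rb))
                                                         (λ v → w.V⊑V₀ v ∘ w.Mw⊑V j v) (≤-trans Rb-big (size-mono Rb (LSub Rl) λ v → toList⁺ Rb)))) ⟩
                  size (w.Mw j ∩ Cv) + u            ∎)))
              where
              open ≤-Reasoning
              comps : ∃[ Q ] size Q < u × (∀ v → w.R ∋ v → Q ∋ v ⊎ BigComponent w.R v)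
              comps = big-components w.R R⊑V₀ (≤-trans (units (s≤s (s≤s (s≤s z≤n)))) w.R-size)
              Q : Sub n
              Q = proj₁ comps
              Q<u : size Q < u
              Q<u = proj₁ (proj₂ comps)
              Rb : Sub n
              Rb = w.R ∖ Q
              Rl : List (Fin n)
              Rl = toList Rb
              Cv : Sub n
              Cv = Cov Γ Rl
              Rb-big : u ≤ size Rb
              Rb-big = +-cancelˡ-≤ u _ _ (begin
                u + u                     ≡⟨ cong (u +_) (sym (+-identityʳ u)) ⟩
                2 * u                     ≤⟨ ≤-trans (units (s≤s (s≤s z≤n))) w.R-size ⟩
                size w.R                  ≤⟨ size-split w.R Q ⟩
                size (w.R ∩ Q) + size Rb  ≤⟨ +-monoˡ-≤ _ (≤-trans (size-mono (w.R ∩ Q) Q λ _ → proj₂) (<⇒≤ Q<u)) ⟩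
                u + size Rb               ∎)
              pick : ∃[ t ] (w.Mw j ∩ Cv) ∋ t → Exit
              pick (t , t∈ , c) = record
                { t₀∈ = t∈
                ; z~t₀ = near⇒adj Γ (proj₂ (proj₂ (find c))) λ e → S.R-M (w.R⊑S z (proj₁ zR)) (subst (Hb.M j ∋_) (sym e) (w.Mw⊑M j t t∈))
                ; comp = [ (λ q → contradiction q (proj₂ zR)) , id ]′ (proj₂ (proj₂ comps) z (proj₁ zR)) }
                where
                z : Fin n
                z = proj₁ (find c)
                zR : Rb ∋ z
                zR = toList⁻ Rb (proj₁ (proj₂ (find c)))

          module Ex = Exit exit

          t₀ tt₀ : Fin n
          t₀ = Ex.t₀
          tt₀ = Hb.tl j t₀

          t₀∈V : w.V ∋ t₀
          t₀∈V = w.Mw⊑V j t₀ Ex.t₀∈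

          t₀∈M : Hb.M j ∋ t₀
          t₀∈M = w.Mw⊑M j t₀ Ex.t₀∈

          -- Two units, since one may lie in `Kt` itself; the other provides `u` outer neighbours,
          -- which cover almost everything.
          grown : Grown w.R w.V Ex.z 2
          grown = grow 2 R⊑V₀ w.V⊑V₀ (s≤s z≤n) (≤-trans (units (s≤s (s≤s (s≤s z≤n)))) (≤-trans w.R-size (size-mono w.R w.V w.R⊑))) Ex.comp

          module Gr = Grown grown

          Kt : List (Fin n)
          Kt = Gr.verts

          cov3 : size (w.V ∩ Cov Γ Kt) ≤ 3 * u
          cov3 = ≤-trans Gr.upper (≤-trans (+-monoʳ-≤ (2 * u) d≤u) (≤-reflexive (+-comm (2 * u) u)))

          Wt : Sub n
          Wt = w.V ∩ Cov Γ Kt ∖ LSub Kt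

          Wl : List (Fin n)
          Wl = toList Wt

          Wt-big : u ≤ size (LSub Wl)
          Wt-big = ≤-trans (+-cancelʳ-≤ u _ _ (begin
              u + u                   ≡⟨ cong (u +_) (sym (+-identityʳ u)) ⟩
              2 * u                   ≤⟨ Gr.lower ⟩
              size (w.V ∩ Cov Γ Kt)   ≤⟨ size-cover (w.V ∩ Cov Γ Kt) Wt (LSub Kt) (λ v p → case mem? (LSub Kt) v of λ where
                                           (yes q) → inj₂ q
                                           (no ¬q) → inj₁ (p , ¬q)) ⟩
              size Wt + size (LSub Kt) ≤⟨ +-monoʳ-≤ _ Gr.small ⟩
              size Wt + u             ∎))
            (size-mono Wt (LSub Wl) λ v → toList⁺ Wt)
            where open ≤-Reasoning

          Wl⊑ : All (V₀ ∋_) Wl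
          Wl⊑ = All.tabulate λ v∈ → w.V⊑V₀ _ (proj₁ (proj₁ (toList⁻ Wt v∈)))

          q : Fin n → Fin n
          q = parent Γ Wl

          N₀ : Fin n → Sub n
          N₀ v = sub λ m → mem? V₀ m ×-dec near? Γ v m

          -- Each removal excludes one contact of a member or its tail with the prolongation `t₀`,
          -- `tt₀`, `Kt`; tails are far from `Kt` already by `R-tl`. The final intersection provides
          -- the neighbour `q m`.
          X₀ X₁ X₂ X₃ X₄ X : Sub n
          X₀ = w.Mw i ∖ Cov Γ Kt
          X₁ = X₀ ∖ N₀ t₀
          X₂ = X₁ ∖ N₀ tt₀
          X₃ = X₂ ∖ tails-at Γ (S.hub i) t₀
          X₄ = X₃ ∖ tails-at Γ (S.hub i) tt₀
          X  = X₄ ∩ Cov Γ Wl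

          X₀⊑V : X₀ ⊑ w.V
          X₀⊑V v (p , _) = w.Mw⊑V i v p

          minus : ∀ {k} (A B : Sub n) → size B ≤ u → suc k * u ≤ size A → k * u ≤ size (A ∖ B)
          minus {k} A B B≤ le′ = +-cancelˡ-≤ u _ _ (≤-trans le′ (≤-trans (size-split A B)
            (+-monoˡ-≤ _ (≤-trans (size-mono (A ∩ B) B λ _ → proj₂) B≤))))

          X-big : 6 * u ≤ size X
          -- Eleven units survive the neighbourhood of `Kt`; four go to contacts with `t₀` and
          -- `tt₀`, one to members without a neighbour in `Wt`.
          X-big = +-cancelʳ-≤ u _ _ (begin
              6 * u + u                     ≡⟨ +-comm (6 * u) u ⟩
              7 * u                         ≤⟨ minus {7} X₃ (tails-at Γ (S.hub i) tt₀) (<⇒≤ (w.clean (i≢j ∘ sym) Ex.t₀∈))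
                                                 (minus {8} X₂ (tails-at Γ (S.hub i) t₀) (<⇒≤ (w.good t₀∈V i))
                                                 (minus {9} X₁ (N₀ tt₀) (≤-trans (deg tt₀ (Hb.tl∈ j t₀∈M)) d≤u)
                                                 (minus {10} X₀ (N₀ t₀) (≤-trans (deg t₀ (w.V⊑V₀ _ t₀∈V)) d≤u) X₀-big))) ⟩
              size X₄                       ≤⟨ size-split X₄ (Cov Γ Wl) ⟩
              size X + size (X₄ ∖ Cov Γ Wl) ≤⟨ +-monoʳ-≤ _ (<⇒≤ (uncovered Wl X₄ Wl⊑ (λ v ((((p , _) , _) , _) , _) → w.V⊑V₀ v (X₀⊑V v p)) Wt-big)) ⟩
              size X + u                    ∎)
            where
            open ≤-Reasoning
            X₀-big : 11 * u ≤ size X₀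
            X₀-big = +-cancelˡ-≤ (3 * u) _ _ (begin
              3 * u + 11 * u                ≡⟨ sym (*-distribʳ-+ u 3 11) ⟩
              14 * u                        ≤⟨ ≤-trans (units (n≤1+n 14)) (w.Mw-size i) ⟩
              size (w.Mw i)                 ≤⟨ size-split (w.Mw i) (Cov Γ Kt) ⟩
              size (w.Mw i ∩ Cov Γ Kt) + size X₀ ≤⟨ +-monoˡ-≤ _ (≤-trans (size-mono (w.Mw i ∩ Cov Γ Kt) (w.V ∩ Cov Γ Kt) λ v (p , c) → w.Mw⊑V i v p , c) cov3) ⟩
              3 * u + size X₀               ∎)

          module Member {m} (m∈ : X ∋ m) where
            private
              in₀ : X₀ ∋ m
              in₀ = proj₁ (proj₁ (proj₁ (proj₁ (proj₁ m∈))))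
            inMw : w.Mw i ∋ m
            inMw = proj₁ in₀
            inV : w.V ∋ m
            inV = X₀⊑V m in₀
            inM : Hb.M i ∋ m
            inM = w.Mw⊑M i m inMw
            ¬Kt : ¬ (Cov Γ Kt ∋ m)
            ¬Kt = proj₂ in₀
            t₀-m : Far Γ m t₀
            t₀-m nr = proj₂ (proj₁ (proj₁ (proj₁ (proj₁ m∈)))) (w.V⊑V₀ m inV , near-sym Γ nr)
            tt₀-m : Far Γ m tt₀
            tt₀-m nr = proj₂ (proj₁ (proj₁ (proj₁ m∈))) (w.V⊑V₀ m inV , near-sym Γ nr)
            t₀-tl : Far Γ (Hb.tl i m) t₀
            t₀-tl nr = proj₂ (proj₁ (proj₁ m∈)) (inM , nr)
            tt₀-tl : Far Γ (Hb.tl i m) tt₀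
            tt₀-tl nr = proj₂ (proj₁ m∈) (inM , nr)
            inW : Wt ∋ q m
            inW = toList⁻ Wt (parent∈ Γ Wl (proj₂ m∈))
            qV : w.V ∋ q m
            qV = proj₁ (proj₁ inW)
            qK : Cov Γ Kt ∋ q m
            qK = proj₂ (proj₁ inW)
            q≢m : q m ≢ m
            q≢m e = ¬Kt (subst (Cov Γ Kt ∋_) e qK)

          A B : Fin n → Set
          A = Side x y
          B v = Side y x v ⊎ IsTail Γ Sp S j t₀ v ⊎ v ∈ Kt

          V-A : ∀ {v a} → w.V ∋ v → A a → Far Γ v a
          V-A v∈ a∈ = far-sym Γ (side-V {w = w} le {x} {y} a∈ v∈)

          V-B : ∀ {v b} → w.V ∋ v → Side y x b → Far Γ v b
          V-B v∈ b∈ = far-sym Γ (side-V {w = w} le {y} {x} b∈ v∈)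

          KtV : ∀ {k} → k ∈ Kt → w.V ∋ k
          KtV k∈ = w.R⊑ _ (All.lookup Gr.inside k∈)

          A-B : ∀ {a b} → A a → B b → Far Γ a b
          A-B a∈ (inj₁ b∈)               = side-side {x} {y} {y} {x} x≢y a∈ b∈
          A-B a∈ (inj₂ (inj₁ (inj₁ refl))) = side-V {w = w} le {x} {y} a∈ t₀∈V
          A-B a∈ (inj₂ (inj₁ (inj₂ refl))) = side-tl {w = w} le {x} {y} arm≢root (i≢j ∘ sym) a∈ Ex.t₀∈
          A-B a∈ (inj₂ (inj₂ k∈))        = side-V {w = w} le {x} {y} a∈ (KtV k∈)

          m-B : ∀ {m b} → X ∋ m → B b → Far Γ m b
          m-B m∈ (inj₁ b∈)               = V-B (Member.inV m∈) b∈
          m-B m∈ (inj₂ (inj₁ (inj₁ refl))) = Member.t₀-m m∈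
          m-B m∈ (inj₂ (inj₁ (inj₂ refl))) = Member.tt₀-m m∈
          m-B m∈ (inj₂ (inj₂ k∈))        = far-sym Γ (¬Cov⇒far Γ (Member.¬Kt m∈) k∈)

          w-B : ∀ {m b} → X ∋ m → B b → Far Γ (Hb.tl i m) b
          w-B m∈ (inj₁ b∈)               = far-sym Γ (side-tl {w = w} le {y} {x} arm≢root i≢j b∈ (Member.inMw m∈))
          w-B m∈ (inj₂ (inj₁ (inj₁ refl))) = Member.t₀-tl m∈
          w-B m∈ (inj₂ (inj₁ (inj₂ refl))) = Member.tt₀-tl m∈
          w-B m∈ (inj₂ (inj₂ k∈))        = S.R-tl (w.R⊑S _ (All.lookup Gr.inside k∈)) (Member.inM m∈)

          ra : ∀ {m} → X ∋ m → Reach Γ (Spi.b x) A (Hb.tl i m)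
          ra {m} m∈ = into (find (Hb.tl-K i (Member.inM m∈)))
            where
            into : ∃[ k ] k ∈ Hb.K i × Adj Γ k (Hb.tl i m) → Reach Γ (Spi.b x) A (Hb.tl i m)
            into (k , k∈ , adj) = reach-step Γ {U = A} (Graph.adj-sym Γ adj) (inj₂ (inj₂ k∈)) (side-reach {x} {y} {A} id k∈)

          reach-t₀ : Reach Γ (Spi.b y) B t₀
          reach-t₀ = into (find (Hb.tl-K j t₀∈M))
            where
            into : ∃[ k ] k ∈ Hb.K j × Adj Γ k tt₀ → Reach Γ (Spi.b y) B t₀
            into (k , k∈ , adj) = reach-step Γ {U = B} (Graph.adj-sym Γ (Hb.tl-m j t₀∈M)) (inj₂ (inj₁ (inj₂ refl)))
              (reach-step Γ {U = B} (Graph.adj-sym Γ adj) (inj₁ (inj₂ (inj₂ k∈))) (side-reach {y} {x} {B} inj₁ k∈))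

          reach-Kt : ∀ {k} → k ∈ Kt → Reach Γ (Spi.b y) B k
          reach-Kt k∈ = reach-conn Γ {U = B} Gr.conn (All.tabulate (inj₂ ∘ inj₂)) (root∈ Γ Gr.conn) k∈
            (reach-step Γ {U = B} Ex.z~t₀ (inj₂ (inj₁ (inj₁ refl))) reach-t₀)

          rb : ∀ {m} → X ∋ m → Reach Γ (Spi.b y) B (q m)
          rb {m} m∈ = into (find (touch-outside Γ (Member.qK m∈) (proj₂ (Member.inW m∈))))
            where
            into : ∃[ k ] k ∈ Kt × Adj Γ k (q m) → Reach Γ (Spi.b y) B (q m)
            into (k , k∈ , adj) = reach-step Γ {U = B} (Graph.adj-sym Γ adj) (inj₂ (inj₂ k∈)) (reach-Kt k∈)

          tl≢b : ∀ {m} → X ∋ m → Hb.tl i m ≢ Spi.b x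
          tl≢b m∈ e = Avoids.far-tl (avoid (inj₁ (refl , refl))) (arm≢root ∘ sym) (_≼_.M≼ le _ _ (Member.inMw m∈)) (inj₁ (sym e))

          abstract
            result : Outcome Γ (Spi.b x) (Spi.b y) A B X (Hb.tl i) q
            result = ParityLink.outcome Γ Sp X (Hb.tl i) q
              (λ v v∈ → w.V⊑V₀ v (Member.inV v∈)) X-big (inj₁ refl) (inj₁ (inj₁ refl))
              (λ m∈ → Hb.tl-m i (Member.inM m∈)) (λ m∈ → Graph.adj-sym Γ (near⇒adj Γ (parent-near Γ Wl (proj₂ m∈)) (Member.q≢m m∈)))
              (λ m∈ → Hb.tl∈ i (Member.inM m∈)) ra rb
              (λ m∈ → V-A (Member.inV m∈)) m-B w-B (λ m∈ → V-A (Member.qV m∈)) A-B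
              tl≢b
              (λ m∈ e → V-B (Member.qV m∈) (inj₁ refl) (inj₁ e))
              (λ m∈ m∈′ e → S.V-tl (w.V⊑ _ (Member.qV m∈′)) (Member.inM m∈) (sym e))
              (λ m∈ m∈′ e → Member.¬Kt m∈ (subst (Cov Γ Kt ∋_) (sym e) (Member.qK m∈′)))
              (λ m∈ m∈′ e → S.V-tl (w.V⊑ _ (Member.inV m∈′)) (Member.inM m∈) (sym e))

          x₁ y₁ m₁ : Fin n
          x₁ = proj₁ result
          y₁ = proj₁ (proj₂ result)
          m₁ = proj₁ (proj₂ (proj₂ result))

          x₁∈ : X ∋ x₁
          x₁∈ = proj₁ (proj₂ (proj₂ (proj₂ result)))

          y₁∈ : X ∋ y₁
          y₁∈ = proj₁ (proj₂ (proj₂ (proj₂ (proj₂ result))))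

          m₁∈ : X ∋ m₁
          m₁∈ = proj₁ (proj₂ (proj₂ (proj₂ (proj₂ (proj₂ result)))))

          made : ∀ U → (∀ {v} → A v → OnPath Γ (Spi.b x) (Spi.b y) U v) → (∀ {v} → B v → OnPath Γ (Spi.b x) (Spi.b y) U v) →
                 U x₁ → U y₁ → U (Hb.tl i m₁) → U (q y₁) → OddFuzzy Γ (Spi.b x) (Spi.b y) U
          made = proj₂ (proj₂ (proj₂ (proj₂ (proj₂ (proj₂ result)))))

          F : List (Fin n × Fin N)
          F = (x₁ , i) ∷ (y₁ , i) ∷ (Hb.tl i m₁ , i) ∷ (q y₁ , j) ∷ (t₀ , j) ∷ (tt₀ , j) ∷ []

          foot₀ : Fin n → Fin N → Set
          foot₀ v l = (v , l) ∈ F ⊎ (v ∈ Kt × l ≡ j)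

          F-inside : ∀ {v l} → (v , l) ∈ F → Inside Γ Sp S w v l
          F-inside (here refl)                                 = inj₁ (Member.inV x₁∈)
          F-inside (there (here refl))                         = inj₁ (Member.inV y₁∈)
          F-inside (there (there (here refl)))                 = inj₂ (m₁ , Member.inMw m₁∈ , refl)
          F-inside (there (there (there (here refl))))         = inj₁ (Member.qV y₁∈)
          F-inside (there (there (there (there (here refl))))) = inj₁ t₀∈V
          F-inside (there (there (there (there (there (here refl)))))) = inj₂ (t₀ , Ex.t₀∈ , refl)

          F-tags : ∀ {v l} → (v , l) ∈ F → l ≡ i ⊎ l ≡ j
          F-tags (here refl)                                 = inj₁ refl
          F-tags (there (here refl))                         = inj₁ refl
          F-tags (there (there (here refl)))                 = inj₁ refl
          F-tags (there (there (there (here refl))))         = inj₂ refl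
          F-tags (there (there (there (there (here refl))))) = inj₂ refl
          F-tags (there (there (there (there (there (here refl)))))) = inj₂ refl

        link : Link (x , y)
        link = record
          { foot = foot₀
          ; tags = λ where (inj₁ f) → F-tags f ; (inj₂ (_ , e)) → inj₂ e
          ; path = λ _ → made (Body x y foot₀) A⊆ B⊆
              (used (here refl)) (used (there (here refl))) (used (there (there (here refl)))) (used (there (there (there (here refl)))))
          }
          where
          used : ∀ {v l} → (v , l) ∈ F → Body x y foot₀ v
          used f = inj₂ (inj₂ (_ , inj₁ f))
          A⊆ : ∀ {v} → A v → OnPath Γ (Spi.b x) (Spi.b y) (Body x y foot₀) v
          A⊆ (inj₁ e) = inj₂ (inj₁ e)
          A⊆ (inj₂ r) = inj₁ (inj₁ r)
          B⊆ : ∀ {v} → B v → OnPath Γ (Spi.b x) (Spi.b y) (Body x y foot₀) v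
          B⊆ (inj₁ (inj₁ e)) = inj₂ (inj₂ e)
          B⊆ (inj₁ (inj₂ r)) = inj₁ (inj₂ (inj₁ r))
          B⊆ (inj₂ (inj₁ (inj₁ refl))) = inj₁ (used (there (there (there (there (here refl))))))
          B⊆ (inj₂ (inj₁ (inj₂ refl))) = inj₁ (used (there (there (there (there (there (here refl)))))))
          B⊆ (inj₂ (inj₂ k))           = inj₁ (inj₂ (inj₂ (j , inj₂ (k , refl))))

        link-inside : ∀ {v l} → Link.foot link v l → Inside Γ Sp S w v l
        link-inside (inj₁ f)       = F-inside f
        link-inside (inj₂ (k , _)) = inj₁ (KtV k)

        private
          module Sh = Shrink Γ Sp S link-cost w F (All.tabulate λ f → inside⇒usable Γ Sp S w (F-inside f)) Kt Gr.inside 3 cov3 ≤-refl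

        after-link : Σ (W a) λ w′ → (w′ ≤ʷ w) × (∀ {v l} → Link.foot link v l → Avoids Γ Sp S w′ v l)
        after-link = Sh.w′ , Sh.w′≼w , λ where
          (inj₁ f)       → Sh.avoids-F f
          (inj₂ (k , _)) → Sh.avoids-K k

      abstract
        link-op : ∀ xy a (w : W (link-cost + a)) → w ≤ʷ w₀ → Σ (Link xy) λ it → (∀ {v l} → Link.foot it v l → Inside Γ Sp S w v l) ×
                  Σ (W a) λ w′ → (w′ ≤ʷ w) × (∀ {v l} → Link.foot it v l → Avoids Γ Sp S w′ v l)
        link-op (x , y) a w le with x ≟ y
        ... | no x≢y = Make.link x y x≢y w le , Make.link-inside x y x≢y w le , Make.after-link x y x≢y w le
        ... | yes refl = record { foot = λ _ _ → ⊥ ; tags = λ () ; path = λ lt → contradiction refl (<⇒≢ lt) } , (λ ())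
                       , Sh.w′ , Sh.w′≼w , λ ()
          where module Sh = Shrink Γ Sp S link-cost w [] [] [] [] 0 (≤-reflexive (size-empty (World.V w ∩ Cov Γ []) λ _ → λ ())) z≤n

  -- Choice of the constants and the sparse case

  module Constants (h : ℕ) where

    -- `a` is what `h` stars and `h * h` links spend. `G` adds what a class loses to later hubs and
    -- to cleaning; `L` adds what `R` loses while `N` hubs are built and cleaned. `G` enters `L`
    -- through the cost of a hub, but not conversely.
    P p N a G L Λ : ℕ
    P = 2 ^ (h + h)
    p = pred P
    N = h * P
    a = h * (σ p + (suc (h + h) + suc (h + h))) + (h * h * 15 + 0)
    G = suc (N * (3 + N) + (N + N) + a)
    L = suc N * (3 + N + suc G) + (N + a)
    Λ = suc G * suc G

    P≡ : P ≡ suc p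
    P≡ = sym (suc-pred P ⦃ m^n≢0 2 (h + h) ⦄)

  module _ {h : ℕ} (H : Graph h) {n : ℕ} (Γ : Graph n) {V₀ : Sub n} {d u : ℕ} (Sp : Sparse Γ V₀ d u) where

    open Constants h

    module _ (thin : suc G * (suc G * d) ≤ u) (big : L * u ≤ size V₀) where

      private
        cls : Fin h → Fin P → Fin N
        cls = combine

        cls-inj : ∀ {x x′ k k′} → cls x k ≡ cls x′ k′ → x ≡ x′ × k ≡ k′
        cls-inj {x} {x′} {k} {k′} = combine-injective x k x′ k′

        abstract
          built : Σ (State Γ V₀ (Construction.s Γ Sp G N L (s≤s z≤n) thin) u N) (Construction.Sized Γ Sp G N L (s≤s z≤n) thin N)
          built = Construction.build Γ Sp G N L (s≤s z≤n) thin (m≤m+n _ (N + a)) big N ≤-refl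

        S : State Γ V₀ (Construction.s Γ Sp G N L (s≤s z≤n) thin) u N
        S = proj₁ built

        module S = State S
        module Hb i = Hub (S.hub i)

        abstract
          world : World Γ Sp S a
          world = clean-world Γ Sp G N L (s≤s z≤n) thin S (proj₂ built) a
            (≤-trans (≤-reflexive (+-assoc (N * (3 + N + suc G)) N a)) (+-monoˡ-≤ (N + a) (m≤n+m _ (3 + N + suc G))))
            (n≤1+n _)

        module St = StarOp Γ Sp S cls cls-inj P≡ refl
        module SSeq = Sequence Γ Sp S St.Spider (λ {x} → St.foot {x}) world St.star-cost (λ x a w _ → St.star-op x a w)

        abstract
          stars : SSeq.Extracted id (h * h * 15 + 0) world
          stars = SSeq.extract h id (h * h * 15 + 0) world (≼-refl Γ Sp S)

        module Ss = SSeq.Extracted stars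

        module Li = Linking Γ Sp S cls cls-inj P≡ refl Ss.item (λ ne → Ss.far ne) Ss.final Ss.avoids
        module LSeq = Sequence Γ Sp S Li.Link Li.Link.foot Ss.final Li.link-cost Li.link-op

        abstract
          links : LSeq.Extracted (remQuot h) 0 Ss.final
          links = LSeq.extract (h * h) (remQuot h) 0 Ss.final (≼-refl Γ Sp S)

        module Ls = LSeq.Extracted links

        pick : ∀ {xy} → (∃[ i ] remQuot {h} h i ≡ xy) → Li.Link xy
        pick (i , refl) = Ls.item i

        code : ∀ xy → ∃[ i ] remQuot {h} h i ≡ xy
        code (x , y) = combine x y , remQuot-combine x y

        pick-inside : ∀ {xy} (c : ∃[ i ] remQuot {h} h i ≡ xy) {q l} → Li.Link.foot (pick c) q l → Inside Γ Sp S Ss.final q l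
        pick-inside (i , refl) f = Ls.inside f

        pick-far : ∀ {xy xy′} (c : ∃[ i ] remQuot {h} h i ≡ xy) (c′ : ∃[ i ] remQuot {h} h i ≡ xy′) → xy ≢ xy′ → ∀ {q q′ l l′} →
                   Li.Link.foot (pick c) q l → Li.Link.foot (pick c′) q′ l′ → l ≢ l′ → Far Γ q q′
        pick-far (i , refl) (j , refl) ne = Ls.far (ne ∘ cong (remQuot h))

        lnk : ∀ x y → Li.Link (x , y)
        lnk x y = pick (code (x , y))

        Foot : Fin h → Fin h → Fin n → Fin N → Set
        Foot x y = Li.Link.foot (lnk x y)

        b : Fin h → Fin n
        b = Li.Spi.b

        U : Edge H → Fin n → Set
        U e = Li.Body (Edge.lo e) (Edge.hi e) (Foot (Edge.lo e) (Edge.hi e))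

        path : ∀ e → OddFuzzy Γ (b (Edge.lo e)) (b (Edge.hi e)) (U e)
        path e = Li.Link.path (lnk (Edge.lo e) (Edge.hi e)) (Edge.lo<hi e)

        Half : Fin h → Fin h → Fin n → Set
        Half x y q = IsTail Γ Sp S (Li.arm x y) (Li.Spi.leaf x y) q ⊎ (_∈K q)
          where
          open import Data.List.Membership.Propositional using (_∈_)
          _∈K : Fin n → Set
          q ∈K = q ∈ Hb.K (Li.arm x y)

        tag≢centre : ∀ {x y q l z} → Foot x y q l → Li.centre-class z ≢ l
        tag≢centre {x} {y} f e = [ (λ t → Li.arm≢root (trans (sym t) (sym e))) , (λ t → Li.arm≢root (trans (sym t) (sym e))) ]′ (Li.Link.tags (lnk x y) f)

        foot-b : ∀ {x y q l} z → Foot x y q l → Far Γ q (b z)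
        foot-b {x} {y} z f = far-sym Γ (avoids⇒far Γ Sp S (Ss.avoids (inj₁ (refl , refl))) (pick-inside (code (x , y)) f) (tag≢centre {x} {y} f))

        half-b : ∀ {x y q} z → z ≢ x → Half x y q → Far Γ q (b z)
        half-b {x} {y} z ne (inj₁ t) = far-sym Γ (Li.b-tail {y′ = y} ne t)
        half-b {x} {y} z ne (inj₂ k) = Li.K-b {x} {y} k

        half≢b : ∀ {x y q} z → Half x y q → q ≢ b z
        half≢b {x} {y} {q} z (inj₂ k) e = Li.K-b {x} {y} {z} k (inj₁ e)
        half≢b {x} {y} {q} z (inj₁ t) e = case z ≟ x of λ where
          (yes z≡x) → Li.Spi.tail≢b x t (trans e (cong b z≡x))
          (no ne)   → half-b z ne (inj₁ t) (inj₁ e)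

        Diff : (x y x′ y′ : Fin h) → Set
        Diff x y x′ y′ = x ≢ x′ ⊎ y ≢ y′

        half-half : ∀ {x y x′ y′ q q′} → Diff x y x′ y′ → Half x y q → Half x′ y′ q′ → Far Γ q q′
        half-half {x} {y} {x′} {y′} ne (inj₁ t) (inj₁ t′) = Li.tail-tail {x} {y} {x′} {y′} ne t t′
        half-half {x} {y} {x′} {y′} ne (inj₁ t) (inj₂ k)  = far-sym Γ (Li.K-tail {y = x} {y} (Li.arm≢arm ne ∘ sym) k t)
        half-half {x} {y} {x′} {y′} ne (inj₂ k) (inj₁ t)  = Li.K-tail {y = x′} {y′} (Li.arm≢arm ne) k t
        half-half {x} {y} {x′} {y′} ne (inj₂ k) (inj₂ k′) = Apart.K-K (S.apart (Li.arm≢arm ne)) k k′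

        half-inside : ∀ {x y q q′ l} → Li.arm x y ≢ l → Half x y q → Inside Γ Sp S Ss.final q′ l → Far Γ q q′
        half-inside {x} {y} ne (inj₁ t) ins = avoids⇒far Γ Sp S (Ss.avoids (inj₂ (y , refl , t))) ins ne
        half-inside ne (inj₂ k) (inj₁ v)    = S.V-K (World.V⊑ Ss.final _ v) k
        half-inside {q = q} ne (inj₂ k) (inj₂ (m , m∈ , e)) = subst (Far Γ q) (sym e) (Apart.K-tl (S.apart ne) k (World.Mw⊑M Ss.final _ m m∈))

        half-foot : ∀ {x y x′ y′ q q′ l} → Diff x y x′ y′ → Diff x y y′ x′ → Half x y q → Foot x′ y′ q′ l → Far Γ q q′
        half-foot {x} {y} {x′} {y′} d₁ d₂ hf f = half-inside {x} {y}
          (λ e → [ (λ t → Li.arm≢arm d₁ (trans e t)) , (λ t → Li.arm≢arm d₂ (trans e t)) ]′ (Li.Link.tags (lnk x′ y′) f)) hf (pick-inside (code (x′ , y′)) f)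

        diff-sym : ∀ {x y x′ y′} → Diff x y x′ y′ → Diff x′ y′ x y
        diff-sym = [ (λ ne → inj₁ (ne ∘ sym)) , (λ ne → inj₂ (ne ∘ sym)) ]′

        flip : ∀ {x y x′ y′} → Diff x y x′ y′ → Diff y x y′ x′
        flip = swap

        foot-foot : ∀ {x y x′ y′ q q′ l l′} → Diff x y x′ y′ → Diff x y y′ x′ → Foot x y q l → Foot x′ y′ q′ l′ → Far Γ q q′
        foot-foot {x} {y} {x′} {y′} {l = l} {l′ = l′} d₁ d₂ f f′ = pick-far (code (x , y)) (code (x′ , y′))
          (λ e → [ (λ ne → ne (cong proj₁ e)) , (λ ne → ne (cong proj₂ e)) ]′ d₁) f f′ tags≢
          where
          tags≢ : l ≢ l′
          tags≢ e = [ (λ t → [ (λ t′ → Li.arm≢arm d₁ (trans (sym t) (trans e t′))) , (λ t′ → Li.arm≢arm d₂ (trans (sym t) (trans e t′))) ]′ tg′)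
                    , (λ t → [ (λ t′ → Li.arm≢arm (flip d₂) (trans (sym t) (trans e t′))) , (λ t′ → Li.arm≢arm (flip d₁) (trans (sym t) (trans e t′))) ]′ tg′) ]′
                    (Li.Link.tags (lnk x y) f)
            where tg′ = Li.Link.tags (lnk x′ y′) f′

        -- A body contains the legs at both of its ends, so the two pairs must differ as they stand
        -- and also after swapping one of them.
        body-body : ∀ {x y x′ y′ q q′} → Diff x y x′ y′ → Diff x y y′ x′ → Li.Body x y (Foot x y) q → Li.Body x′ y′ (Foot x′ y′) q′ → Far Γ q q′
        body-body {x} {y} {x′} {y′} d₁ d₂ (inj₁ r)        (inj₁ r′)        = half-half {x} {y} {x′} {y′} d₁ r r′
        body-body {x} {y} {x′} {y′} d₁ d₂ (inj₁ r)        (inj₂ (inj₁ r′)) = half-half {x} {y} {y′} {x′} d₂ r r′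
        body-body {x} {y} {x′} {y′} d₁ d₂ (inj₁ r)        (inj₂ (inj₂ (_ , f))) = half-foot {x} {y} {x′} {y′} d₁ d₂ r f
        body-body {x} {y} {x′} {y′} d₁ d₂ (inj₂ (inj₁ r)) (inj₁ r′)        = half-half {y} {x} {x′} {y′} (flip d₂) r r′
        body-body {x} {y} {x′} {y′} d₁ d₂ (inj₂ (inj₁ r)) (inj₂ (inj₁ r′)) = half-half {y} {x} {y′} {x′} (flip d₁) r r′
        body-body {x} {y} {x′} {y′} d₁ d₂ (inj₂ (inj₁ r)) (inj₂ (inj₂ (_ , f))) = half-foot {y} {x} {x′} {y′} (flip d₂) (flip d₁) r f
        body-body {x} {y} {x′} {y′} d₁ d₂ (inj₂ (inj₂ (_ , f))) (inj₁ r)   = far-sym Γ (half-foot {x′} {y′} {x} {y} (diff-sym d₁) (flip (diff-sym d₂)) r f)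
        body-body {x} {y} {x′} {y′} d₁ d₂ (inj₂ (inj₂ (_ , f))) (inj₂ (inj₁ r)) = far-sym Γ (half-foot {y′} {x′} {x} {y} (diff-sym d₂) (flip (diff-sym d₁)) r f)
        body-body {x} {y} {x′} {y′} d₁ d₂ (inj₂ (inj₂ (_ , f))) (inj₂ (inj₂ (_ , f′))) = foot-foot {x} {y} {x′} {y′} d₁ d₂ f f′

        body≢b : ∀ {x y v} z → Li.Body x y (Foot x y) v → v ≢ b z
        body≢b {x} {y} z (inj₁ r)                 = half≢b {x} {y} z r
        body≢b {x} {y} z (inj₂ (inj₁ r))          = half≢b {y} {x} z r
        body≢b {x} {y} z (inj₂ (inj₂ (_ , f))) e  = foot-b {x} {y} z f (inj₁ e)

        body-b : ∀ {x y v} z → z ≢ x → z ≢ y → Li.Body x y (Foot x y) v → Far Γ v (b z)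
        body-b {x} {y} z nx ny (inj₁ r)               = half-b {x} {y} z nx r
        body-b {x} {y} z nx ny (inj₂ (inj₁ r))        = half-b {y} {x} z ny r
        body-b {x} {y} z nx ny (inj₂ (inj₂ (_ , f))) = foot-b {x} {y} z f

        diff : ∀ {e e′ : Edge H} → e ≢ e′ → Diff (Edge.lo e) (Edge.hi e) (Edge.lo e′) (Edge.hi e′)
        diff {e} {e′} ne = case Edge.lo e ≟ Edge.lo e′ of λ where
          (no l)  → inj₁ l
          (yes l) → inj₂ λ r → ne (edge-≡ l r)

        -- Edges are oriented upwards, so none is the reverse of any edge, itself included.
        diff′ : ∀ (e e′ : Edge H) → Diff (Edge.lo e) (Edge.hi e) (Edge.hi e′) (Edge.lo e′)
        diff′ e e′ = case Edge.lo e ≟ Edge.hi e′ of λ where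
          (no l)  → inj₁ l
          (yes l) → inj₂ λ r → <-asym (Edge.lo<hi e) (subst₂ Fin._<_ (sym r) (sym l) (Edge.lo<hi e′))

        b-injective : ∀ {x y} → b x ≡ b y → x ≡ y
        b-injective {x} {y} e = case x ≟ y of λ where
          (yes x≡y) → x≡y
          (no ne)   → contradiction (inj₁ e) (Li.b-b ne)

      abstract
        sparse⇒subdivision : ContainsSubdivision H Γ
        sparse⇒subdivision = contains-subdivision Γ H b b-injective Li.b-b U path
          (λ {e} x u∈ → body≢b {Edge.lo e} {Edge.hi e} x u∈)
          (λ {e} {v} {x} u∈ nx ny → body-b {Edge.lo e} {Edge.hi e} x nx ny u∈)
          (λ {e} {e′} ne u∈ u∈′ → body-body {Edge.lo e} {Edge.hi e} {Edge.lo e′} {Edge.hi e′} (diff ne) (diff′ e e′) u∈ u∈′)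

  abstract
    sparse-case : ∀ {h} (H : Graph h) → ∃[ g ] ∃[ L ] ∀ {n} (Γ : Graph n) {V₀ : Sub n} {d u} → Sparse Γ V₀ d u →
                  suc g * (suc g * d) ≤ u → L * u ≤ size V₀ → ContainsSubdivision H Γ
    sparse-case {h} H = Constants.G h , Constants.L h , λ Γ → sparse⇒subdivision H Γ

  -- Sparse or dense subsets

  pos-factor : ∀ {x y} p → x < p * y → NonZero p
  pos-factor (suc p) _ = _

  split-blocks : ∀ {n} (Z : Sub n) q z → q * z ≤ size Z →
                 Σ (Fin q → Sub n) λ C → (∀ i → C i ⊑ Z) × (∀ i → z ≤ size (C i)) × (∀ {i j v} → i ≢ j → C i ∋ v → C j ∋ v → ⊥)
  split-blocks Z zero    z le = (λ ()) , (λ ()) , (λ ()) , λ { {()} }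
  split-blocks {n} Z (suc q) z le with subset-of-size Z z (≤-trans (m≤m+n z (q * z)) le)
  ... | B , B⊑ , eq with split-blocks (Z ∖ B) q z rest
    where
    rest : q * z ≤ size (Z ∖ B)
    rest = +-cancelˡ-≤ z _ _ (begin
      z + q * z                     ≤⟨ le ⟩
      size Z                        ≤⟨ size-split Z B ⟩
      size (Z ∩ B) + size (Z ∖ B)   ≤⟨ +-monoˡ-≤ _ (≤-trans (size-mono (Z ∩ B) B λ _ → proj₂) (≤-reflexive eq)) ⟩
      z + size (Z ∖ B)              ∎)
      where open ≤-Reasoning
  ...   | C , C⊑ , big , dis = C′ , sub′ , big′ , λ {i} {j} → dis′ i j
    where
    C′ : Fin (suc q) → Sub n
    C′ zero    = B
    C′ (suc i) = C i
    sub′ : ∀ i → C′ i ⊑ Z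
    sub′ zero    = B⊑
    sub′ (suc i) v = proj₁ ∘ C⊑ i v
    big′ : ∀ i → z ≤ size (C′ i)
    big′ zero    = ≤-reflexive (sym eq)
    big′ (suc i) = big i
    dis′ : ∀ i j {v} → i ≢ j → C′ i ∋ v → C′ j ∋ v → ⊥
    dis′ zero    zero    ne _ _  = ne refl
    dis′ zero    (suc j) ne b c  = proj₂ (C⊑ j _ c) b
    dis′ (suc i) zero    ne c b  = proj₂ (C⊑ i _ c) b
    dis′ (suc i) (suc j) ne c c′ = dis (ne ∘ cong suc) c c′

  -- A block may shrink by a factor `p` with each embedded vertex. `suc (q * A)` exceeds what `q`
  -- bad sets below the bound `A` can fill, and the last `A` is the size demanded of a thin pair.
  blocks : (p A q : ℕ) → ℕ
  blocks p A zero    = 0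
  blocks p A (suc q) = p * blocks p A q + (suc (q * A) + A)

  -- A Ramsey recursion: the colour of a thin pair decides which of the two numbers decreases, and
  -- there is room for either call. The summand `2` leaves `2 * b` vertices on the side from which
  -- `b` are added.
  span : ℕ → ℕ → ℕ → ℕ
  span q zero    t       = 0
  span q (suc s) zero    = 0
  span q (suc s) (suc t) = q * blocks (2 * (suc s + suc t)) (span q s (suc t) + span q (suc s) t + 2) q

  module _ {n : ℕ} (G : Graph n) where

    adj-symᵇ : ∀ x y → Graph.adj G x y ≡ Graph.adj G y x
    adj-symᵇ x y with Graph.adj G x y in e | Graph.adj G y x in e′
    ... | true  | true  = refl
    ... | false | false = refl
    ... | true  | false = contradiction (Graph.adj-sym G {x} {y} (Equivalence.from T-≡ e)) (subst (¬_ ∘ T) (sym e′) id)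
    ... | false | true  = contradiction (Graph.adj-sym G {y} {x} (Equivalence.from T-≡ e′)) (subst (¬_ ∘ T) (sym e) id)

    E : Bool → Fin n → Fin n → Set
    E β x y = Graph.adj G x y ≡ β

    E? : ∀ β x y → Dec (E β x y)
    E? β x y = Graph.adj G x y ≟ᵇ β

    nbr : Bool → Fin n → Sub n → Sub n
    nbr β x Y = sub λ y → mem? Y y ×-dec E? β x y

    Embedding : ∀ {q} → (Fin q → Fin q → Bool) → (Fin q → Sub n) → Set
    Embedding {q} Q C = Σ (Fin q → Fin n) λ f → (∀ i → C i ∋ f i) × (∀ {i j : Fin q} → i Fin.< j → Graph.adj G (f i) (f j) ≡ Q i j)

    record ThinPair (p a : ℕ) (Z : Sub n) : Set₁ where
      field
        β      : Bool
        X Y    : Sub n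
        X⊑     : X ⊑ Z
        Y⊑     : Y ⊑ Z
        X#Y    : ∀ {v} → X ∋ v → Y ∋ v → ⊥
        X-size : a ≤ size X
        Y-size : a ≤ size Y
        thin   : ∀ {x} → X ∋ x → p * size (nbr β x Y) ≤ size Y

    -- A vertex `v` is acceptable if more than a fraction `1 / p` of every later block remains as
    -- candidates. If none is, a single later block is to blame for many vertices of the first
    -- block, and these form a thin pair with it.
    embed-or-thin : ∀ q (Q : Fin q → Fin q → Bool) p A b → 1 ≤ b → ∀ Z (C : Fin q → Sub n) → (∀ i → C i ⊑ Z) →
                    (∀ {i j v} → i ≢ j → C i ∋ v → C j ∋ v → ⊥) → (∀ i → blocks p A q * b ≤ size (C i)) →
                    Embedding Q C ⊎ ThinPair p (A * b) Z
    embed-or-thin zero    Q p A b 1≤b Z C C⊑ dis big = inj₁ ((λ ()) , (λ ()) , λ { {()} })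
    embed-or-thin (suc q) Q p A b 1≤b Z C C⊑ dis big = choose (any? λ v → mem? (C zero) v ×-dec all? λ j → size (C (suc j)) <? p * size (cand v j))
      where
      cand : Fin n → Fin q → Sub n
      cand v j = nbr (Q zero (suc j)) v (C (suc j))
      enough : ∀ i → (q * A) * b + b + A * b ≤ size (C i)
      enough i = begin
        (q * A) * b + b + A * b              ≡⟨ cong (_+ A * b) (+-comm (q * A * b) b) ⟩
        suc (q * A) * b + A * b              ≡⟨ sym (*-distribʳ-+ b (suc (q * A)) A) ⟩
        (suc (q * A) + A) * b                ≤⟨ *-monoˡ-≤ b (m≤n+m _ (p * blocks p A q)) ⟩
        blocks p A (suc q) * b               ≤⟨ big i ⟩
        size (C i)                           ∎
        where open ≤-Reasoning
      choose : Dec (∃[ v ] C zero ∋ v × (∀ j → size (C (suc j)) < p * size (cand v j))) → Embedding Q C ⊎ ThinPair p (A * b) Z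
      choose (yes (v , v∈ , ok)) with embed-or-thin q (λ i j → Q (suc i) (suc j)) p A b 1≤b Z (cand v)
          (λ j w (c , _) → C⊑ (suc j) w c) (λ ne (c , _) (c′ , _) → dis (ne ∘ suc-injective) c c′)
          (λ j → *-cancelˡ-≤ p ⦃ nz j ⦄ (≤-trans (≤-reflexive (sym (*-assoc p (blocks p A q) b)))
            (≤-trans (*-monoˡ-≤ b (m≤m+n (p * blocks p A q) _)) (≤-trans (big (suc j)) (<⇒≤ (ok j))))))
        where
        nz : ∀ j → NonZero p
        nz j = pos-factor p (ok j)
      ... | inj₂ tp = inj₂ tp
      ... | inj₁ (f , f∈ , adj) = inj₁ (f′ , f′∈ , λ {i} {j} → adj′ i j)
        where
        f′ : Fin (suc q) → Fin n
        f′ zero    = v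
        f′ (suc j) = f j
        f′∈ : ∀ i → C i ∋ f′ i
        f′∈ zero    = v∈
        f′∈ (suc j) = proj₁ (f∈ j)
        adj′ : ∀ i j → i Fin.< j → Graph.adj G (f′ i) (f′ j) ≡ Q i j
        adj′ zero    (suc j) lt       = proj₂ (f∈ j)
        adj′ (suc i) (suc j) (s≤s lt) = adj lt
      choose (no none) = pick (any? λ j → A * b ≤? size (Bad j))
        where
        Bad : Fin q → Sub n
        Bad j = sub λ v → mem? (C zero) v ×-dec (p * size (cand v j) ≤? size (C (suc j)))
        pick : Dec (∃[ j ] A * b ≤ size (Bad j)) → Embedding Q C ⊎ ThinPair p (A * b) Z
        pick (yes (j , le)) = inj₂ record
          { β = Q zero (suc j) ; X = Bad j ; Y = C (suc j) ; X⊑ = λ v (c , _) → C⊑ zero v c ; Y⊑ = C⊑ (suc j)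
          ; X#Y = λ (c , _) c′ → dis (λ ()) c c′ ; X-size = le ; Y-size = ≤-trans (m≤n+m (A * b) _) (enough (suc j)) ; thin = proj₂ }
        pick (no few) = contradiction (begin-strict
            size (C zero)         ≤⟨ size-mono (C zero) AllBad (λ v c → let (j , ¬lt) = ¬∀⟶∃¬ q _ (λ j → size (C (suc j)) <? p * size (cand v j)) (λ ok → none (v , c , ok))
                                                                       in j , c , ≮⇒≥ ¬lt) ⟩
            size AllBad           ≤⟨ size-⋃ Bad (λ j → ≰⇒≥ λ le → few (j , le)) ⟩
            q * (A * b)           ≡⟨ sym (*-assoc q A b) ⟩
            q * A * b             <⟨ m<m+n (q * A * b) 1≤b ⟩
            q * A * b + b         ≤⟨ m≤m+n _ (A * b) ⟩
            q * A * b + b + A * b ≤⟨ enough zero ⟩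
            size (C zero)         ∎) (<-irrefl refl)
          where
          open ≤-Reasoning
          AllBad : Sub n
          AllBad = sub λ v → any? λ j → mem? (Bad j) v

    -- The orientation makes the degree bound independent of `m`: edges to added vertices point
    -- towards them, so old in-degrees do not grow. The ratio of size to degree can thus be made as
    -- large as desired.
    record Degenerate (β : Bool) (m b : ℕ) (Z : Sub n) : Set₁ where
      field
        S      : Sub n
        S⊑     : S ⊑ Z
        S-size : size S ≡ m * b
        O      : Fin n → Fin n → Set
        O?     : ∀ x y → Dec (O x y)
        total  : ∀ {x y} → S ∋ x → S ∋ y → x ≢ y → E β x y → O x y ⊎ O y x
        in-deg : ∀ {y} → S ∋ y → size (sub λ x → mem? S x ×-dec O? x y) ≤ 2 * b

    -- By Markov's inequality at most half of `Y` has `b` or more neighbours of colour `β` in `S`,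
    -- and `b` of the other vertices are added. A new in-degree is at most `b` from `S` and `b` from
    -- the added set itself.
    enlarge : ∀ {β m b Z X Y p} → 1 ≤ b → X ⊑ Z → Y ⊑ Z → (∀ {v} → X ∋ v → Y ∋ v → ⊥) → 2 * b ≤ size Y → .⦃ _ : NonZero p ⦄ → 2 * m ≤ p →
              (∀ {x} → X ∋ x → p * size (nbr β x Y) ≤ size Y) → Degenerate β m b X → Degenerate β (suc m) b Z
    enlarge {β} {m} {b} {Z} {X} {Y} {p} 1≤b X⊑ Y⊑ X#Y 2b≤ 2m≤p thin D = finish (subset-of-size (Y ∖ Bad) b good-size)
      where
      open Degenerate D
      k = size Y / p
      Bad : Sub n
      Bad = sub λ y → mem? Y y ×-dec (b ≤? size (fibre (E β) (E? β) S y))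
      bad-size : size Bad ≤ m * k
      bad-size = *-cancelʳ-≤ _ _ b ⦃ >-nonZero 1≤b ⦄ (begin
        size Bad * b      ≤⟨ markov S Y (E? β) b (λ x x∈ → ≤-trans (≤-reflexive (sym (m*n/n≡m _ p)))
                               (/-monoˡ-≤ p (≤-trans (≤-reflexive (*-comm _ p)) (thin (S⊑ x x∈))))) ⟩
        size S * k        ≡⟨ cong (_* k) S-size ⟩
        m * b * k         ≡⟨ trans (*-assoc m b k) (trans (cong (m *_) (*-comm b k)) (sym (*-assoc m k b))) ⟩
        m * k * b         ∎)
        where open ≤-Reasoning
      good-size : b ≤ size (Y ∖ Bad)
      good-size = *-cancelˡ-≤ 2 (≤-trans 2b≤ (+-cancelˡ-≤ (size Y) _ _ (begin
        size Y + size Y                             ≡⟨ cong (size Y +_) (sym (+-identityʳ _)) ⟩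
        2 * size Y                                  ≤⟨ *-monoʳ-≤ 2 (≤-trans (size-split Y Bad) (+-monoˡ-≤ _ (≤-trans (size-mono (Y ∩ Bad) Bad λ _ → proj₂) bad-size))) ⟩
        2 * (m * k + size (Y ∖ Bad))                ≡⟨ *-distribˡ-+ 2 (m * k) _ ⟩
        2 * (m * k) + 2 * size (Y ∖ Bad)            ≤⟨ +-monoˡ-≤ _ (≤-trans (≤-reflexive (sym (*-assoc 2 m k))) (≤-trans (*-monoˡ-≤ k 2m≤p)
                                                         (≤-trans (≤-reflexive (*-comm p k)) (m/n*n≤m (size Y) p)))) ⟩
        size Y + 2 * size (Y ∖ Bad)                 ∎)))
        where open ≤-Reasoning
      finish : ∃[ Y′ ] Y′ ⊑ Y ∖ Bad × size Y′ ≡ b → Degenerate β (suc m) b Z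
      finish (Y′ , Y′⊑ , Y′-size) = record
        { S = S′ ; S⊑ = λ where v (inj₁ s) → X⊑ v (S⊑ v s) ; v (inj₂ y) → Y⊑ v (proj₁ (Y′⊑ v y))
        ; S-size = ≤-antisym (≤-trans (size-cover S′ Y′ S λ where v (inj₁ s) → inj₂ s ; v (inj₂ y) → inj₁ y) (≤-reflexive sizes))
                             (≤-trans (≤-reflexive (sym sizes)) (size-disjoint S′ Y′ S (λ _ → inj₂) (λ _ → inj₁) λ v y s → S#Y′ s y))
        ; O = O′ ; O? = O′? ; total = total′ ; in-deg = in-deg′ }
        where
        S′ : Sub n
        S′ = sub λ v → mem? S v ⊎-dec mem? Y′ v
        sizes : size Y′ + size S ≡ suc m * b
        sizes = cong₂ _+_ Y′-size S-size
        S#Y′ : ∀ {v} → S ∋ v → Y′ ∋ v → ⊥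
        S#Y′ s y = X#Y (S⊑ _ s) (proj₁ (Y′⊑ _ y))
        O′ : Fin n → Fin n → Set
        O′ x y = (S ∋ x × S ∋ y × O x y) ⊎ (Y′ ∋ y × E β x y)
        O′? : ∀ x y → Dec (O′ x y)
        O′? x y = (mem? S x ×-dec (mem? S y ×-dec O? x y)) ⊎-dec (mem? Y′ y ×-dec E? β x y)
        total′ : ∀ {x y} → S′ ∋ x → S′ ∋ y → x ≢ y → E β x y → O′ x y ⊎ O′ y x
        total′ (inj₁ s) (inj₁ s′) ne e = [ (λ o → inj₁ (inj₁ (s , s′ , o))) , (λ o → inj₂ (inj₁ (s′ , s , o))) ]′ (total s s′ ne e)
        total′ _        (inj₂ y)  ne e = inj₁ (inj₂ (y , e))
        total′ {x} {y} (inj₂ y′) _ ne e = inj₂ (inj₂ (y′ , trans (adj-symᵇ y x) e))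
        in-deg′ : ∀ {y} → S′ ∋ y → size (sub λ x → mem? S′ x ×-dec O′? x y) ≤ 2 * b
        in-deg′ {y} (inj₁ s) = ≤-trans (size-mono (sub λ x → mem? S′ x ×-dec O′? x y) (sub λ x → mem? S x ×-dec O? x y) λ where
            x (_ , inj₁ (sx , _ , o)) → sx , o
            x (_ , inj₂ (y′ , _))     → ⊥-elim (S#Y′ s y′)) (in-deg s)
        in-deg′ {y} (inj₂ y′) = ≤-trans (size-cover (sub λ x → mem? S′ x ×-dec O′? x y) (fibre (E β) (E? β) S y) Y′ λ where
            x (_ , inj₁ (_ , sy , _))    → ⊥-elim (S#Y′ sy y′)
            x (inj₁ s , inj₂ (_ , e))    → inj₁ (s , e)
            x (inj₂ yx , inj₂ (_ , e))   → inj₂ yx)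
          (+-mono-≤ (≰⇒≥ λ le → proj₂ (Y′⊑ y y′) (proj₁ (Y′⊑ y y′) , le)) (≤-trans (≤-reflexive Y′-size) (≤-reflexive (sym (+-identityʳ b)))))

    widen : ∀ {β m b Z Z′} → Z ⊑ Z′ → Degenerate β m b Z → Degenerate β m b Z′
    widen le D = record { Degenerate D ; S⊑ = λ v → le v ∘ Degenerate.S⊑ D v }

    nothing-yet : ∀ β b Z → Degenerate β 0 b Z
    nothing-yet β b Z = record
      { S = sub {Mem = λ _ → ⊥} λ _ → no λ () ; S⊑ = λ _ () ; S-size = size-empty (sub {n} {Mem = λ _ → ⊥} λ _ → no λ ()) λ _ ()
      ; O = λ _ _ → ⊥ ; O? = λ _ _ → no λ () ; total = λ () ; in-deg = λ () }

    module _ {q} (Q : Fin q → Fin q → Bool) where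

      -- The blocks are kept because their disjointness makes the embedding injective.
      Copy : Set₁
      Copy = Σ (Fin q → Sub n) λ C → Embedding Q C × (∀ {i j : Fin q} {v} → i ≢ j → C i ∋ v → C j ∋ v → ⊥)

      -- For a thin pair of colour `β` the recursion runs inside `X` with the number for `β`
      -- lowered: an outcome of colour `β` is enlarged from `Y`, one of the other colour is already
      -- as required.
      rödl : ∀ s t b Z → 1 ≤ b → span q s t * b ≤ size Z → Copy ⊎ Degenerate true s b Z ⊎ Degenerate false t b Z
      rödl zero    t       b Z 1≤b le = inj₂ (inj₁ (nothing-yet true b Z))
      rödl (suc s) zero    b Z 1≤b le = inj₂ (inj₂ (nothing-yet false b Z))
      rödl (suc s) (suc t) b Z 1≤b le with split-blocks Z q (blocks p A q * b) (≤-trans (≤-reflexive (sym (*-assoc q (blocks p A q) b))) le)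
        where
        p = 2 * (suc s + suc t)
        A = span q s (suc t) + span q (suc s) t + 2
      ... | C , C⊑ , big , dis with embed-or-thin q Q (2 * (suc s + suc t)) (span q s (suc t) + span q (suc s) t + 2) b 1≤b Z C C⊑ dis big
      ...   | inj₁ em = inj₁ (C , em , dis)
      ...   | inj₂ tp = by (ThinPair.β tp) refl
        where
        open ThinPair tp
        A≤ : ∀ {k} → k ≤ span q s (suc t) + span q (suc s) t + 2 → ∀ {B} → (span q s (suc t) + span q (suc s) t + 2) * b ≤ size B → k * b ≤ size B
        A≤ le′ le″ = ≤-trans (*-monoˡ-≤ b le′) le″
        thinβ : ∀ {β′} → β ≡ β′ → ∀ {x} → X ∋ x → 2 * (suc s + suc t) * size (nbr β′ x Y) ≤ size Y
        thinβ refl = thin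
        by : ∀ β′ → β ≡ β′ → Copy ⊎ Degenerate true (suc s) b Z ⊎ Degenerate false (suc t) b Z
        by true e with rödl s (suc t) b X 1≤b (A≤ (≤-trans (m≤m+n _ (span q (suc s) t)) (m≤m+n _ 2)) X-size)
        ... | inj₁ cp        = inj₁ cp
        ... | inj₂ (inj₂ D)  = inj₂ (inj₂ (widen X⊑ D))
        ... | inj₂ (inj₁ D)  = inj₂ (inj₁ (enlarge 1≤b X⊑ Y⊑ X#Y (A≤ (m≤n+m 2 _) Y-size) (*-monoʳ-≤ 2 (≤-trans (n≤1+n s) (m≤m+n (suc s) (suc t)))) (thinβ e) D))
        by false e with rödl (suc s) t b X 1≤b (A≤ (≤-trans (m≤n+m _ (span q s (suc t))) (m≤m+n _ 2)) X-size)
        ... | inj₁ cp        = inj₁ cp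
        ... | inj₂ (inj₁ D)  = inj₂ (inj₁ (widen X⊑ D))
        ... | inj₂ (inj₂ D)  = inj₂ (inj₂ (enlarge 1≤b X⊑ Y⊑ X#Y (A≤ (m≤n+m 2 _) Y-size) (*-monoʳ-≤ 2 (≤-trans (n≤1+n t) (m≤n+m (suc t) (suc s)))) (thinβ e) D))

    -- Deleting the vertices of large out-degree bounds all degrees.
    trim-degrees : ∀ {β m b Z} → 1 ≤ b → Degenerate β m b Z →
                   ∃[ S ] S ⊑ Z × m * b ≤ 2 * size S × (∀ {v} → S ∋ v → size (sub λ x → mem? S x ×-dec ((v ≟ x) ⊎-dec (¬? (v ≟ x) ×-dec E? β v x))) ≤ 7 * b)
    trim-degrees {β} {m} {b} {Z} 1≤b D = S₁ , (λ v (s , _) → S⊑ v s) , half , degree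
      where
      open Degenerate D
      Rev? : ∀ y x → Dec (O x y)
      Rev? y x = O? x y
      Bad S₁ : Sub n
      Bad = sub λ x → mem? S x ×-dec (4 * b ≤? size (fibre (λ y x → O x y) Rev? S x))
      S₁ = S ∖ Bad
      -- Out-degrees and in-degrees have the same sum, so at most half of `S` has out-degree `4 * b`
      -- or more.
      bad-size : 2 * size Bad ≤ m * b
      bad-size = *-cancelʳ-≤ _ _ (2 * b) ⦃ >-nonZero (≤-trans 1≤b (m≤m+n b (b + 0))) ⦄ (begin
        2 * size Bad * (2 * b)     ≡⟨ cong (_* (2 * b)) (*-comm 2 (size Bad)) ⟩
        size Bad * 2 * (2 * b)     ≡⟨ *-assoc (size Bad) 2 (2 * b) ⟩
        size Bad * (2 * (2 * b))   ≡⟨ cong (size Bad *_) (sym (*-assoc 2 2 b)) ⟩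
        size Bad * (4 * b)         ≤⟨ markov S S Rev? (4 * b) (λ y y∈ → in-deg y∈) ⟩
        size S * (2 * b)           ≡⟨ cong (_* (2 * b)) S-size ⟩
        m * b * (2 * b)            ∎)
        where open ≤-Reasoning
      half : m * b ≤ 2 * size S₁
      half = +-cancelˡ-≤ (m * b) _ _ (begin
        m * b + m * b                      ≡⟨ cong (m * b +_) (sym (+-identityʳ _)) ⟩
        2 * (m * b)                        ≤⟨ *-monoʳ-≤ 2 (≤-trans (≤-reflexive (sym S-size)) (size-split S Bad)) ⟩
        2 * (size (S ∩ Bad) + size S₁)     ≡⟨ *-distribˡ-+ 2 (size (S ∩ Bad)) _ ⟩
        2 * size (S ∩ Bad) + 2 * size S₁   ≤⟨ +-monoˡ-≤ _ (≤-trans (*-monoʳ-≤ 2 (size-mono (S ∩ Bad) Bad λ _ → proj₂)) bad-size) ⟩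
        m * b + 2 * size S₁                ∎)
        where open ≤-Reasoning
      degree : ∀ {v} → S₁ ∋ v → size (sub λ x → mem? S₁ x ×-dec ((v ≟ x) ⊎-dec (¬? (v ≟ x) ×-dec E? β v x))) ≤ 7 * b
      degree {v} (s , ¬bad) = begin
        size N                                ≤⟨ size-cover N One Rest (λ where x (_ , inj₁ e) → inj₁ (sym e) ; x ((sx , _) , inj₂ (ne , e)) → inj₂ (total s sx ne e , sx)) ⟩
        size One + size Rest                  ≤⟨ +-mono-≤ (size-single One v λ _ → id) (size-cover Rest Out In (λ where
                                                   x (inj₁ o , sx) → inj₁ (sx , o) ; x (inj₂ o , sx) → inj₂ (sx , o))) ⟩
        -- The vertex itself, its out-neighbours and its in-neighbours.
        1 + (size Out + size In)              ≤⟨ +-mono-≤ 1≤b (+-mono-≤ (≰⇒≥ λ le → ¬bad (s , le)) (in-deg s)) ⟩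
        b + (4 * b + 2 * b)                   ≡⟨ cong (b +_) (sym (*-distribʳ-+ b 4 2)) ⟩
        7 * b                                 ∎
        where
        open ≤-Reasoning
        N One Rest Out In : Sub n
        N = sub λ x → mem? S₁ x ×-dec ((v ≟ x) ⊎-dec (¬? (v ≟ x) ×-dec E? β v x))
        One = sub λ x → x ≟ v
        Rest = sub λ x → (O? v x ⊎-dec O? x v) ×-dec mem? S x
        Out = fibre (λ y x → O x y) Rev? S v
        In = sub λ x → mem? S x ×-dec O? x v

  abstract
    rödl-constant : ∀ {q} (Q : Fin q → Fin q → Bool) m → ∃[ c ] ∀ {n} (G : Graph n) b Z → 1 ≤ b → c * b ≤ size Z →
                    Copy G Q ⊎ Degenerate G true m b Z ⊎ Degenerate G false m b Z
    rödl-constant {q} Q m = span q m m , λ G → rödl G Q m m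

open Combinatorics
open import Data.Fin.Subset using (Subset; ∣_∣; ⁅_⁆; Empty) renaming (_∈_ to _∈ˢ_; _∩_ to _∩ˢ_)
open import Data.Fin.Subset.Properties using (anySubset?; nonempty?; ∣⁅x⁆∣≡1; x∈⁅y⁆⇒x≡y; x∈p∩q⁻) renaming (_∈?_ to _∈ˢ?_)
open import Data.Integer.Base as ℤ using (+_)
import Data.Integer.Properties as ℤ
open import Data.Nat.Base using (zero; suc; s≤s; z≤n)
open import Data.Nat.DivMod using (_%_; m/n*n≤m; m%n<n; m≡m%n+[m/n]*n; m≥n⇒m/n>0) renaming (_/_ to _÷_)
import Data.Nat.Properties as ℕ
open import Data.Rational.Base using (ℚ; 0ℚ; _<_; _≤_; _*_; _/_; toℚᵘ)
import Data.Rational.Properties as ℚ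
open import Data.Rational.Unnormalised.Base as ℚᵘ using (mkℚᵘ; *≤*)
import Data.Rational.Unnormalised.Properties as ℚᵘ
import Data.Vec.Base as Vec
open import Data.Vec.Properties using (lookup∘tabulate; []=⇒lookup)

-- Pure pairs, and passing to the complement

toSubset : ∀ {n} → Sub n → Subset n
toSubset A = Vec.tabulate (does ∘ mem? A)

toSubset⁻ : ∀ {n} (A : Sub n) {v} → v ∈ˢ toSubset A → A ∋ v
toSubset⁻ A {v} v∈ with mem? A v | trans (sym (lookup∘tabulate (does ∘ mem? A) v)) ([]=⇒lookup v∈)
... | yes a | _ = a

∣toSubset∣ : ∀ {n} (A : Sub n) → ∣ toSubset A ∣ ≡ size A
∣toSubset∣ A = trans (count (mem? A)) (sym (size-∑ A))
  where
  count : ∀ {n} {M : Fin n → Set} (M? : ∀ v → Dec (M v)) → ∣ Vec.tabulate (does ∘ M?) ∣ ≡ ∑ (λ v → bit (M? v))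
  count {zero}  M? = refl
  count {suc n} M? with M? zero
  ... | yes _ = cong suc (count (M? ∘ suc))
  ... | no _  = count (M? ∘ suc)

module _ {n : ℕ} (G : Graph n) where

  PurePair : ℕ → Subset n → Subset n → Set
  PurePair u A B = u ℕ.≤ ∣ A ∣ × u ℕ.≤ ∣ B ∣ × (Complete G A B ⊎ Anticomplete G A B)

  -- Coherence is the absence of a pure pair, so the argument has to decide whether one exists; the
  -- finitely many subsets are searched.
  pure-pair? : ∀ u → Dec (∃[ A ] ∃[ B ] PurePair u A B)
  pure-pair? u = anySubset? λ A → anySubset? λ B → (u ℕ.≤? ∣ A ∣) ×-dec ((u ℕ.≤? ∣ B ∣) ×-dec
    ((¬? (nonempty? (A ∩ˢ B)) ×-dec (all? λ x → all? λ y → (x ∈ˢ? A) →-dec ((y ∈ˢ? B) →-dec adj? x y))) ⊎-dec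
     (¬? (nonempty? (A ∩ˢ B)) ×-dec (all? λ x → all? λ y → (x ∈ˢ? A) →-dec ((y ∈ˢ? B) →-dec ¬? (adj? x y))))))
    where
    adj? : ∀ x y → Dec (Adj G x y)
    adj? x y = T? (Graph.adj G x y)

  side : Bool → Graph n
  side true  = G
  side false = complement G

  complement⇔ : ∀ {x y} → Adj (complement G) x y ⇔ (x ≢ y × ¬ Adj G x y)
  complement⇔ = mk⇔ toWitness fromWitness

  near-side : ∀ β {x y} → Near (side β) x y → (x ≡ y) ⊎ ((x ≢ y) × E G β x y)
  near-side β {x} {y} nr with x ≟ y
  ... | yes e = inj₁ e
  near-side β     (inj₁ e) | no ne = contradiction e ne
  near-side true  (inj₂ a) | no ne = inj₂ (ne , Equivalence.to T-≡ a)
  near-side false (inj₂ a) | no ne = inj₂ (ne , ¬-not λ e → proj₂ (Equivalence.to complement⇔ a) (Equivalence.from T-≡ e))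

  far-side : ∀ β {x y} → Far (side β) x y → (β ≡ true × ¬ Adj G x y) ⊎ (β ≡ false × Adj G x y)
  far-side true  f = inj₁ (refl , f ∘ inj₂)
  far-side false {x} {y} f = go (Graph.adj G x y) refl
    where
    go : ∀ c → Graph.adj G x y ≡ c → (false ≡ true × ¬ Adj G x y) ⊎ (false ≡ false × Adj G x y)
    go true  e = inj₂ (refl , Equivalence.from T-≡ e)
    go false e = contradiction (inj₂ (Equivalence.from complement⇔ ((f ∘ inj₁) , subst T e))) f

  -- Two sets without contact in `side β` are anticomplete in `G` for `true` and complete for
  -- `false`; either way they would be a pure pair.
  sparse-side : ∀ {β m b Z} u → 1 ℕ.≤ b → 7 ℕ.* b ℕ.≤ u → ¬ (∃[ A ] ∃[ B ] PurePair u A B) → (D : Degenerate G β m b Z) →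
                ∃[ S ] m ℕ.* b ℕ.≤ 2 ℕ.* size S × Sparse (side β) S (7 ℕ.* b) u
  sparse-side {β} {b = b} u 1≤b 7b≤ none D with trim-degrees G 1≤b D
  ... | S , _ , half , degree = S , half , record
    { 1≤d = ℕ.≤-trans 1≤b (ℕ.m≤m+n b _) ; d≤u = 7b≤
    ; deg = λ v v∈ → ℕ.≤-trans (size-mono (sub λ x → mem? S x ×-dec near? (side β) v x)
        (sub λ x → mem? S x ×-dec ((v ≟ x) ⊎-dec (¬? (v ≟ x) ×-dec E? G β v x))) λ x (sx , nr) → sx , near-side β nr) (degree v∈)
    ; coh = coherent }
    where
    coherent : ∀ A B → A ⊑ S → B ⊑ S → u ℕ.≤ size A → u ℕ.≤ size B → ∃[ a ] ∃[ b ] A ∋ a × B ∋ b × Near (side β) a b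
    coherent A B _ _ uA uB with any? (λ a → any? λ b → mem? A a ×-dec (mem? B b ×-dec near? (side β) a b))
    ... | yes p = p
    ... | no ¬p = contradiction (toSubset A , toSubset B , ℕ.≤-trans uA (ℕ.≤-reflexive (sym (∣toSubset∣ A)))
                                , ℕ.≤-trans uB (ℕ.≤-reflexive (sym (∣toSubset∣ B))) , pure) none
      where
      far : ∀ {x y} → x ∈ˢ toSubset A → y ∈ˢ toSubset B → Far (side β) x y
      far x∈ y∈ nr = ¬p (_ , _ , toSubset⁻ A x∈ , toSubset⁻ B y∈ , nr)
      empty : Empty (toSubset A ∩ˢ toSubset B)
      empty (x , x∈) = let (a , b) = x∈p∩q⁻ (toSubset A) (toSubset B) x∈ in far a b (inj₁ refl)
      pure : Complete G (toSubset A) (toSubset B) ⊎ Anticomplete G (toSubset A) (toSubset B)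
      pure = orient β refl
        where
        orient : ∀ β′ → β ≡ β′ → Complete G (toSubset A) (toSubset B) ⊎ Anticomplete G (toSubset A) (toSubset B)
        orient true  refl = inj₂ (empty , λ x y x∈ y∈ → far x∈ y∈ ∘ inj₂)
        orient false refl = inj₁ (empty , λ x y x∈ y∈ → [ (λ { (() , _) }) , proj₂ ]′ (far-side false (far x∈ y∈)))

  -- Complementing both graphs preserves induced copies. The double negation of adjacency is removed
  -- by inspecting its Boolean value.
  co-subdivision : ∀ {h} {H : Graph h} → ContainsSubdivision H (complement G) → ContainsCoSubdivision H G
  co-subdivision (m , J , sd , f , inj , iff) = m , J , sd , f , inj , λ x y → mk⇔ (to x y) (from x y)
    where
    J⇔ : ∀ {x y} → Adj (complement J) x y ⇔ (x ≢ y × ¬ Adj J x y)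
    J⇔ = mk⇔ toWitness fromWitness
    to : ∀ x y → Adj (complement J) x y → Adj G (f x) (f y)
    to x y a = go (Graph.adj G (f x) (f y)) refl
      where
      go : ∀ c → Graph.adj G (f x) (f y) ≡ c → Adj G (f x) (f y)
      go true  e = Equivalence.from T-≡ e
      go false e = contradiction (Equivalence.from (iff x y) (Equivalence.from complement⇔
                     ((λ fe → proj₁ (Equivalence.to J⇔ a) (inj fe)) , subst T e))) (proj₂ (Equivalence.to J⇔ a))
    from : ∀ x y → Adj G (f x) (f y) → Adj (complement J) x y
    from x y a = Equivalence.from J⇔ ((λ where refl → Graph.adj-irrefl G _ a) , λ j → proj₂ (Equivalence.to complement⇔ (Equivalence.to (iff x y) j)) a)

-- Induced 3-subdivisions

module Pattern (h : ℕ) where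

  -- Branch vertices x and, for all y and z, the neighbour of y on the path of length three from y to z.
  Vtx : Set
  Vtx = Fin h ⊎ (Fin h × Fin h)

  q : ℕ
  q = h ℕ.+ h ℕ.* h

  decode : Fin q → Vtx
  decode i = [ inj₁ , inj₂ ∘ remQuot h ]′ (splitAt h i)

  encode : Vtx → Fin q
  encode (inj₁ x)       = x ↑ˡ (h ℕ.* h)
  encode (inj₂ (y , z)) = h ↑ʳ combine y z

  decode-encode : ∀ v → decode (encode v) ≡ v
  decode-encode (inj₁ x)       = cong [ inj₁ , inj₂ ∘ remQuot h ]′ (splitAt-↑ˡ h x (h ℕ.* h))
  decode-encode (inj₂ (y , z)) = trans (cong [ inj₁ , inj₂ ∘ remQuot h ]′ (splitAt-↑ʳ h (h ℕ.* h) (combine y z))) (cong inj₂ (remQuot-combine y z))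

  pat : Vtx → Vtx → Bool
  pat (inj₁ x)       (inj₁ y)         = false
  pat (inj₁ x)       (inj₂ (y , z))   = does (x ≟ y)
  pat (inj₂ (y , z)) (inj₁ x)         = does (x ≟ y)
  pat (inj₂ (y , z)) (inj₂ (y′ , z′)) = does ((y ≟ z′) ×-dec (z ≟ y′))

  pat-sym : ∀ v w → pat v w ≡ pat w v
  pat-sym (inj₁ x)       (inj₁ y)         = refl
  pat-sym (inj₁ x)       (inj₂ (y , z))   = refl
  pat-sym (inj₂ (y , z)) (inj₁ x)         = refl
  pat-sym (inj₂ (y , z)) (inj₂ (y′ , z′)) = does-⇔ (mk⇔ (λ (a , b) → sym b , sym a) (λ (a , b) → sym b , sym a)) ((y ≟ z′) ×-dec (z ≟ y′)) ((y′ ≟ z) ×-dec (z′ ≟ y))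

  -- This is the 3-subdivision of the complete graph on `Fin h`, with a pendant vertex `(y , y)` at
  -- each `y`; its copies contain the 3-subdivision of every `H` on `Fin h`. The diagonal is
  -- immaterial, since `Embedding` compares only `i < j`.
  Q : Fin q → Fin q → Bool
  Q i j = pat (decode i) (decode j)

  module _ {n : ℕ} (G : Graph n) (H : Graph h) where

    copy⇒subdivision : Copy G Q → ContainsSubdivision H G
    copy⇒subdivision (C , (f , f∈ , adj) , dis) = contains-subdivision G H (F ∘ inj₁)
      (λ {x} {y} e → inj₁-inj (F-inj {inj₁ x} {inj₁ y} e))
      (λ {x} {y} ne → farF {inj₁ x} {inj₁ y} (ne ∘ inj₁-inj) refl) U path
      (λ {e} x → [ (λ p r → U≢b {x} (trans (sym p) r)) , (λ p r → U≢b {x} (trans (sym p) r)) ]′)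
      (λ {e} {v} {x} u nl nh → [ (λ where refl → farF {inj₂ (Edge.lo e , Edge.hi e)} {inj₁ x} (λ ()) (dec-false (x ≟ Edge.lo e) nl))
                               , (λ where refl → farF {inj₂ (Edge.hi e , Edge.lo e)} {inj₁ x} (λ ()) (dec-false (x ≟ Edge.hi e) nh)) ]′ u)
      U-U
      where
      F : Vtx → Fin n
      F = f ∘ encode
      inj₁-inj : ∀ {x y : Fin h} → inj₁ {B = Fin h × Fin h} x ≡ inj₁ y → x ≡ y
      inj₁-inj refl = refl
      f-inj : ∀ {i j} → f i ≡ f j → i ≡ j
      f-inj {i} {j} e with i ≟ j
      ... | yes p = p
      ... | no ne = ⊥-elim (dis ne (f∈ i) (subst (C j ∋_) (sym e) (f∈ j)))
      F-inj : ∀ {v w} → F v ≡ F w → v ≡ w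
      F-inj {v} {w} e = trans (sym (decode-encode v)) (trans (cong decode (f-inj e)) (decode-encode w))
      adjF : ∀ v w → v ≢ w → Graph.adj G (F v) (F w) ≡ pat v w
      adjF v w ne with <-cmp (encode v) (encode w)
      ... | tri< lt _ _ = trans (adj lt) (cong₂ pat (decode-encode v) (decode-encode w))
      ... | tri≈ _ e _  = contradiction (trans (sym (decode-encode v)) (trans (cong decode e) (decode-encode w))) ne
      ... | tri> _ _ gt = trans (adj-symᵇ G (F v) (F w)) (trans (adj gt) (trans (cong₂ pat (decode-encode w) (decode-encode v)) (pat-sym w v)))
      farF : ∀ {v w} → v ≢ w → pat v w ≡ false → Far G (F v) (F w)
      farF ne e (inj₁ eq) = ne (F-inj eq)
      farF {v} {w} ne e (inj₂ a) = subst T (trans (adjF v w ne) e) a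
      joinF : ∀ v w → v ≢ w → pat v w ≡ true → Adj G (F v) (F w)
      joinF v w ne e = Equivalence.from T-≡ (trans (adjF v w ne) e)
      U≢b : ∀ {x yz} → F (inj₂ yz) ≢ F (inj₁ x)
      U≢b {x} {yz} r = case F-inj {inj₂ yz} {inj₁ x} r of λ ()
      U : Edge H → Fin n → Set
      U e v = v ≡ F (inj₂ (Edge.lo e , Edge.hi e)) ⊎ v ≡ F (inj₂ (Edge.hi e , Edge.lo e))
      apart : ∀ {v w} → v ≢ w → pat v w ≡ false → ¬ Adj G (F v) (F w) × F v ≢ F w
      apart ne e = farF ne e ∘ inj₂ , farF ne e ∘ inj₁
      path : ∀ e → OddFuzzy G (F (inj₁ (Edge.lo e))) (F (inj₁ (Edge.hi e))) (U e)
      path e = plain G (F (inj₂ (x , y)) ∷ F (inj₂ (y , x)) ∷ F (inj₁ y) ∷ [])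
        ( joinF (inj₁ x) (inj₂ (x , y)) (λ ()) (dec-true (x ≟ x) refl)
        , apart {inj₁ x} {inj₂ (y , x)} (λ ()) (dec-false (x ≟ y) x≢y) ∷ apart {inj₁ x} {inj₁ y} (x≢y ∘ inj₁-inj) refl ∷ []
        , joinF (inj₂ (x , y)) (inj₂ (y , x)) (λ e′ → x≢y (fst e′)) (dec-true ((x ≟ x) ×-dec (y ≟ y)) (refl , refl))
        , apart {inj₂ (x , y)} {inj₁ y} (λ ()) (dec-false (y ≟ x) (x≢y ∘ sym)) ∷ []
        , joinF (inj₂ (y , x)) (inj₁ y) (λ ()) (dec-true (y ≟ y) refl)
        , [] , tt )
        (there (there (there here)))
        (inj₂ (inj₁ refl) ∷ inj₁ (inj₁ refl) ∷ inj₁ (inj₂ refl) ∷ inj₂ (inj₂ refl) ∷ []) refl (s≤s (s≤s z≤n))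
        where
        x = Edge.lo e
        y = Edge.hi e
        x≢y : x ≢ y
        x≢y = <⇒≢ (Edge.lo<hi e)
        fst : ∀ {a b c d : Fin h} → inj₂ {A = Fin h} (a , b) ≡ inj₂ (c , d) → a ≡ c
        fst refl = refl
      clash : ∀ {e e′ : Edge H} → e ≢ e′ → ¬ (Edge.lo e ≡ Edge.lo e′ × Edge.hi e ≡ Edge.hi e′)
      clash ne (p , r) = ne (edge-≡ p r)
      cross : ∀ (e e′ : Edge H) → ¬ (Edge.lo e ≡ Edge.hi e′ × Edge.hi e ≡ Edge.lo e′)
      cross e e′ (p , r) = <-asym (Edge.lo<hi e) (subst₂ Fin._<_ (sym r) (sym p) (Edge.lo<hi e′))
      two : ∀ {a b c d : Fin h} → ¬ (a ≡ c × b ≡ d) → ¬ (a ≡ d × b ≡ c) → Far G (F (inj₂ (a , b))) (F (inj₂ (c , d)))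
      two {a} {b} {c} {d} n₁ n₂ = farF {inj₂ (a , b)} {inj₂ (c , d)} (λ where refl → n₁ (refl , refl)) (dec-false ((a ≟ d) ×-dec (b ≟ c)) n₂)
      U-U : ∀ {e e′ v w} → e ≢ e′ → U e v → U e′ w → Far G v w
      U-U {e} {e′} ne (inj₁ refl) (inj₁ refl) = two (clash ne) (cross e e′)
      U-U {e} {e′} ne (inj₁ refl) (inj₂ refl) = two (cross e e′) (clash ne)
      U-U {e} {e′} ne (inj₂ refl) (inj₁ refl) = two (λ (p , r) → cross e e′ (r , p)) (λ (p , r) → clash ne (r , p))
      U-U {e} {e′} ne (inj₂ refl) (inj₂ refl) = two (λ (p , r) → clash ne (r , p)) (λ (p , r) → cross e e′ (r , p))

-- The rational bound and the conclusion

scaled-≤ : ∀ e n k → n ℕ.≤ suc e ℕ.* k → (+ 1 / suc e) * fromNat n ≤ fromNat k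
scaled-≤ e n k le = ℚ.toℚᵘ-cancel-≤ (begin
  toℚᵘ ((+ 1 / suc e) * fromNat n)           ≃⟨ ℚ.toℚᵘ-homo-* (+ 1 / suc e) (fromNat n) ⟩
  toℚᵘ (+ 1 / suc e) ℚᵘ.* toℚᵘ (fromNat n)   ≃⟨ ℚᵘ.*-cong (ℚ.toℚᵘ-fromℚᵘ (mkℚᵘ (+ 1) e)) (ℚ.toℚᵘ-fromℚᵘ (mkℚᵘ (+ n) 0)) ⟩
  mkℚᵘ (+ 1) e ℚᵘ.* mkℚᵘ (+ n) 0             ≤⟨ *≤* core ⟩
  mkℚᵘ (+ k) 0                               ≃⟨ ℚᵘ.≃-sym (ℚ.toℚᵘ-fromℚᵘ (mkℚᵘ (+ k) 0)) ⟩
  toℚᵘ (fromNat k)                           ∎)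
  where
  open ℚᵘ.≤-Reasoning
  core : (+ 1 ℤ.* + n) ℤ.* + 1 ℤ.≤ + k ℤ.* + (suc e ℕ.* 1)
  core = subst₂ ℤ._≤_ (sym (trans (ℤ.*-identityʳ (+ 1 ℤ.* + n)) (ℤ.*-identityˡ (+ n))))
    (trans (cong +_ (trans (ℕ.*-comm (suc e) k) (cong (k ℕ.*_) (sym (ℕ.*-identityʳ (suc e)))))) (ℤ.pos-* k (suc e ℕ.* 1))) (ℤ.+≤+ le)

module Conclude {h : ℕ} (H : Graph h) (g L : ℕ)
  (main : ∀ {n} (Γ : Graph n) {V₀ : Sub n} {d u} → Sparse Γ V₀ d u → suc g ℕ.* (suc g ℕ.* d) ℕ.≤ u → L ℕ.* u ℕ.≤ size V₀ → ContainsSubdivision H Γ)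
  (c₀ : ℕ)
  (ramsey : ∀ {n} (G : Graph n) b Z → 1 ℕ.≤ b → c₀ ℕ.* b ℕ.≤ size Z →
            Copy G (Pattern.Q h) ⊎ Degenerate G true (2 ℕ.* (L ℕ.* (suc g ℕ.* suc g ℕ.* 7))) b Z ⊎ Degenerate G false (2 ℕ.* (L ℕ.* (suc g ℕ.* suc g ℕ.* 7))) b Z)
  where

  open Pattern h

  -- With `d = 7 * b`, the factor `Λ` between `d` and `u` makes the graph thin, and half of `m * b`
  -- is `L * u`. `c` is positive so that `b = n ÷ c` makes sense, and `e = c + c` because rounding
  -- down loses at most a factor two once `b` is positive.
  Λ m c e : ℕ
  Λ = suc g ℕ.* suc g
  m = 2 ℕ.* (L ℕ.* (Λ ℕ.* 7))
  c = suc c₀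
  e = c ℕ.+ c

  Goal : ∀ {n} → Graph n → Set
  Goal {n} G = ∃[ A ] ∃[ B ] ((+ 1 / suc e) * fromNat n ≤ fromNat ∣ A ∣) × ((+ 1 / suc e) * fromNat n ≤ fromNat ∣ B ∣) × (Complete G A B ⊎ Anticomplete G A B)

  -- For `n ≤ suc e` the required size is at most one, so two distinct vertices suffice.
  single : ∀ n → 1 ℕ.< n → (G : Graph n) → n ℕ.≤ suc e → Goal G
  single (suc zero) (s≤s ()) G le
  single (suc (suc n)) _ G le = ⁅ zero ⁆ , ⁅ suc zero ⁆ , bound zero , bound (suc zero) , pure
    where
    bound : ∀ (v : Fin (suc (suc n))) → (+ 1 / suc e) * fromNat (suc (suc n)) ≤ fromNat ∣ ⁅ v ⁆ ∣
    bound v = scaled-≤ e (suc (suc n)) ∣ ⁅ v ⁆ ∣ (ℕ.≤-trans le (ℕ.≤-reflexive (sym (trans (cong (suc e ℕ.*_) (∣⁅x⁆∣≡1 v)) (ℕ.*-identityʳ (suc e))))))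
    disjoint : Empty (⁅ zero ⁆ ∩ˢ ⁅ suc zero ⁆)
    disjoint (x , x∈) with x∈p∩q⁻ (⁅ zero ⁆) (⁅ suc zero ⁆) x∈
    ... | a , b with x∈⁅y⁆⇒x≡y zero a | x∈⁅y⁆⇒x≡y (suc zero) b
    ...   | refl | ()
    pure : Complete G ⁅ zero ⁆ ⁅ suc zero ⁆ ⊎ Anticomplete G ⁅ zero ⁆ ⁅ suc zero ⁆
    pure with Graph.adj G zero (suc zero) in eq
    ... | true  = inj₁ (disjoint , λ x y x∈ y∈ → subst₂ (Adj G) (sym (x∈⁅y⁆⇒x≡y zero x∈)) (sym (x∈⁅y⁆⇒x≡y (suc zero) y∈)) (Equivalence.from T-≡ eq))
    ... | false = inj₂ (disjoint , λ x y x∈ y∈ a → subst T eq (subst₂ (Adj G) (x∈⁅y⁆⇒x≡y zero x∈) (x∈⁅y⁆⇒x≡y (suc zero) y∈) a))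
  module Large {n} (G : Graph n) (noH : ¬ ContainsSubdivision H G) (noCo : ¬ ContainsCoSubdivision H G) (large : ¬ (n ℕ.≤ suc e)) where

    b u : ℕ
    b = n ÷ c
    u = Λ ℕ.* (7 ℕ.* b)
    e≤n : suc e ℕ.≤ n
    e≤n = ℕ.≰⇒≥ large
    1≤b : 1 ℕ.≤ b
    1≤b = m≥n⇒m/n>0 (ℕ.≤-trans (ℕ.≤-trans (ℕ.m≤m+n c c) (ℕ.n≤1+n e)) e≤n)
    bc≤n : c ℕ.* b ℕ.≤ n
    bc≤n = ℕ.≤-trans (ℕ.≤-reflexive (ℕ.*-comm c b)) (m/n*n≤m n c)
    7b≤u : 7 ℕ.* b ℕ.≤ u
    7b≤u = ℕ.m≤m+n (7 ℕ.* b) _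
    n≤eu : n ℕ.≤ suc e ℕ.* u
    n≤eu = begin
      n                        ≡⟨ m≡m%n+[m/n]*n n c ⟩
      n % c ℕ.+ b ℕ.* c        ≤⟨ ℕ.+-monoˡ-≤ (b ℕ.* c) (ℕ.≤-trans (ℕ.<⇒≤ (m%n<n n c)) (ℕ.≤-trans (ℕ.≤-reflexive (sym (ℕ.*-identityˡ c))) (ℕ.*-monoˡ-≤ c 1≤b))) ⟩
      b ℕ.* c ℕ.+ b ℕ.* c      ≡⟨ sym (ℕ.*-distribˡ-+ b c c) ⟩
      b ℕ.* e                  ≡⟨ ℕ.*-comm b e ⟩
      e ℕ.* b                  ≤⟨ ℕ.*-mono-≤ (ℕ.n≤1+n e) (ℕ.≤-trans (ℕ.m≤m+n b _) 7b≤u) ⟩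
      suc e ℕ.* u              ∎
      where open ℕ.≤-Reasoning
    enough : ∀ k → u ℕ.≤ k → (+ 1 / suc e) * fromNat n ≤ fromNat k
    enough k u≤k = scaled-≤ e n k (ℕ.≤-trans n≤eu (ℕ.*-monoʳ-≤ (suc e) u≤k))
    everything : Sub n
    everything = sub {Mem = λ _ → ⊤} λ _ → yes tt
    thin : suc g ℕ.* (suc g ℕ.* (7 ℕ.* b)) ℕ.≤ u
    thin = ℕ.≤-reflexive (sym (ℕ.*-assoc (suc g) (suc g) (7 ℕ.* b)))
    big : ∀ {k} → m ℕ.* b ℕ.≤ 2 ℕ.* k → L ℕ.* u ℕ.≤ k
    big {k} le = ℕ.*-cancelˡ-≤ 2 (begin
      2 ℕ.* (L ℕ.* (Λ ℕ.* (7 ℕ.* b)))   ≡⟨ cong (λ z → 2 ℕ.* (L ℕ.* z)) (sym (ℕ.*-assoc Λ 7 b)) ⟩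
      2 ℕ.* (L ℕ.* (Λ ℕ.* 7 ℕ.* b))     ≡⟨ cong (2 ℕ.*_) (sym (ℕ.*-assoc L (Λ ℕ.* 7) b)) ⟩
      2 ℕ.* (L ℕ.* (Λ ℕ.* 7) ℕ.* b)     ≡⟨ sym (ℕ.*-assoc 2 (L ℕ.* (Λ ℕ.* 7)) b) ⟩
      m ℕ.* b                           ≤⟨ le ⟩
      2 ℕ.* k                           ∎)
      where open ℕ.≤-Reasoning
    found : ∀ {β} → ¬ (∃[ A ] ∃[ B ] PurePair G u A B) → Degenerate G β m b everything → ContainsSubdivision H (side G β)
    found {β} none D = let (S , half , sp) = sparse-side G u 1≤b 7b≤u none D in main (side G β) sp thin (big half)
    decide : Dec (∃[ A ] ∃[ B ] PurePair G u A B) → Goal G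
    decide (yes (A , B , uA , uB , pure)) = A , B , enough _ uA , enough _ uB , pure
    decide (no none) with ramsey G b everything 1≤b
      (ℕ.≤-trans (ℕ.*-monoˡ-≤ b (ℕ.n≤1+n c₀)) (ℕ.≤-trans bc≤n (size-all everything λ _ → tt)))
    ... | inj₁ copy       = contradiction (copy⇒subdivision G H copy) noH
    ... | inj₂ (inj₁ D)   = contradiction (found none D) noH
    ... | inj₂ (inj₂ D)   = contradiction (co-subdivision G (found none D)) noCo

  pairs : ∀ n → 1 ℕ.< n → (G : Graph n) → ¬ ContainsSubdivision H G → ¬ ContainsCoSubdivision H G → Goal G
  pairs n 1<n G noH noCo with n ℕ.≤? suc e
  ... | yes small = single n 1<n G small
  ... | no large  = Large.decide G noH noCo large (pure-pair? G (Large.u G noH noCo large))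

theorem1p3 : ∀ (h : ℕ) (H : Graph h) →
    ∃[ ε ] 0ℚ < ε ×
    (∀ (n : ℕ) → 1 ℕ.< n → (G : Graph n) →
    ¬ ContainsSubdivision H G →
    ¬ ContainsCoSubdivision H G →
    ∃[ A ] ∃[ B ]
    (ε * fromNat n ≤ fromNat ∣ A ∣) ×
    (ε * fromNat n ≤ fromNat ∣ B ∣) ×
    (Complete G A B ⊎ Anticomplete G A B))
theorem1p3 h H = let (g , L , main) = sparse-case H
                     (c₀ , ramsey) = rödl-constant (Pattern.Q h) (2 ℕ.* (L ℕ.* (suc g ℕ.* suc g ℕ.* 7)))
                     e = suc c₀ ℕ.+ suc c₀
                 in + 1 / suc e , ℚ.positive⁻¹ (+ 1 / suc e) ⦃ ℚ.normalize-pos 1 (suc e) ⦄ , Conclude.pairs H g L main c₀ ramsey
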